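{- Let $\sigma$ be a primitive substitution on a finite alphabet $\mathcal A=\{a_1,\dots,a_k\}$ with $k\ge2$, and let $w=w_0w_1w_2\ldots$ be a one-sided infinite fixed point of $\sigma$. The following are equivalent: (i) $w$ is not eventually periodic (i.e. $\sigma$ is aperiodic); (ii) there exists $1\le i\le k$ such that $C_{a_i}(X)$ is transcendental over $\mathbb{Q}(X)$; (iii) there exist $1\le i<j\le k$ such that $C_{a_i}(X)$ and $C_{a_j}(X)$ are both transcendental over $\mathbb{Q}(X)$; (iv) there exists $1\le i\le k$ such that $P_{a_i}(X)$ is transcendental over $\mathbb{Q}(X)$; (v) there exist $1\le i<j\le k$ such that $P_{a_i}(X)$ and $P_{a_j}(X)$ are both transcendental over $\mathbb{Q}(X)$.
   Context: A substitution on $\mathcal A$ is a map $\sigma$ from $\mathcal A$ to non-empty finite words over $\mathcal A$, extended to (finite and infinite) words by concatenation. Its matrix $A_\sigma$ has $(i,j)$ entry equal to the number of $a_j$ in $\sigma(a_i)$; $\sigma$ is primitive if some power of $A_\sigma$ has all entries positive. $w$ is a fixed point if $\sigma(w)=w$. A word $w$ is eventually periodic if there exist $N$, $d\ge1$ with $w_{n+d}=w_n$ for all $n\ge N$; $\sigma$ is called aperiodic if it has a one-sided infinite fixed word which is not eventually periodic. Positions are indexed from $0$. $C_{a_i}(X)=\sum_{n\ge0}1_{a_i}(w_n)X^n$, where $1_{a_i}$ is the indicator of $a_i$; for $n\ge1$, $p_i(n)$ is the position of the $n$-th occurrence of $a_i$ in $w$, and $P_{a_i}(X)=\sum_{n\ge1}p_i(n)X^n$.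 Transcendence over $\mathbb{Q}(X)$ is meant inside $\mathbb{C}((X))$. -}

module Defs where

open import Algebra.Bundles using (CommutativeRing)
import Algebra.Properties.Semiring.Sum as Sum
open import Data.Bool using (if_then_else_)
open import Data.Fin using (Fin; zero; suc; toℕ; _≟_)
open import Data.Integer using (+_)
open import Data.List using (List; []; _∷_; length; filter; applyUpTo)
open import Data.List.Membership.Propositional using (_∈_)
open import Data.List.NonEmpty using (List⁺; _∷_; toList)
open import Data.List.Properties using (applyUpTo-∷ʳ; filter-++; length-++)
open import Data.List.Relation.Unary.All using (All)
open import Data.List.Relation.Unary.Any using (Any; here; there)
open import Data.Nat as ℕ using (ℕ; zero; suc; _≤_; _<_; _≥_; _∸_; z≤n; s≤s)
open import Data.Nat.Properties using (≤-refl; ≤-trans; m≤n⇒m≤o+n; m+[n∸m]≡n; +-identityʳ; +-suc; +-comm; +-*-semiring; *-zeroʳ)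
open import Data.Product using (∃; ∃₂; _×_; _,_; proj₁; proj₂)
open import Data.Rational as ℚ using (ℚ; 0ℚ; 1ℚ; _/_)
import Data.Rational.Properties as ℚₚ
open import Function using (_∘_)
open import Relation.Binary.PropositionalEquality using (_≡_; _≢_; refl; sym; trans; cong; subst)
open import Relation.Nullary using (¬_; yes; no; does; contradiction)

private
  module Σℕ = Sum +-*-semiring
  module Σℚ = Sum (CommutativeRing.semiring ℚₚ.+-*-commutativeRing)

-- The alphabet {a₁,…,a_k} is Fin k.
Word : ℕ → Set
Word k = List (Fin k)

InfWord : ℕ → Set
InfWord k = ℕ → Fin k

Substitution : ℕ → Set
Substitution k = Fin k → List⁺ (Fin k)

occ : ∀ {k} → Fin k → Word k → ℕ
occ a u = length (filter (a ≟_) u)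

-- The n-th letter of the infinite concatenation (a ∷ as) u₀ u₁ u₂ …
concatFrom : ∀ {A : Set} → List⁺ A → (ℕ → List⁺ A) → ℕ → A
concatFrom (a ∷ as)       u zero    = a
concatFrom (a ∷ [])       u (suc n) = concatFrom (u 0) (u ∘ suc) n
concatFrom (a ∷ (b ∷ bs)) u (suc n) = concatFrom (b ∷ bs) u n

concatω : ∀ {A : Set} → (ℕ → List⁺ A) → ℕ → A
concatω u = concatFrom (u 0) (u ∘ suc)

applyω : ∀ {k} → Substitution k → InfWord k → InfWord k
applyω σ w = concatω (σ ∘ w)

FixedPoint : ∀ {k} → Substitution k → InfWord k → Set
FixedPoint σ w = ∀ n → applyω σ w n ≡ w n

EventuallyPeriodic : ∀ {k} → InfWord k → Set
EventuallyPeriodic w = ∃₂ λ N d → d ≥ 1 × (∀ n → n ≥ N → w (n ℕ.+ d) ≡ w n)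

Aperiodic : ∀ {k} → Substitution k → Set
Aperiodic σ = ∃ λ w → FixedPoint σ w × ¬ EventuallyPeriodic w

Matrix : ℕ → Set
Matrix k = Fin k → Fin k → ℕ

identity : ∀ {k} → Matrix k
identity i j = if does (i ≟ j) then 1 else 0

_⊗_ : ∀ {k} → Matrix k → Matrix k → Matrix k
(A ⊗ B) i j = Σℕ.sum (λ l → A i l ℕ.* B l j)

power : ∀ {k} → Matrix k → ℕ → Matrix k
power A zero    = identity
power A (suc r) = A ⊗ power A r

matrix : ∀ {k} → Substitution k → Matrix k
matrix σ i j = occ j (toList (σ i))

Primitive : ∀ {k} → Substitution k → Set
Primitive σ = ∃ λ r → ∀ i j → 0 < power (matrix σ) r i j

-- w_m is the n-th occurrence of a (n counted from 1, m from 0).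
IsPosition : ∀ {k} → InfWord k → Fin k → ℕ → ℕ → Set
IsPosition w a n m = w m ≡ a × n ≡ suc (occ a (applyUpTo w m))

private
  concatFrom-∈ : ∀ {A : Set} {c : A} v u → c ∈ toList v → ∃ λ n → concatFrom v u n ≡ c
  concatFrom-∈ (a ∷ as)       u (here refl) = 0 , refl
  concatFrom-∈ (a ∷ (b ∷ bs)) u (there c∈)  with concatFrom-∈ (b ∷ bs) u c∈
  ... | n , eq = suc n , eq

  concatFrom-skip : ∀ {A : Set} (a : A) as u n →
                    concatFrom (a ∷ as) u (suc (length as) ℕ.+ n) ≡ concatω u n
  concatFrom-skip a []       u n = refl
  concatFrom-skip a (b ∷ bs) u n = concatFrom-skip b bs u n

  concatω-∈ : ∀ {A : Set} {c : A} u m → c ∈ toList (u m) → ∃ λ n → m ≤ n × concatω u n ≡ c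
  concatω-∈ u zero c∈ with concatFrom-∈ (u 0) (u ∘ suc) c∈
  ... | n , eq = n , z≤n , eq
  concatω-∈ u (suc m) c∈ with u 0 | concatω-∈ (u ∘ suc) m c∈
  ... | a ∷ as | n , m≤n , eq =
    suc (length as) ℕ.+ n , s≤s (m≤n⇒m≤o+n (length as) m≤n) ,
    trans (concatFrom-skip a as (u ∘ suc) n) eq

  occ>0⇒∈ : ∀ {k} (c : Fin k) u → 0 < occ c u → c ∈ u
  occ>0⇒∈ c (b ∷ u) p with c ≟ b
  ... | yes c≡b = here c≡b
  ... | no  _   = there (occ>0⇒∈ c u p)

  sum>0 : ∀ {n} (f : Fin n → ℕ) → 0 < Σℕ.sum f → ∃ λ l → 0 < f l
  sum>0 {suc n} f p with f zero in eq
  ... | suc x = zero , subst (0 <_) (sym eq) (s≤s z≤n)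
  ... | zero  with sum>0 (f ∘ suc) p
  ...   | l , q = suc l , q

  *>0 : ∀ x y → 0 < x ℕ.* y → 0 < x × 0 < y
  *>0 (suc x) (suc y) p = s≤s z≤n , s≤s z≤n
  *>0 (suc x) zero    p = contradiction (subst (0 <_) (*-zeroʳ x) p) λ ()

  reach : ∀ {k} (σ : Substitution k) w → FixedPoint σ w → ∀ r a m →
          0 < power (matrix σ) r (w m) a → ∃ λ n → m ≤ n × w n ≡ a
  reach σ w fix zero a m p with w m ≟ a
  ... | yes eq = m , ≤-refl , eq
  reach σ w fix (suc r) a m p
    with c , q ← sum>0 (λ l → matrix σ (w m) l ℕ.* power (matrix σ) r l a) p
    with q₁ , q₂ ← *>0 (matrix σ (w m) c) _ q
    with n , m≤n , eq ← concatω-∈ (σ ∘ w) m (occ>0⇒∈ c _ q₁)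
    with n′ , n≤n′ , eq′ ← reach σ w fix r a n
           (subst (λ b → 0 < power (matrix σ) r b a) (trans (sym eq) (fix n)) q₂)
    = n′ , ≤-trans m≤n n≤n′ , eq′

  occ-∷ʳ : ∀ {k} (a : Fin k) w m →
           occ a (applyUpTo w (suc m)) ≡ occ a (applyUpTo w m) ℕ.+ occ a (w m ∷ [])
  occ-∷ʳ a w m = trans (cong (occ a) (sym (applyUpTo-∷ʳ w m)))
    (trans (cong length (filter-++ (a ≟_) (applyUpTo w m) (w m ∷ [])))
           (length-++ (filter (a ≟_) (applyUpTo w m))))

  occ-yes : ∀ {k} (a : Fin k) w m → w m ≡ a →
            occ a (applyUpTo w (suc m)) ≡ suc (occ a (applyUpTo w m))
  occ-yes a w m eq with a ≟ w m | occ-∷ʳ a w m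
  ... | yes _ | e = trans e (+-comm _ 1)
  ... | no ¬p | _ = contradiction (sym eq) ¬p

  occ-no : ∀ {k} (a : Fin k) w m → w m ≢ a →
           occ a (applyUpTo w (suc m)) ≡ occ a (applyUpTo w m)
  occ-no a w m neq with a ≟ w m | occ-∷ʳ a w m
  ... | yes p | _ = contradiction (sym p) neq
  ... | no _  | e = trans e (+-identityʳ _)

  first : ∀ {k} (a : Fin k) w d m → w (m ℕ.+ d) ≡ a →
          ∃ λ n → w n ≡ a × occ a (applyUpTo w n) ≡ occ a (applyUpTo w m)
  first a w d m eq with w m ≟ a
  first a w d       m eq | yes p = m , p , refl
  first a w zero    m eq | no ¬p = contradiction (subst (λ x → w x ≡ a) (+-identityʳ m) eq) ¬p
  first a w (suc d) m eq | no ¬p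
    with n , e , e′ ← first a w d (suc m) (subst (λ x → w x ≡ a) (+-suc m d) eq)
    = n , e , trans e′ (occ-no a w m ¬p)

  next : ∀ {k} (σ : Substitution k) → Primitive σ → ∀ w → FixedPoint σ w → ∀ a m →
         ∃ λ n → w n ≡ a × occ a (applyUpTo w n) ≡ occ a (applyUpTo w m)
  next σ (r , pos) w fix a m with reach σ w fix r a m (pos (w m) a)
  ... | n , m≤n , eq = first a w (n ∸ m) m (subst (λ x → w x ≡ a) (sym (m+[n∸m]≡n m≤n)) eq)

-- By primitivity every letter occurs infinitely often in a fixed point.
position-exists : ∀ {k} (σ : Substitution k) → Primitive σ → ∀ w → FixedPoint σ w →
                  ∀ a n → ∃ (IsPosition w a (suc n))
position-exists σ prim w fix a zero with next σ prim w fix a 0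
... | m , eq , e = m , eq , cong suc (sym e)
position-exists σ prim w fix a (suc n) with position-exists σ prim w fix a n
... | m , eq , e with next σ prim w fix a (suc m)
...   | m′ , eq′ , e′ = m′ , eq′ , cong suc (trans e (trans (sym (occ-yes a w m eq)) (sym e′)))

Series : Set
Series = ℕ → ℚ

_⊕_ : Series → Series → Series
(f ⊕ g) n = f n ℚ.+ g n

_⊛_ : Series → Series → Series
(f ⊛ g) n = Σℚ.sum {suc n} (λ j → f (toℕ j) ℚ.* g (n ∸ toℕ j))

X^_·_ : ℕ → Series → Series
(X^ zero  · f) n       = f n
(X^ suc s · f) zero    = 0ℚ
(X^ suc s · f) (suc n) = (X^ s · f) n

-- X^-⟨ s ⟩ f is the Laurent series X⁻ˢ·f; the representation is not unique,
-- and equality of Laurent series is _≈_.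
record Laurent : Set where
  constructor X^-⟨_⟩_
  field
    pole   : ℕ
    series : Series

infix 4 _≈_
_≈_ : Laurent → Laurent → Set
(X^-⟨ s ⟩ f) ≈ (X^-⟨ t ⟩ g) = ∀ n → (X^ t · f) n ≡ (X^ s · g) n

fromSeries : Series → Laurent
fromSeries f = X^-⟨ 0 ⟩ f

0L : Laurent
0L = fromSeries (λ _ → 0ℚ)

infixl 6 _+L_
_+L_ : Laurent → Laurent → Laurent
(X^-⟨ s ⟩ f) +L (X^-⟨ t ⟩ g) = X^-⟨ s ℕ.+ t ⟩ ((X^ t · f) ⊕ (X^ s · g))

infixl 7 _*L_
_*L_ : Laurent → Laurent → Laurent
(X^-⟨ s ⟩ f) *L (X^-⟨ t ⟩ g) = X^-⟨ s ℕ.+ t ⟩ (f ⊛ g)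

-- The subring ℚ[X] of ℚ[[X]].
IsPolynomial : Series → Set
IsPolynomial f = ∃ λ d → ∀ n → n ≥ d → f n ≡ 0ℚ

-- The subfield ℚ(X) of ℚ((X)): those r with r = p/q, p, q ∈ ℚ[X], q ≠ 0.
IsRationalFunction : Laurent → Set
IsRationalFunction r = ∃₂ λ p q → IsPolynomial p × IsPolynomial q ×
  ¬ (fromSeries q ≈ 0L) × fromSeries q *L r ≈ fromSeries p

-- c₀ ∷ c₁ ∷ … ∷ c_d ∷ [] is the polynomial c₀ + c₁Y + … + c_dY^d.
evalAt : Laurent → List Laurent → Laurent
evalAt y []       = 0L
evalAt y (c ∷ cs) = c +L y *L evalAt y cs

Algebraic : Laurent → Set
Algebraic y = ∃ λ cs → All IsRationalFunction cs × Any (λ c → ¬ (c ≈ 0L)) cs × evalAt y cs ≈ 0L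

-- Over ℚ(X).  For y ∈ ℚ((X)) the whole relation Σ cⱼyʲ = 0 lives in ℚ((X)),
-- so this is the same as transcendence inside ℂ((X)).
Transcendental : Series → Set
Transcendental f = ¬ Algebraic (fromSeries f)

C-series : ∀ {k} → InfWord k → Fin k → Series
C-series w a n = if does (w n ≟ a) then 1ℚ else 0ℚ

module _ {k} (σ : Substitution k) (prim : Primitive σ) (w : InfWord k) (fix : FixedPoint σ w) where

  -- position a n is the position of the (n+1)-st occurrence of a in w.
  position : Fin k → ℕ → ℕ
  position a n = proj₁ (position-exists σ prim w fix a n)

  position-correct : ∀ a n → IsPosition w a (suc n) (position a n)
  position-correct a n = proj₂ (position-exists σ prim w fix a n)

  P-series : Fin k → Series
  P-series a zero    = 0ℚ
  P-series a (suc n) = + position a n / 1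

{-# OPTIONS --safe #-}

-- Everything rests on a version of Fatou's theorem: an algebraic power series f with integer
-- coefficients of linear growth is rational.  If a is the leading coefficient of an equation of f
-- over ℚ[X], then g = a·f is integral over ℚ[X], so on the unit disc it is bounded by some B, and
-- by Parseval its coefficients, which have a common denominator, are square summable; hence g is a
-- polynomial.  Complex analysis is avoided as follows.  For a rescaled truncation p of g, the monic
-- equation bounds the ℓ¹ norm of pⁿ by C·Bⁿ.  A polynomial F with reversal G satisfies
-- ∥F²∥₂ = ∥F·G∥₂ ≥ ∥F∥₂², so that ∥p∥₂ ≤ ∥pⁿ∥₂^(1/n) for n = 2ʲ, and n → ∞ gives ∥p∥₂ ≤ B.
--
-- A rational series with finitely many values is eventually periodic, by the pigeonhole principle.
-- This applies to C_a, and to (1 - X)·P_a, whose coefficients are the gaps between consecutive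
-- occurrences of a, bounded by primitivity.  If w is not eventually periodic, then at least two of
-- its letters have an indicator sequence that is not eventually periodic.  Finally, any two fixed
-- points of σ have the same factors, so that all of them are eventually periodic or none is.

module Submission where

open import Defs
open import Algebra.Bundles using (CommutativeRing)
import Algebra.Properties.CommutativeSemiring.Exp as Exp
import Algebra.Properties.Semiring.Sum as Sum
import Algebra.Solver.Ring.NaturalCoefficients.Default as NatSolver
open import Axiom.ExcludedMiddle using (ExcludedMiddle)
open import Data.Bool using (Bool; true; false; if_then_else_)
open import Data.Fin as Fin using (Fin; zero; suc; toℕ; fromℕ<; funToFin; finToFun)
import Data.Fin.Properties as Finₚ
open import Data.Integer as ℤ using (ℤ; -[1+_])
import Data.Integer.Properties as ℤₚ
open import Data.List using (List; []; _∷_; length; map; filter; applyUpTo)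
open import Data.List.Membership.Propositional using (_∈_)
open import Data.List.NonEmpty using (List⁺; _∷_; toList)
open import Data.List.Properties using (applyUpTo-∷ʳ; filter-++; filter-accept; filter-reject; length-++; length-filter; length-applyUpTo; length-map)
open import Data.List.Relation.Binary.Pointwise using (Pointwise; []; _∷_)
open import Data.List.Relation.Unary.All using (All; []; _∷_)
open import Data.List.Relation.Unary.Any using (Any; here; there)
open import Data.Nat as ℕ using (ℕ; zero; suc; z≤n; s≤s; _∸_)
import Data.Nat.Properties as ℕₚ
open import Data.Nat.Solver using () renaming (module +-*-Solver to ℕS)
open import Data.Product using (∃; ∃₂; _×_; _,_; proj₁; proj₂)
open import Data.Rational as ℚ using (ℚ; 0ℚ; 1ℚ; mkℚ)
import Data.Rational.Properties as ℚₚ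
open import Data.Rational.Solver using (module +-*-Solver)
import Data.Rational.Unnormalised as ℚᵘ
import Data.Rational.Unnormalised.Properties as ℚᵘₚ
open import Data.Sum using (_⊎_; inj₁; inj₂)
open import Function using (_∘_)
open import Function.Bundles using (_⇔_; mk⇔)
open import Level using (0ℓ)
open import Relation.Binary.Definitions using (tri<; tri≈; tri>)
open import Relation.Binary.PropositionalEquality using (_≡_; _≢_; _≗_; refl; sym; trans; cong; cong₂; subst; subst₂; module ≡-Reasoning)
open import Relation.Nullary using (¬_; Dec; yes; no; does; contradiction)
open import Relation.Nullary.Decidable using (dec-true; dec-false; decidable-stable)
open import Algebra.Properties.Group ℚₚ.+-0-group using (∙-cancelʳ)

open +-*-Solver using (solve; _:+_; _:*_; _:-_; :-_; _:=_; con)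

-- The series g has no finite ℓ¹ norm in general, which forces truncation; but for g cut off at
-- degree N the monic equation holds only up to an error divisible by X^N. Linear growth of f bounds
-- the ℓ¹ norm of this error by some A (N+1)^D, and the substitution X ↦ rX multiplies it by at most
-- r^N. The order of the choices matters: K coefficients of g are given, then r is taken so close to
-- 1 that r^(2k) ≥ 1/2 for k < K, and only then N is taken large in terms of r. The constant C in
-- C·Bⁿ depends on N, which is harmless since n → ∞ with N fixed; B depends on the equation alone,
-- so the resulting bound is uniform in K.
--
-- P_a takes infinitely many values, but linear growth is enough for Fatou's theorem, which is
-- therefore applied to P_a itself. Only afterwards is the factor 1 - X brought in, and the
-- denominator found for P_a serves for (1 - X)·P_a too.

private module Σℕ = Sum ℕₚ.+-*-semiring

-- For infinite words this is Defs.EventuallyPeriodic by definition.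
Periodic : ∀ {A : Set} → (ℕ → A) → Set
Periodic s = ∃₂ λ N d → d ℕ.≥ 1 × (∀ n → n ℕ.≥ N → s (n ℕ.+ d) ≡ s n)

-- Infinite words and fixed points of substitutions

module _ where

  open import Data.Nat using (_+_; _*_; _^_; _≤_; _<_; _≥_)

  does-true : ∀ {P : Set} (p? : Dec P) → does p? ≡ true → P
  does-true (yes p) _ = p

  indicator : ∀ {k} → InfWord k → Fin k → ℕ → Bool
  indicator w a n = does (w n Fin.≟ a)

  period-multiple : ∀ {A : Set} {s : ℕ → A} {N d} → (∀ n → n ≥ N → s (n + d) ≡ s n) →
                    ∀ m n → n ≥ N → s (n + m * d) ≡ s n
  period-multiple {s = s} per zero n n≥N = cong s (ℕₚ.+-identityʳ n)
  period-multiple {s = s} {N} {d} per (suc m) n n≥N = trans (cong s (sym (ℕₚ.+-assoc n d (m * d))))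
    (trans (period-multiple per m (n + d) (ℕₚ.≤-trans n≥N (ℕₚ.m≤m+n n d))) (per n n≥N))

  common-period : ∀ {A : Set} {k} (s : Fin k → ℕ → A) → (∀ j → Periodic (s j)) →
                  ∃₂ λ N d → d ≥ 1 × (∀ j n → n ≥ N → s j (n + d) ≡ s j n)
  common-period {k = zero}  s p = 0 , 1 , s≤s z≤n , λ ()
  common-period {k = suc k} s p with common-period (s ∘ suc) (p ∘ suc) | p zero
  ... | N , d , d≥1 , per | N₀ , d₀ , d₀≥1 , per₀ = N₀ + N , d₀ * d , ℕₚ.*-mono-≤ d₀≥1 d≥1 , λ
    { zero    n n≥ → trans (cong (λ x → s zero (n + x)) (ℕₚ.*-comm d₀ d))
        (period-multiple per₀ d n (ℕₚ.≤-trans (ℕₚ.m≤m+n N₀ N) n≥))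
    ; (suc j) n n≥ → period-multiple (per j) d₀ n (ℕₚ.≤-trans (ℕₚ.m≤n+m N N₀) n≥) }

  -- One letter may be left out: it fills the positions left by the others.
  indicators-periodic⇒periodic : ∀ {k} (w : InfWord k) i → (∀ j → j ≢ i → Periodic (indicator w j)) → EventuallyPeriodic w
  indicators-periodic⇒periodic {k} w i per with common-period {k = k} s s-periodic
    where
    -- A constant sequence stands in for the omitted letter, so that `common-period` can run over
    -- all of `Fin k`.
    s : Fin k → ℕ → Bool
    s j with j Fin.≟ i
    ... | yes _ = λ _ → true
    ... | no  _ = indicator w j
    s-periodic : ∀ j → Periodic (s j)
    s-periodic j with j Fin.≟ i
    ... | yes _   = 0 , 1 , s≤s z≤n , λ _ _ → refl
    ... | no  j≢i = per j j≢i
  ... | N , d , d≥1 , all = N , d , d≥1 , λ n n≥N → letter n (λ j j≢i → keep j j≢i n n≥N)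
    where
    keep : ∀ j → j ≢ i → ∀ n → n ≥ N → indicator w j (n + d) ≡ indicator w j n
    keep j j≢i n n≥N with j Fin.≟ i | all j n n≥N
    ... | yes j≡i | _ = contradiction j≡i j≢i
    ... | no _    | e = e
    letter : ∀ n → (∀ j → j ≢ i → indicator w j (n + d) ≡ indicator w j n) → w (n + d) ≡ w n
    letter n same with w n Fin.≟ i
    ... | no wn≢i = does-true (w (n + d) Fin.≟ w n) (trans (same (w n) wn≢i) (dec-true (w n Fin.≟ w n) refl))
    ... | yes wn≡i with w (n + d) Fin.≟ i
    ...   | yes eq = trans eq (sym wn≡i)
    -- As w (n + d) ≠ i, the indicator of the letter w (n + d) has period d, and it is read
    -- backwards, from n + d to n.
    ...   | no neq = sym (does-true (w n Fin.≟ w (n + d))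
        (trans (sym (same (w (n + d)) neq)) (dec-true (w (n + d) Fin.≟ w (n + d)) refl)))

  -- Excluded middle turns the contrapositive of `indicators-periodic⇒periodic` into a letter.
  -- Avoiding a prescribed i lets a second call return a letter different from the first.
  aperiodic-letter : ExcludedMiddle 0ℓ → ∀ {k} (w : InfWord k) → ¬ EventuallyPeriodic w →
                     ∀ i → ∃ λ j → j ≢ i × ¬ Periodic (indicator w j)
  aperiodic-letter em w ap i with em {∃ λ j → j ≢ i × ¬ Periodic (indicator w j)}
  ... | yes p = p
  ... | no ¬p = contradiction (indicators-periodic⇒periodic w i periodic) ap
    where
    periodic : ∀ j → j ≢ i → Periodic (indicator w j)
    periodic j j≢i with em {Periodic (indicator w j)}
    ... | yes q = q
    ... | no ¬q = contradiction (j , j≢i , ¬q) ¬p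

  two-aperiodic-letters : ExcludedMiddle 0ℓ → ∀ {k} → 2 ≤ k → (w : InfWord k) → ¬ EventuallyPeriodic w →
                          ∃₂ λ i j → i Fin.< j × ¬ Periodic (indicator w i) × ¬ Periodic (indicator w j)
  two-aperiodic-letters em (s≤s _) w ap with aperiodic-letter em w ap zero
  ... | i , _ , pi with aperiodic-letter em w ap i
  ...   | j , j≢i , pj with Finₚ.<-cmp i j
  ...     | tri< i<j _ _ = i , j , i<j , pi , pj
  ...     | tri≈ _ i≡j _ = contradiction (sym i≡j) j≢i
  ...     | tri> _ _ j<i = j , i , j<i , pj , pi

  -- Occurrences of a letter and their positions

  module Count {k} (w : InfWord k) (a : Fin k) where

    count : ℕ → ℕ
    count m = occ a (applyUpTo w m)

    private
      count-∷ʳ : ∀ m → count (suc m) ≡ count m + occ a (w m ∷ [])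
      count-∷ʳ m = trans (cong (occ a) (sym (applyUpTo-∷ʳ w m)))
        (trans (cong length (filter-++ (a Fin.≟_) (applyUpTo w m) (w m ∷ []))) (length-++ (filter (a Fin.≟_) (applyUpTo w m))))

    count-hit : ∀ {m} → w m ≡ a → count (suc m) ≡ suc (count m)
    count-hit {m} eq = trans (count-∷ʳ m)
      (trans (cong (λ u → count m + length u) (filter-accept (a Fin.≟_) (sym eq))) (ℕₚ.+-comm (count m) 1))

    count-miss : ∀ {m} → w m ≢ a → count (suc m) ≡ count m
    count-miss {m} neq = trans (count-∷ʳ m)
      (trans (cong (λ u → count m + length u) (filter-reject (a Fin.≟_) (neq ∘ sym))) (ℕₚ.+-identityʳ (count m)))

    count-step : ∀ m → count m ≤ count (suc m)
    count-step m = ℕₚ.≤-trans (ℕₚ.m≤m+n (count m) _) (ℕₚ.≤-reflexive (sym (count-∷ʳ m)))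

    count-mono : ∀ {m n} → m ≤ n → count m ≤ count n
    count-mono {m} {n} m≤n = subst (λ x → count m ≤ count x) (ℕₚ.m+[n∸m]≡n m≤n) (go (n ∸ m))
      where
      go : ∀ d → count m ≤ count (m + d)
      go zero    = ℕₚ.≤-reflexive (cong count (sym (ℕₚ.+-identityʳ m)))
      go (suc d) = ℕₚ.≤-trans (go d) (ℕₚ.≤-trans (count-step (m + d)) (ℕₚ.≤-reflexive (cong count (sym (ℕₚ.+-suc m d)))))

    count-strict : ∀ {m n} → w m ≡ a → m < n → count m < count n
    count-strict eq m<n = ℕₚ.≤-trans (ℕₚ.≤-reflexive (sym (count-hit eq))) (count-mono m<n)

    count≤ : ∀ m → count m ≤ m
    count≤ m = ℕₚ.≤-trans (length-filter (a Fin.≟_) (applyUpTo w m)) (ℕₚ.≤-reflexive (length-applyUpTo w m))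

    count-injective : ∀ {m n} → w m ≡ a → w n ≡ a → count m ≡ count n → m ≡ n
    count-injective {m} {n} wm wn eq with ℕₚ.<-cmp m n
    ... | tri< m<n _ _ = contradiction eq (ℕₚ.<⇒≢ (count-strict wm m<n))
    ... | tri≈ _ m≡n _ = m≡n
    ... | tri> _ _ n<m = contradiction (sym eq) (ℕₚ.<⇒≢ (count-strict wn n<m))

    -- Sliding a window of length d by one position, beyond N, drops and gains the same letter, so
    -- it always contains as many a's as the window at N.
    count-periodic : ∀ {N d} → (∀ n → n ≥ N → w (n + d) ≡ w n) → ∀ m → m ≥ N →
                     count (m + d) ≡ count m + (count (N + d) ∸ count N)
    count-periodic {N} {d} per m m≥N = subst (λ x → count (x + d) ≡ count x + e) (ℕₚ.m+[n∸m]≡n m≥N) (go (m ∸ N))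
      where
      e = count (N + d) ∸ count N
      go : ∀ t → count (N + t + d) ≡ count (N + t) + e
      go zero rewrite ℕₚ.+-identityʳ N = sym (ℕₚ.m+[n∸m]≡n (count-mono (ℕₚ.m≤m+n N d)))
      go (suc t) rewrite ℕₚ.+-suc N t with w (N + t) Fin.≟ a
      ... | yes eq = trans (count-hit (trans (per (N + t) (ℕₚ.m≤m+n N t)) eq))
          (trans (cong suc (go t)) (cong (_+ e) (sym (count-hit eq))))
      ... | no neq = trans (count-miss (neq ∘ trans (sym (per (N + t) (ℕₚ.m≤m+n N t)))))
          (trans (go t) (cong (_+ e) (sym (count-miss neq))))

  -- Only the specification of `pos` is assumed, so the search that computes it is never unfolded.
  -- On the occurrences of a, `pos` and `count` are inverse to each other.
  module Positions {k} (w : InfWord k) (a : Fin k) (pos : ℕ → ℕ) (correct : ∀ n → IsPosition w a (suc n) (pos n)) where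

    open Count w a

    w-pos : ∀ n → w (pos n) ≡ a
    w-pos n = proj₁ (correct n)

    count-pos : ∀ n → count (pos n) ≡ n
    count-pos n = sym (ℕₚ.suc-injective (proj₂ (correct n)))

    pos-count : ∀ {m} → w m ≡ a → pos (count m) ≡ m
    pos-count {m} eq = count-injective (w-pos (count m)) eq (count-pos (count m))

    pos-≥ : ∀ n → n ≤ pos n
    pos-≥ n = subst (_≤ pos n) (count-pos n) (count≤ (pos n))

    pos-reflects-≤ : ∀ {m n} → pos m ≤ pos n → m ≤ n
    pos-reflects-≤ {m} {n} le = subst₂ _≤_ (count-pos m) (count-pos n) (count-mono le)

    pos-strict : ∀ {m n} → m < n → pos m < pos n
    pos-strict m<n = ℕₚ.≰⇒> λ le → ℕₚ.<⇒≱ m<n (pos-reflects-≤ le)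

    pos-minimal : ∀ {m x} → w x ≡ a → m ≤ count x → pos m ≤ x
    pos-minimal {m} {x} eq le = ℕₚ.≮⇒≥ λ x<pos → ℕₚ.<⇒≱ (count-strict eq x<pos) (subst (_≤ count x) (sym (count-pos m)) le)

    gap : ℕ → ℕ
    gap n = pos (suc n) ∸ pos n

    pos-suc : ∀ n → pos (suc n) ≡ pos n + gap n
    pos-suc n = sym (ℕₚ.m+[n∸m]≡n (ℕₚ.<⇒≤ (pos-strict (ℕₚ.n<1+n n))))

    -- The shift by d carries occurrences to occurrences, and it raises their index by e, the number
    -- of occurrences in one period.
    periodic⇒pos-affine : EventuallyPeriodic w → ∃ λ N → ∃₂ λ e d → e ≥ 1 × (∀ n → n ≥ N → pos (n + e) ≡ pos n + d)
    periodic⇒pos-affine (N , d , d≥1 , per) = N , e , d , e≥1 , affine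
      where
      e = count (N + d) ∸ count N
      affine : ∀ n → n ≥ N → pos (n + e) ≡ pos n + d
      affine n n≥N = count-injective (w-pos (n + e)) (trans (per (pos n) pos≥N) (w-pos n))
        (trans (count-pos (n + e)) (sym (trans (count-periodic per (pos n) pos≥N) (cong (_+ e) (count-pos n)))))
        where
        pos≥N : pos n ≥ N
        pos≥N = ℕₚ.≤-trans n≥N (pos-≥ n)
      -- If e were 0, `affine` would say pos N = pos N + d although d ≥ 1.
      e≥1 : e ≥ 1
      e≥1 with e | affine N ℕₚ.≤-refl
      ... | suc _ | _  = s≤s z≤n
      ... | zero  | eq = contradiction (trans (cong pos (sym (ℕₚ.+-identityʳ N))) eq) (ℕₚ.<⇒≢ (ℕₚ.m<m+n (pos N) d≥1))

    -- The gaps of one period add up to d, so from pos N on the set of occurrences is invariant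
    -- under the shift by d in both directions.
    gap-periodic⇒indicator-periodic : Periodic gap → Periodic (indicator w a)
    gap-periodic⇒indicator-periodic (N , e , e≥1 , per) = pos N , d , ℕₚ.m<n⇒0<n∸m posN< , same
      where
      d = pos (N + e) ∸ pos N
      posN< : pos N < pos (N + e)
      posN< = pos-strict (ℕₚ.m<m+n N e≥1)
      shift : ∀ t → pos (N + t + e) ≡ pos (N + t) + d
      shift zero rewrite ℕₚ.+-identityʳ N = sym (ℕₚ.m+[n∸m]≡n (ℕₚ.<⇒≤ posN<))
      shift (suc t) rewrite ℕₚ.+-suc N t = begin
        pos (suc (N + t + e))               ≡⟨ pos-suc (N + t + e) ⟩
        pos (N + t + e) + gap (N + t + e)   ≡⟨ cong₂ _+_ (shift t) (per (N + t) (ℕₚ.m≤m+n N t)) ⟩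
        pos (N + t) + d + gap (N + t)
             ≡⟨ ℕS.solve 3 (λ x y z → x ℕS.:+ y ℕS.:+ z ℕS.:= x ℕS.:+ z ℕS.:+ y) refl (pos (N + t)) d (gap (N + t)) ⟩
        pos (N + t) + gap (N + t) + d       ≡⟨ cong (_+ d) (pos-suc (N + t)) ⟨
        pos (suc (N + t)) + d               ∎
        where open ≡-Reasoning
      affine : ∀ n → n ≥ N → pos (n + e) ≡ pos n + d
      affine n n≥N = subst (λ x → pos (x + e) ≡ pos x + d) (ℕₚ.m+[n∸m]≡n n≥N) (shift (n ∸ N))
      forth : ∀ m → m ≥ pos N → w m ≡ a → w (m + d) ≡ a
      forth m m≥ eq = subst (λ x → w x ≡ a)
        (trans (affine (count m) (subst (_≤ count m) (count-pos N) (count-mono m≥))) (cong (_+ d) (pos-count eq)))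
            (w-pos (count m + e))
      -- The occurrence at m + d has an index n ≥ N + e, so the occurrence of index n ∸ e lies d
      -- before it, that is, at m.
      back : ∀ m → m ≥ pos N → w (m + d) ≡ a → w m ≡ a
      back m m≥ eq = subst (λ x → w x ≡ a) pos-t≡m (w-pos t)
        where
        n = count (m + d)
        N+e≤n : N + e ≤ n
        N+e≤n = pos-reflects-≤ (ℕₚ.≤-trans (ℕₚ.≤-reflexive (affine N ℕₚ.≤-refl))
          (ℕₚ.≤-trans (ℕₚ.+-monoˡ-≤ d m≥) (ℕₚ.≤-reflexive (sym (pos-count eq)))))
        t = n ∸ e
        t≥N : t ≥ N
        t≥N = ℕₚ.≤-trans (ℕₚ.≤-reflexive (sym (ℕₚ.m+n∸n≡m N e))) (ℕₚ.∸-monoˡ-≤ e N+e≤n)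
        pos-t≡m : pos t ≡ m
        pos-t≡m = ℕₚ.+-cancelʳ-≡ d (pos t) m (trans (sym (affine t t≥N))
          (trans (cong pos (ℕₚ.m∸n+n≡m (ℕₚ.≤-trans (ℕₚ.m≤n+m e N) N+e≤n))) (pos-count eq)))
      same : ∀ m → m ≥ pos N → indicator w a (m + d) ≡ indicator w a m
      same m m≥ with w m Fin.≟ a
      ... | yes eq = dec-true (w (m + d) Fin.≟ a) (forth m m≥ eq)
      ... | no neq = dec-false (w (m + d) Fin.≟ a) (neq ∘ back m m≥)

  -- Blocks of an infinite concatenation and bounded gaps

  start : ∀ {A : Set} → (ℕ → List⁺ A) → ℕ → ℕ
  start u zero    = 0
  start u (suc t) = length (toList (u 0)) + start (u ∘ suc) t

  concatFrom-skip : ∀ {A : Set} (v : List⁺ A) u n → concatFrom v u (length (toList v) + n) ≡ concatω u n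
  concatFrom-skip (a ∷ as) u n = go a as
    where
    go : ∀ a as → concatFrom (a ∷ as) u (suc (length as) + n) ≡ concatω u n
    go a []       = refl
    go a (b ∷ bs) = go b bs

  concatω-start : ∀ {A : Set} (u : ℕ → List⁺ A) t n → concatω u (start u t + n) ≡ concatω (λ i → u (t + i)) n
  concatω-start u zero    n = refl
  concatω-start u (suc t) n = trans (cong (concatω u) (ℕₚ.+-assoc (length (toList (u 0))) (start (u ∘ suc) t) n))
    (trans (concatFrom-skip (u 0) (u ∘ suc) (start (u ∘ suc) t + n)) (concatω-start (u ∘ suc) t n))

  concatFrom-∈ : ∀ {A : Set} {c : A} v u → c ∈ toList v → ∃ λ n → n < length (toList v) × concatFrom v u n ≡ c
  concatFrom-∈ (a ∷ as)     u (here refl) = 0 , s≤s z≤n , refl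
  concatFrom-∈ (a ∷ b ∷ bs) u (there c∈) with concatFrom-∈ (b ∷ bs) u c∈
  ... | n , n< , eq = suc n , s≤s n< , eq

  start-suc : ∀ {A : Set} (u : ℕ → List⁺ A) t → start u (suc t) ≡ start u t + length (toList (u t))
  start-suc u zero    = ℕₚ.+-identityʳ _
  start-suc u (suc t) = trans (cong (length (toList (u 0)) +_) (start-suc (u ∘ suc) t))
      (sym (ℕₚ.+-assoc (length (toList (u 0))) _ _))

  concatω-∈ : ∀ {A : Set} {c : A} u t → c ∈ toList (u t) → ∃ λ n → start u t ≤ n × n < start u (suc t) × concatω u n ≡ c
  concatω-∈ u zero c∈ with concatFrom-∈ (u 0) (u ∘ suc) c∈
  ... | n , n< , eq = n , z≤n , subst (n <_) (sym (ℕₚ.+-identityʳ _)) n< , eq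
  concatω-∈ u (suc t) c∈ with concatω-∈ (u ∘ suc) t c∈
  ... | n , ≤n , n< , eq = length (toList (u 0)) + n , ℕₚ.+-monoʳ-≤ _ ≤n , ℕₚ.+-monoʳ-< (length (toList (u 0))) n< ,
    trans (concatFrom-skip (u 0) (u ∘ suc) n) eq

  concatFrom-cong : ∀ {A : Set} (v : List⁺ A) {u u′} i →
      (length (toList v) ≤ i → concatω u (i ∸ length (toList v)) ≡ concatω u′ (i ∸ length (toList v))) →
                    concatFrom v u i ≡ concatFrom v u′ i
  concatFrom-cong (a ∷ as)     zero    p = refl
  concatFrom-cong (a ∷ [])     (suc i) p = p (s≤s z≤n)
  concatFrom-cong (a ∷ b ∷ bs) (suc i) p = concatFrom-cong (b ∷ bs) i (p ∘ s≤s)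

  concatω-cong-below : ∀ {A : Set} L {u u′ : ℕ → List⁺ A} → (∀ t → t < L → u t ≡ u′ t) → ∀ i → i < start u L → concatω u
      i ≡ concatω u′ i
  concatω-cong-below (suc L) {u} {u′} p i i< = trans
    (concatFrom-cong (u 0) i λ ≤i → concatω-cong-below L (λ t t<L → p (suc t) (s≤s t<L)) (i ∸ length (toList (u 0)))
      (ℕₚ.+-cancelˡ-< (length (toList (u 0))) _ _ (subst (_< start u (suc L)) (sym (ℕₚ.m+[n∸m]≡n ≤i)) i<)))
    (cong (λ v → concatFrom v (u′ ∘ suc) i) (p 0 (s≤s z≤n)))

  length⁺≥1 : ∀ {A : Set} (v : List⁺ A) → 1 ≤ length (toList v)
  length⁺≥1 (a ∷ as) = s≤s z≤n

  start-strict : ∀ {A : Set} (u : ℕ → List⁺ A) t → start u t < start u (suc t)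
  start-strict u t = subst (start u t <_) (sym (start-suc u t)) (ℕₚ.m<m+n (start u t) (length⁺≥1 (u t)))

  -- `start u t` is the position at which the word `u t` begins, and each word contributes at least
  -- one letter.
  start-+ : ∀ {A : Set} (u : ℕ → List⁺ A) t x → start u t + x ≤ start u (t + x)
  start-+ u t zero    = ℕₚ.≤-reflexive (trans (ℕₚ.+-identityʳ _) (cong (start u) (sym (ℕₚ.+-identityʳ t))))
  start-+ u t (suc x) = subst₂ _≤_ (sym (ℕₚ.+-suc (start u t) x)) (cong (start u) (sym (ℕₚ.+-suc t x)))
    (ℕₚ.≤-trans (s≤s (start-+ u t x)) (start-strict u (t + x)))

  start-mono : ∀ {A : Set} (u : ℕ → List⁺ A) {s t} → s ≤ t → start u s ≤ start u t
  start-mono u {s} {t} s≤t = ℕₚ.≤-trans (ℕₚ.m≤m+n _ (t ∸ s))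
      (subst (λ x → start u s + (t ∸ s) ≤ start u x) (ℕₚ.m+[n∸m]≡n s≤t) (start-+ u s (t ∸ s)))

  occ>0⇒∈ : ∀ {k} (c : Fin k) u → 0 < occ c u → c ∈ u
  occ>0⇒∈ c (b ∷ u) p with c Fin.≟ b
  ... | yes c≡b = here c≡b
  ... | no  _   = there (occ>0⇒∈ c u p)

  sum>0 : ∀ {n} (f : Fin n → ℕ) → 0 < Σℕ.sum f → ∃ λ l → 0 < f l
  sum>0 {suc n} f p with f zero in eq
  ... | suc x = zero , subst (0 <_) (sym eq) (s≤s z≤n)
  ... | zero  with sum>0 (f ∘ suc) p
  ...   | l , q = suc l , q

  *>0 : ∀ x y → 0 < x * y → 0 < x × 0 < y
  *>0 (suc x) (suc y) p = s≤s z≤n , s≤s z≤n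
  *>0 (suc x) zero    p = contradiction (subst (0 <_) (ℕₚ.*-zeroʳ x) p) λ ()

  power-suc>0 : ∀ {k} (σ : Substitution k) r b a → 0 < power (matrix σ) (suc r) b a →
                ∃ λ c → c ∈ toList (σ b) × 0 < power (matrix σ) r c a
  power-suc>0 σ r b a p with sum>0 (λ l → matrix σ b l * power (matrix σ) r l a) p
  ... | c , q with *>0 (matrix σ b c) _ q
  ...   | q₁ , q₂ = c , occ>0⇒∈ c _ q₁ , q₂

  finite-max : ∀ {k} (f : Fin k → ℕ) → ∃ λ M → ∀ i → f i ≤ M
  finite-max {zero}  f = 0 , λ ()
  finite-max {suc k} f with finite-max (f ∘ suc)
  ... | M , bound = f zero + M , λ { zero → ℕₚ.m≤m+n _ M ; (suc i) → ℕₚ.≤-trans (bound i) (ℕₚ.m≤n+m M (f zero)) }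

  module Gaps {k} (σ : Substitution k) (prim : Primitive σ) (w : InfWord k) (fix : FixedPoint σ w) where

    private
      s : ℕ → ℕ
      s = start (σ ∘ w)

    -- σʳ(w_t) is the factor of w = σʳ(w) at the positions from block r t to block r (t + 1).
    block : ℕ → ℕ → ℕ
    block zero    t = t
    block (suc r) t = block r (s t)

    block-mono : ∀ r {t t′} → t ≤ t′ → block r t ≤ block r t′
    block-mono zero    le = le
    block-mono (suc r) le = block-mono r (start-mono (σ ∘ w) le)

    block-strict : ∀ r {t t′} → t < t′ → block r t < block r t′
    block-strict zero    lt = lt
    block-strict (suc r) {t} lt = block-strict r (ℕₚ.<-≤-trans (start-strict (σ ∘ w) t) (start-mono (σ ∘ w) lt))

    block-0 : ∀ r → block r 0 ≡ 0
    block-0 zero    = refl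
    block-0 (suc r) = block-0 r

    -- A path of length r from w t to a in the graph of the matrix is followed letter by letter:
    -- since w is fixed, the next letter c, taken from σ(w t), occurs in w at a position m of the
    -- block of t, and the level-r block of m lies inside the block of t one level up.
    block-reach : ∀ r t a → 0 < power (matrix σ) r (w t) a → ∃ λ n → block r t ≤ n × n < block r (suc t) × w n ≡ a
    block-reach zero t a p with w t Fin.≟ a
    ... | yes eq = t , ℕₚ.≤-refl , ℕₚ.n<1+n t , eq
    block-reach (suc r) t a p with power-suc>0 σ r (w t) a p
    ... | c , c∈ , q with concatω-∈ (σ ∘ w) t c∈
    ...   | m , ≤m , m< , eq with block-reach r m a (subst (λ b → 0 < power (matrix σ) r b a) (trans (sym eq) (fix m)) q)
    ...     | n , ≤n , n< , eq′ = n , ℕₚ.≤-trans (block-mono r ≤m) ≤n , ℕₚ.<-≤-trans n< (block-mono r m<) , eq′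

    private
      M = proj₁ (finite-max (λ a → length (toList (σ a))))
      length≤M = proj₂ (finite-max (λ a → length (toList (σ a))))

    start-slope : ∀ t x → s (t + x) ≤ s t + M * x
    start-slope t zero    = ℕₚ.≤-trans (ℕₚ.≤-reflexive (cong s (ℕₚ.+-identityʳ t))) (ℕₚ.m≤m+n (s t) (M * 0))
    start-slope t (suc x) = begin
      s (t + suc x)                                ≡⟨ cong s (ℕₚ.+-suc t x) ⟩
      s (suc (t + x))                              ≡⟨ start-suc (σ ∘ w) (t + x) ⟩
      s (t + x) + length (toList (σ (w (t + x))))  ≤⟨ ℕₚ.+-mono-≤ (start-slope t x) (length≤M (w (t + x))) ⟩
      s t + M * x + M
           ≡⟨ ℕS.solve 3 (λ a m x → a ℕS.:+ m ℕS.:* x ℕS.:+ m ℕS.:= a ℕS.:+ m ℕS.:* (ℕS.con 1 ℕS.:+ x)) refl (s t) M x ⟩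
      s t + M * suc x                              ∎
      where open ℕₚ.≤-Reasoning

    block-slope : ∀ r t x → block r (t + x) ≤ block r t + M ^ r * x
    block-slope zero    t x = ℕₚ.≤-reflexive (cong (t +_) (sym (ℕₚ.+-identityʳ x)))
    block-slope (suc r) t x = begin
      block r (s (t + x))               ≤⟨ block-mono r (start-slope t x) ⟩
      block r (s t + M * x)             ≤⟨ block-slope r (s t) (M * x) ⟩
      block r (s t) + M ^ r * (M * x)
           ≡⟨ cong (block r (s t) +_) (ℕS.solve 3 (λ p m x → p ℕS.:* (m ℕS.:* x) ℕS.:= m ℕS.:* p ℕS.:* x) refl (M ^ r) M x) ⟩
      block r (s t) + M * M ^ r * x     ∎
      where open ℕₚ.≤-Reasoning

    block-suc : ∀ r t → block r (suc t) ≤ block r t + M ^ r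
    block-suc r t = subst₂ _≤_ (cong (block r) (ℕₚ.+-comm t 1)) (cong (block r t +_) (ℕₚ.*-identityʳ (M ^ r))) (block-slope r t 1)

    -- Blocks of level r have length at most M^r, so one of them begins at most M^r after any given
    -- position.
    block-near : ∀ r m → ∃ λ t → m ≤ block r t × block r t ≤ m + M ^ r
    block-near r zero = 0 , z≤n , ℕₚ.≤-trans (ℕₚ.≤-reflexive (block-0 r)) z≤n
    block-near r (suc m) with block-near r m
    ... | t , m≤ , ≤m with suc m ℕₚ.≤? block r t
    ...   | yes m+1≤ = t , m+1≤ , ℕₚ.m≤n⇒m≤1+n ≤m
    ...   | no  m+1≰ = suc t , ℕₚ.≤-trans (s≤s m≤) (block-strict r (ℕₚ.n<1+n t)) ,
      ℕₚ.≤-trans (block-suc r t) (ℕₚ.≤-trans (ℕₚ.+-monoˡ-≤ (M ^ r) (ℕₚ.≤-pred (ℕₚ.≰⇒> m+1≰))) (ℕₚ.n≤1+n _))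

    bounded-gaps : ∃ λ G → ∀ a m → ∃ λ n → m ≤ n × n < m + G × w n ≡ a
    -- One M^r to reach the beginning of a block, one to cross it.
    bounded-gaps = M ^ r + M ^ r , λ a m → occurrence a m
      where
      r = proj₁ prim
      occurrence : ∀ a m → ∃ λ n → m ≤ n × n < m + (M ^ r + M ^ r) × w n ≡ a
      occurrence a m with block-near r m
      ... | t , m≤ , ≤m with block-reach r t a (proj₂ prim (w t) a)
      ...   | n , ≤n , n< , eq = n , ℕₚ.≤-trans m≤ ≤n ,
        ℕₚ.<-≤-trans n< (ℕₚ.≤-trans (block-suc r t)
            (ℕₚ.≤-trans (ℕₚ.+-monoˡ-≤ (M ^ r) ≤m) (ℕₚ.≤-reflexive (ℕₚ.+-assoc m (M ^ r) (M ^ r))))) , eq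

  -- Comparison of two fixed points

  another-letter : ∀ {k} → 2 ≤ k → (b : Fin k) → ∃ λ j → j ≢ b
  another-letter (s≤s (s≤s _)) zero    = suc zero , λ ()
  another-letter (s≤s (s≤s _)) (suc b) = zero , λ ()

  -- If σ(w 0) were a single letter, it would be w 0 because w is fixed; then no power of the matrix
  -- leads from w 0 to another letter, against primitivity and k ≥ 2.
  first-letter-grows : ∀ {k} → 2 ≤ k → (σ : Substitution k) → Primitive σ → ∀ w → FixedPoint σ w → 2 ≤ length (toList (σ (w 0)))
  first-letter-grows k≥2 σ (r , pos) w fix with σ (w 0) in eq | fix 0
  ... | x ∷ y ∷ ys | _    = s≤s (s≤s z≤n)
  ... | x ∷ []     | refl = contradiction (only-itself r (proj₁ other) (pos (w 0) (proj₁ other))) (proj₂ other)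
    where
    other = another-letter k≥2 (w 0)
    only-itself : ∀ r a → 0 < power (matrix σ) r (w 0) a → a ≡ w 0
    only-itself zero a p with w 0 Fin.≟ a
    ... | yes w0≡a = sym w0≡a
    only-itself (suc r) a p with power-suc>0 σ r (w 0) a p
    ... | c , c∈ , q with subst (λ v → c ∈ toList v) eq c∈
    ...   | here refl = only-itself r a q

  -- σ maps an occurrence of a prefix of w′ to an occurrence of a longer prefix, because |σ(w′₀)| ≥ 2.
  prefix-occurs : ∀ {k} → 2 ≤ k → (σ : Substitution k) → Primitive σ → ∀ {w w′} → FixedPoint σ w → FixedPoint σ w′ →
                  ∀ N n → ∃₂ λ L m → n < L × N ≤ m × (∀ i → i < L → w′ i ≡ w (m + i))
  prefix-occurs k≥2 σ prim {w} {w′} fix fix′ N zero with Gaps.bounded-gaps σ prim w fix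
  ... | G , occurs with occurs (w′ 0) N
  ...   | m , N≤m , _ , eq = 1 , m , s≤s z≤n , N≤m , λ { zero _ → sym (trans (cong w (ℕₚ.+-identityʳ m)) eq) ; (suc i) (s≤s ()) }
  prefix-occurs k≥2 σ prim {w} {w′} fix fix′ N (suc n) with prefix-occurs k≥2 σ prim {w} {w′} fix fix′ N n
  ... | suc L , m , n<L , N≤m , agree = start (σ ∘ w′) (suc L) , start (σ ∘ w) m , longer ,
    ℕₚ.≤-trans N≤m (start-+ (σ ∘ w) 0 m) , λ i i< → begin
      w′ i                                            ≡⟨ fix′ i ⟨
      concatω (σ ∘ w′) i                              ≡⟨ concatω-cong-below (suc L) (λ t t< → cong σ (agree t t<)) i i< ⟩
      concatω (λ t → σ (w (m + t))) i                 ≡⟨ concatω-start (σ ∘ w) m i ⟨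
      concatω (σ ∘ w) (start (σ ∘ w) m + i)           ≡⟨ fix (start (σ ∘ w) m + i) ⟩
      w (start (σ ∘ w) m + i)                         ∎
    where
    open ≡-Reasoning
    -- The first letter of the prefix yields at least two letters, each of the L others at least
    -- one.
    longer : suc n < start (σ ∘ w′) (suc L)
    longer = ℕₚ.≤-trans (s≤s n<L) (ℕₚ.≤-trans
      (ℕₚ.+-monoˡ-≤ L (ℕₚ.≤-trans (first-letter-grows k≥2 σ prim w′ fix′) (ℕₚ.≤-reflexive (sym (ℕₚ.+-identityʳ _)))))
      (start-+ (σ ∘ w′) 1 L))

  -- Every prefix of w′ occurs in w beyond the preperiod N, so w′ is even purely periodic, with the
  -- period of w.
  fixed-points-periodic : ∀ {k} → 2 ≤ k → (σ : Substitution k) → Primitive σ → ∀ {w w′} → FixedPoint σ w → FixedPoint σ w′ →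
                          EventuallyPeriodic w → EventuallyPeriodic w′
  fixed-points-periodic k≥2 σ prim {w} {w′} fix fix′ (N , d , d≥1 , per) = 0 , d , d≥1 , λ n _ → step n
    where
    step : ∀ n → w′ (n + d) ≡ w′ n
    step n with prefix-occurs k≥2 σ prim {w} {w′} fix fix′ N (n + d)
    ... | L , m , n+d<L , N≤m , agree = begin
      w′ (n + d)       ≡⟨ agree (n + d) n+d<L ⟩
      w (m + (n + d))  ≡⟨ cong w (ℕₚ.+-assoc m n d) ⟨
      w (m + n + d)    ≡⟨ per (m + n) (ℕₚ.≤-trans N≤m (ℕₚ.m≤m+n m n)) ⟩
      w (m + n)        ≡⟨ agree n (ℕₚ.≤-<-trans (ℕₚ.m≤m+n n d) n+d<L) ⟨
      w′ n             ∎
      where open ≡-Reasoning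

-- The ring of power series

module _ where

  open import Data.Rational using (_+_; _*_; -_)
  open ≡-Reasoning

  tail : Series → Series
  tail f n = f (suc n)

  const : ℚ → Series
  const c zero    = c
  const c (suc n) = 0ℚ

  0S 1S : Series
  0S _ = 0ℚ
  1S = const 1ℚ

  ⊖_ : Series → Series
  (⊖ f) n = - f n

  infixr 21 _•_
  _•_ : ℚ → Series → Series
  (c • f) n = c * f n

  ⊛-head : ∀ f g → (f ⊛ g) 0 ≡ f 0 * g 0
  ⊛-head f g = ℚₚ.+-identityʳ _

  ⊛-cong-below : ∀ n {f f′ g g′ : Series} → (∀ k → k ℕ.≤ n → f k ≡ f′ k) → (∀ k → k ℕ.≤ n → g k ≡ g′ k) →
                 (f ⊛ g) n ≡ (f′ ⊛ g′) n
  ⊛-cong-below zero    p q = cong₂ _+_ (cong₂ _*_ (p 0 z≤n) (q 0 z≤n)) refl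
  ⊛-cong-below (suc n) p q = cong₂ _+_ (cong₂ _*_ (p 0 z≤n) (q (suc n) ℕₚ.≤-refl))
    (⊛-cong-below n (λ k k≤n → p (suc k) (s≤s k≤n)) (λ k k≤n → q k (ℕₚ.m≤n⇒m≤1+n k≤n)))

  ⊛-cong : ∀ {f f′ g g′} → f ≗ f′ → g ≗ g′ → (f ⊛ g) ≗ (f′ ⊛ g′)
  ⊛-cong p q n = ⊛-cong-below n (λ k _ → p k) (λ k _ → q k)

  ⊛-distribʳ : ∀ h f g → ((f ⊕ g) ⊛ h) ≗ ((f ⊛ h) ⊕ (g ⊛ h))
  ⊛-distribʳ h f g zero = solve 3 (λ x y z → (x :+ y) :* z :+ con 0ℚ :=
    (x :* z :+ con 0ℚ) :+ (y :* z :+ con 0ℚ)) refl (f 0) (g 0) (h 0)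
  ⊛-distribʳ h f g (suc n) = begin
    (f 0 + g 0) * h (suc n) + ((tail f ⊕ tail g) ⊛ h) n
      ≡⟨ cong ((f 0 + g 0) * h (suc n) +_) (⊛-distribʳ h (tail f) (tail g) n) ⟩
    (f 0 + g 0) * h (suc n) + ((tail f ⊛ h) n + (tail g ⊛ h) n)
      ≡⟨ solve 5 (λ x y z u v → (x :+ y) :* z :+ (u :+ v) :=
           (x :* z :+ u) :+ (y :* z :+ v)) refl (f 0) (g 0) (h (suc n)) ((tail f ⊛ h) n) ((tail g ⊛ h) n) ⟩
    (f 0 * h (suc n) + (tail f ⊛ h) n) + (g 0 * h (suc n) + (tail g ⊛ h) n) ∎

  •-⊛ : ∀ c f g → ((c • f) ⊛ g) ≗ c • (f ⊛ g)
  •-⊛ c f g zero = solve 3 (λ c x y → (c :* x) :* y :+ con 0ℚ := c :* (x :* y :+ con 0ℚ))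
    refl c (f 0) (g 0)
  •-⊛ c f g (suc n) = begin
    c * f 0 * g (suc n) + ((c • tail f) ⊛ g) n ≡⟨ cong (c * f 0 * g (suc n) +_) (•-⊛ c (tail f) g n) ⟩
    c * f 0 * g (suc n) + c * (tail f ⊛ g) n
      ≡⟨ solve 4 (λ c x y z → c :* x :* y :+ c :* z := c :* (x :* y :+ z)) refl c (f 0) (g (suc n)) ((tail f ⊛ g) n) ⟩
    c * (f 0 * g (suc n) + (tail f ⊛ g) n) ∎

  ⊛-zeroˡ : ∀ g → (0S ⊛ g) ≗ 0S
  ⊛-zeroˡ g zero    = trans (ℚₚ.+-identityʳ _) (ℚₚ.*-zeroˡ (g 0))
  ⊛-zeroˡ g (suc n) = trans (cong₂ _+_ (ℚₚ.*-zeroˡ (g (suc n))) (⊛-zeroˡ g n)) (ℚₚ.+-identityʳ 0ℚ)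

  const-⊛ : ∀ c g → (const c ⊛ g) ≗ c • g
  const-⊛ c g zero    = ℚₚ.+-identityʳ _
  const-⊛ c g (suc n) = trans (cong (c * g (suc n) +_) (⊛-zeroˡ g n)) (ℚₚ.+-identityʳ _)

  -- `⊛` peels the first coefficient off its left factor; commutativity by induction also needs it
  -- peeled off the right factor.
  ⊛-tailʳ : ∀ f g n → (f ⊛ g) (suc n) ≡ f (suc n) * g 0 + (f ⊛ tail g) n
  ⊛-tailʳ f g zero = solve 4 (λ x y z u → x :* y :+ (z :* u :+ con 0ℚ) := z :* u :+ (x :* y :+ con 0ℚ))
    refl (f 0) (g 1) (f 1) (g 0)
  ⊛-tailʳ f g (suc n) = begin
    f 0 * g (2 ℕ.+ n) + (tail f ⊛ g) (suc n) ≡⟨ cong (f 0 * g (2 ℕ.+ n) +_) (⊛-tailʳ (tail f) g n) ⟩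
    f 0 * g (2 ℕ.+ n) + (f (2 ℕ.+ n) * g 0 + (tail f ⊛ tail g) n)
      ≡⟨ solve 3 (λ x y z → x :+ (y :+ z) := y :+ (x :+ z)) refl (f 0 * g (2 ℕ.+ n)) (f (2 ℕ.+ n) * g 0) ((tail f ⊛ tail g) n) ⟩
    f (2 ℕ.+ n) * g 0 + (f 0 * g (2 ℕ.+ n) + (tail f ⊛ tail g) n) ∎

  ⊛-comm : ∀ f g → (f ⊛ g) ≗ (g ⊛ f)
  ⊛-comm f g zero    = cong (_+ 0ℚ) (ℚₚ.*-comm (f 0) (g 0))
  ⊛-comm f g (suc n) = trans (⊛-tailʳ f g n) (cong₂ _+_ (ℚₚ.*-comm (f (suc n)) (g 0)) (⊛-comm f (tail g) n))

  ⊛-assoc : ∀ f g h → ((f ⊛ g) ⊛ h) ≗ (f ⊛ (g ⊛ h))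
  ⊛-assoc f g h zero = solve 3 (λ x y z → (x :* y :+ con 0ℚ) :* z :+ con 0ℚ :=
    x :* (y :* z :+ con 0ℚ) :+ con 0ℚ) refl (f 0) (g 0) (h 0)
  ⊛-assoc f g h (suc n) = begin
    (f ⊛ g) 0 * h (suc n) + (((f 0 • tail g) ⊕ (tail f ⊛ g)) ⊛ h) n
      ≡⟨ cong₂ _+_ (cong (_* h (suc n)) (⊛-head f g)) (⊛-distribʳ h (f 0 • tail g) (tail f ⊛ g) n) ⟩
    f 0 * g 0 * h (suc n) + (((f 0 • tail g) ⊛ h) n + ((tail f ⊛ g) ⊛ h) n)
      ≡⟨ cong (f 0 * g 0 * h (suc n) +_) (cong₂ _+_ (•-⊛ (f 0) (tail g) h n) (⊛-assoc (tail f) g h n)) ⟩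
    f 0 * g 0 * h (suc n) + (f 0 * (tail g ⊛ h) n + (tail f ⊛ (g ⊛ h)) n)
      ≡⟨ solve 5 (λ x y z u v → x :* y :* z :+ (x :* u :+ v) := x :* (y :* z :+ u) :+ v)
           refl (f 0) (g 0) (h (suc n)) ((tail g ⊛ h) n) ((tail f ⊛ (g ⊛ h)) n) ⟩
    f 0 * (g 0 * h (suc n) + (tail g ⊛ h) n) + (tail f ⊛ (g ⊛ h)) n ∎

  -- Coefficientwise equality is the equality of the ring, so that no function extensionality
  -- enters.
  seriesRing : CommutativeRing 0ℓ 0ℓ
  seriesRing = record
    { Carrier = Series ; _≈_ = _≗_ ; _+_ = _⊕_ ; _*_ = _⊛_ ; -_ = ⊖_ ; 0# = 0S ; 1# = 1S
    ; isCommutativeRing = record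
      { isRing = record
        { +-isAbelianGroup = record
          { isGroup = record
            { isMonoid = record
              { isSemigroup = record
                { isMagma = record
                  { isEquivalence = record { refl = λ _ → refl ; sym = λ p n → sym (p n) ; trans = λ p q n → trans (p n) (q n) }
                  ; ∙-cong = λ p q n → cong₂ _+_ (p n) (q n) }
                ; assoc = λ f g h n → ℚₚ.+-assoc (f n) (g n) (h n) }
              ; identity = (λ f n → ℚₚ.+-identityˡ (f n)) , (λ f n → ℚₚ.+-identityʳ (f n)) }
            ; inverse = (λ f n → ℚₚ.+-inverseˡ (f n)) , (λ f n → ℚₚ.+-inverseʳ (f n))
            ; ⁻¹-cong = λ p n → cong -_ (p n) }
          ; comm = λ f g n → ℚₚ.+-comm (f n) (g n) }
        ; *-cong = ⊛-cong
        ; *-assoc = ⊛-assoc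
        ; *-identity = 1S-identityˡ , λ f n → trans (⊛-comm f 1S n) (1S-identityˡ f n)
        ; distrib = (λ f g h n → trans (⊛-comm f (g ⊕ h) n)
                      (trans (⊛-distribʳ f g h n) (cong₂ _+_ (⊛-comm g f n) (⊛-comm h f n)))) , ⊛-distribʳ }
      ; *-comm = ⊛-comm } }
    where
    1S-identityˡ : ∀ f → (1S ⊛ f) ≗ f
    1S-identityˡ f n = trans (const-⊛ 1ℚ f n) (ℚₚ.*-identityˡ (f n))

private
  module S = CommutativeRing seriesRing
  module SS = NatSolver S.commutativeSemiring
  module SE = Exp S.commutativeSemiring
  module QE = Exp (CommutativeRing.commutativeSemiring ℚₚ.+-*-commutativeRing)

-- Fatou's theorem and rationality

module _ where

  open import Data.Rational using (_+_; _*_; -_; _≤_; ∣_∣)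
  open import Data.Integer using (+_)

  -- Opaque, since unification would otherwise unfold the reduction of z / 1 to lowest terms.
  opaque
    fromℤ : ℤ → ℚ
    fromℤ z = z ℚ./ 1

    fromℤ-def : ∀ z → fromℤ z ≡ z ℚ./ 1
    fromℤ-def z = refl

    fromℤ-0 : fromℤ (+ 0) ≡ 0ℚ
    fromℤ-0 = refl

    fromℤ-1 : fromℤ (+ 1) ≡ 1ℚ
    fromℤ-1 = refl

    toℚᵘ-fromℤ : ∀ z → ℚ.toℚᵘ (fromℤ z) ℚᵘ.≃ ℚᵘ.mkℚᵘ z 0
    toℚᵘ-fromℤ z = ℚₚ.toℚᵘ-fromℚᵘ (ℚᵘ.mkℚᵘ z 0)

    fromℤ-+ : ∀ x y → fromℤ (x ℤ.+ y) ≡ fromℤ x + fromℤ y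
    fromℤ-+ x y = ℚₚ.toℚᵘ-injective (begin-equality
      ℚ.toℚᵘ (fromℤ (x ℤ.+ y))                ≃⟨ toℚᵘ-fromℤ (x ℤ.+ y) ⟩
      ℚᵘ.mkℚᵘ (x ℤ.+ y) 0
          ≃⟨ ℚᵘ.*≡* (cong (ℤ._* (+ 1)) (sym (cong₂ ℤ._+_ (ℤₚ.*-identityʳ x) (ℤₚ.*-identityʳ y)))) ⟩
      ℚᵘ.mkℚᵘ x 0 ℚᵘ.+ ℚᵘ.mkℚᵘ y 0            ≃⟨ ℚᵘₚ.+-cong (toℚᵘ-fromℤ x) (toℚᵘ-fromℤ y) ⟨
      ℚ.toℚᵘ (fromℤ x) ℚᵘ.+ ℚ.toℚᵘ (fromℤ y)  ≃⟨ ℚₚ.toℚᵘ-homo-+ (fromℤ x) (fromℤ y) ⟨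
      ℚ.toℚᵘ (fromℤ x + fromℤ y)              ∎)
      where open ℚᵘₚ.≤-Reasoning

    fromℤ-* : ∀ x y → fromℤ (x ℤ.* y) ≡ fromℤ x * fromℤ y
    fromℤ-* x y = ℚₚ.toℚᵘ-injective (begin-equality
      ℚ.toℚᵘ (fromℤ (x ℤ.* y))                ≃⟨ toℚᵘ-fromℤ (x ℤ.* y) ⟩
      ℚᵘ.mkℚᵘ x 0 ℚᵘ.* ℚᵘ.mkℚᵘ y 0            ≃⟨ ℚᵘₚ.*-cong (toℚᵘ-fromℤ x) (toℚᵘ-fromℤ y) ⟨
      ℚ.toℚᵘ (fromℤ x) ℚᵘ.* ℚ.toℚᵘ (fromℤ y)  ≃⟨ ℚₚ.toℚᵘ-homo-* (fromℤ x) (fromℤ y) ⟨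
      ℚ.toℚᵘ (fromℤ x * fromℤ y)              ∎)
      where open ℚᵘₚ.≤-Reasoning

    fromℤ-mono-≤ : ∀ {x y} → x ℤ.≤ y → fromℤ x ≤ fromℤ y
    fromℤ-mono-≤ {x} {y} x≤y = ℚₚ.toℚᵘ-cancel-≤ (begin
      ℚ.toℚᵘ (fromℤ x) ≃⟨ toℚᵘ-fromℤ x ⟩
      ℚᵘ.mkℚᵘ x 0      ≤⟨ ℚᵘ.*≤* (ℤₚ.*-monoʳ-≤-nonNeg (+ 1) x≤y) ⟩
      ℚᵘ.mkℚᵘ y 0      ≃⟨ toℚᵘ-fromℤ y ⟨
      ℚ.toℚᵘ (fromℤ y) ∎)
      where open ℚᵘₚ.≤-Reasoning

    fromℤ-cancel-≤ : ∀ {x y} → fromℤ x ≤ fromℤ y → x ℤ.≤ y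
    fromℤ-cancel-≤ {x} {y} p with begin
        ℚᵘ.mkℚᵘ x 0      ≃⟨ toℚᵘ-fromℤ x ⟨
        ℚ.toℚᵘ (fromℤ x) ≤⟨ ℚₚ.toℚᵘ-mono-≤ p ⟩
        ℚ.toℚᵘ (fromℤ y) ≃⟨ toℚᵘ-fromℤ y ⟩
        ℚᵘ.mkℚᵘ y 0      ∎
      where open ℚᵘₚ.≤-Reasoning
    ... | ℚᵘ.*≤* q = subst₂ ℤ._≤_ (ℤₚ.*-identityʳ x) (ℤₚ.*-identityʳ y) q

  ι : ℕ → ℚ
  ι n = fromℤ (+ n)

  ι-+ : ∀ m n → ι (m ℕ.+ n) ≡ ι m + ι n
  ι-+ m n = fromℤ-+ (+ m) (+ n)

  ι-* : ∀ m n → ι (m ℕ.* n) ≡ ι m * ι n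
  ι-* m n = trans (cong fromℤ (ℤₚ.pos-* m n)) (fromℤ-* (+ m) (+ n))

  ι-mono-≤ : ∀ {m n} → m ℕ.≤ n → ι m ≤ ι n
  ι-mono-≤ m≤n = fromℤ-mono-≤ (ℤ.+≤+ m≤n)

  ι-cancel-≤ : ∀ {m n} → ι m ≤ ι n → m ℕ.≤ n
  ι-cancel-≤ p = ℤₚ.drop‿+≤+ (fromℤ-cancel-≤ p)

  ι-injective : ∀ {m n} → ι m ≡ ι n → m ≡ n
  ι-injective eq = ℕₚ.≤-antisym (ι-cancel-≤ (ℚₚ.≤-reflexive eq)) (ι-cancel-≤ (ℚₚ.≤-reflexive (sym eq)))

  0≤ι : ∀ n → 0ℚ ≤ ι n
  0≤ι n = subst (_≤ ι n) fromℤ-0 (ι-mono-≤ (z≤n {n}))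

  archimedean : ∀ q → ∃ λ n → q ≤ ι n
  archimedean q@(mkℚ z d c) = ℤ.∣ z ∣ , ℚₚ.toℚᵘ-cancel-≤ (begin
    ℚᵘ.mkℚᵘ z d             ≤⟨ ℚᵘ.*≤* (subst (ℤ._≤ (+ ℤ.∣ z ∣) ℤ.* (+ suc d)) (sym (ℤₚ.*-identityʳ z)) (bound z)) ⟩
    ℚᵘ.mkℚᵘ (+ ℤ.∣ z ∣) 0    ≃⟨ toℚᵘ-fromℤ (+ ℤ.∣ z ∣) ⟨
    ℚ.toℚᵘ (ι ℤ.∣ z ∣)       ∎)
    where
    open ℚᵘₚ.≤-Reasoning
    bound : ∀ z → z ℤ.≤ (+ ℤ.∣ z ∣) ℤ.* (+ suc d)
    bound (+ n)    = subst ((+ n) ℤ.≤_) (ℤₚ.pos-* n (suc d)) (ℤ.+≤+ (ℕₚ.m≤m*n n (suc d)))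
    bound -[1+ n ] = ℤ.-≤+

  IsInteger : ℚ → Set
  IsInteger x = ∃ λ z → x ≡ fromℤ z

  integer-+ : ∀ {x y} → IsInteger x → IsInteger y → IsInteger (x + y)
  integer-+ (m , refl) (n , refl) = m ℤ.+ n , sym (fromℤ-+ m n)

  integer-* : ∀ {x y} → IsInteger x → IsInteger y → IsInteger (x * y)
  integer-* (m , refl) (n , refl) = m ℤ.* n , sym (fromℤ-* m n)

  -- The discreteness of ℤ, through which bounded sums of squares force almost all coefficients to
  -- vanish.
  integer-square : ∀ {x} → IsInteger x → x ≢ 0ℚ → 1ℚ ≤ x * x
  integer-square (+ zero , refl)   x≢0 = contradiction fromℤ-0 x≢0
  integer-square (+ suc n , refl)  x≢0 = subst₂ _≤_ fromℤ-1 (fromℤ-* (+ suc n) (+ suc n)) (fromℤ-mono-≤ (ℤ.+≤+ (s≤s z≤n)))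
  integer-square (-[1+ n ] , refl) x≢0 = subst₂ _≤_ fromℤ-1 (fromℤ-* -[1+ n ] -[1+ n ]) (fromℤ-mono-≤ (ℤ.+≤+ (s≤s z≤n)))

  denominator-clears : ∀ q → ∃ λ D → IsInteger (ι (suc D) * q)
  denominator-clears q@(mkℚ z d c) = d , z , ℚₚ.toℚᵘ-injective (begin-equality
    ℚ.toℚᵘ (ι (suc d) * q)              ≃⟨ ℚₚ.toℚᵘ-homo-* (ι (suc d)) q ⟩
    ℚ.toℚᵘ (ι (suc d)) ℚᵘ.* ℚ.toℚᵘ q    ≃⟨ ℚᵘₚ.*-congʳ (toℚᵘ-fromℤ (+ suc d)) ⟩
    ℚᵘ.mkℚᵘ (+ suc d) 0 ℚᵘ.* ℚᵘ.mkℚᵘ z d ≃⟨ ℚᵘ.*≡* (trans (ℤₚ.*-identityʳ _) (trans (ℤₚ.*-comm (+ suc d) z)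
                                              (cong (λ e → z ℤ.* (+ suc e)) (sym (ℕₚ.+-identityʳ d))))) ⟩
    ℚᵘ.mkℚᵘ z 0                         ≃⟨ toℚᵘ-fromℤ z ⟨
    ℚ.toℚᵘ (fromℤ z)                    ∎)
    where open ℚᵘₚ.≤-Reasoning

  0≤* : ∀ {a b} → 0ℚ ≤ a → 0ℚ ≤ b → 0ℚ ≤ a * b
  0≤* {a} {b} 0≤a 0≤b = subst (_≤ a * b) (ℚₚ.*-zeroʳ a) (ℚₚ.*-monoˡ-≤-nonNeg a {{ℚ.nonNegative 0≤a}} 0≤b)

  0≤+ : ∀ {a b} → 0ℚ ≤ a → 0ℚ ≤ b → 0ℚ ≤ a + b
  0≤+ 0≤a 0≤b = ℚₚ.+-mono-≤ 0≤a 0≤b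

  *-mono-≤ : ∀ {a b c d} → 0ℚ ≤ a → a ≤ b → 0ℚ ≤ c → c ≤ d → a * c ≤ b * d
  *-mono-≤ {a} {b} {c} {d} 0≤a a≤b 0≤c c≤d = ℚₚ.≤-trans
    (ℚₚ.*-monoˡ-≤-nonNeg a {{ℚ.nonNegative 0≤a}} c≤d)
    (ℚₚ.*-monoʳ-≤-nonNeg d {{ℚ.nonNegative (ℚₚ.≤-trans 0≤c c≤d)}} a≤b)

  *-monoˡ : ∀ {a b c} → 0ℚ ≤ a → b ≤ c → a * b ≤ a * c
  *-monoˡ {a} 0≤a = ℚₚ.*-monoˡ-≤-nonNeg a {{ℚ.nonNegative 0≤a}}

  square-∣∣ : ∀ x → x * x ≡ ∣ x ∣ * ∣ x ∣
  square-∣∣ x with ℚₚ.∣p∣≡p∨∣p∣≡-p x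
  ... | inj₁ eq rewrite eq = refl
  ... | inj₂ eq rewrite eq = solve 1 (λ x → x :* x := (:- x) :* (:- x)) refl x

  0≤square : ∀ x → 0ℚ ≤ x * x
  0≤square x = subst (0ℚ ≤_) (sym (square-∣∣ x)) (0≤* (ℚₚ.0≤∣p∣ x) (ℚₚ.0≤∣p∣ x))

  -- Finite sums, ℓ¹ norms and sums of squares

  Σ< : ℕ → (ℕ → ℚ) → ℚ
  Σ< zero    f = 0ℚ
  Σ< (suc n) f = f 0 + Σ< n (f ∘ suc)

  ⊛-Σ< : ∀ n f g → (f ⊛ g) n ≡ Σ< (suc n) (λ j → f j * g (n ∸ j))
  ⊛-Σ< zero    f g = refl
  ⊛-Σ< (suc n) f g = cong (λ x → f 0 * g (suc n) + x) (⊛-Σ< n (tail f) g)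

  Σ<-cong : ∀ n {f g} → (∀ k → k ℕ.< n → f k ≡ g k) → Σ< n f ≡ Σ< n g
  Σ<-cong zero    p = refl
  Σ<-cong (suc n) p = cong₂ _+_ (p 0 (s≤s z≤n)) (Σ<-cong n (λ k k<n → p (suc k) (s≤s k<n)))

  Σ<-mono : ∀ n {f g} → (∀ k → k ℕ.< n → f k ≤ g k) → Σ< n f ≤ Σ< n g
  Σ<-mono zero    p = ℚₚ.≤-refl
  Σ<-mono (suc n) p = ℚₚ.+-mono-≤ (p 0 (s≤s z≤n)) (Σ<-mono n (λ k k<n → p (suc k) (s≤s k<n)))

  Σ<-distrib-+ : ∀ n f g → Σ< n (λ k → f k + g k) ≡ Σ< n f + Σ< n g
  Σ<-distrib-+ zero    f g = refl
  Σ<-distrib-+ (suc n) f g = trans (cong (λ x → f 0 + g 0 + x) (Σ<-distrib-+ n (f ∘ suc) (g ∘ suc)))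
    (solve 4 (λ a b c d → a :+ b :+ (c :+ d) := (a :+ c) :+ (b :+ d)) refl (f 0) (g 0) (Σ< n (f ∘ suc)) (Σ< n (g ∘ suc)))

  Σ<-distrib-* : ∀ n c f → Σ< n (λ k → c * f k) ≡ c * Σ< n f
  Σ<-distrib-* zero    c f = sym (ℚₚ.*-zeroʳ c)
  Σ<-distrib-* (suc n) c f = trans (cong (λ x → c * f 0 + x) (Σ<-distrib-* n c (f ∘ suc))) (sym (ℚₚ.*-distribˡ-+ c _ _))

  Σ<-nonNeg : ∀ n {f} → (∀ k → 0ℚ ≤ f k) → 0ℚ ≤ Σ< n f
  Σ<-nonNeg zero    p = ℚₚ.≤-refl
  Σ<-nonNeg (suc n) p = 0≤+ (p 0) (Σ<-nonNeg n (p ∘ suc))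

  Σ<-zero : ∀ n {f} → (∀ k → f k ≡ 0ℚ) → Σ< n f ≡ 0ℚ
  Σ<-zero zero    p = refl
  Σ<-zero (suc n) p = trans (cong₂ _+_ (p 0) (Σ<-zero n (p ∘ suc))) (ℚₚ.+-identityˡ 0ℚ)

  Σ<-suc : ∀ n f → Σ< (suc n) f ≡ Σ< n f + f n
  Σ<-suc zero    f = ℚₚ.+-comm (f 0) 0ℚ
  Σ<-suc (suc n) f = trans (cong (λ x → f 0 + x) (Σ<-suc n (f ∘ suc))) (sym (ℚₚ.+-assoc (f 0) (Σ< n (f ∘ suc)) (f (suc n))))

  -- m and n may be in either order: terms missing on the left are nonnegative, excess terms on the
  -- left vanish.
  Σ<-support : ∀ m n (f : ℕ → ℚ) → (∀ k → 0ℚ ≤ f k) → (∀ k → n ℕ.≤ k → k ℕ.< m → f k ≡ 0ℚ) → Σ< m f ≤ Σ< n f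
  Σ<-support zero    n       f p z = Σ<-nonNeg n p
  Σ<-support (suc m) zero    f p z = ℚₚ.≤-reflexive
      (trans (Σ<-cong (suc m) (λ k k<m → z k z≤n k<m)) (Σ<-zero (suc m) {λ _ → 0ℚ} (λ _ → refl)))
  Σ<-support (suc m) (suc n) f p z = ℚₚ.+-monoʳ-≤ (f 0)
      (Σ<-support m n (f ∘ suc) (p ∘ suc) (λ k n≤k k<m → z (suc k) (s≤s n≤k) (s≤s k<m)))

  Σ<-monoˡ : ∀ {m n f} → (∀ k → 0ℚ ≤ f k) → m ℕ.≤ n → Σ< m f ≤ Σ< n f
  Σ<-monoˡ {m} {n} {f} p m≤n = Σ<-support m n f p
      (λ k n≤k k<m → contradiction (ℕₚ.≤-<-trans (ℕₚ.≤-trans m≤n n≤k) k<m) (ℕₚ.<-irrefl refl))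

  term≤Σ< : ∀ n {f} → (∀ k → 0ℚ ≤ f k) → ∀ k → k ℕ.< n → f k ≤ Σ< n f
  term≤Σ< n {f} p k k<n = ℚₚ.≤-trans (begin
    f k              ≡⟨ ℚₚ.+-identityˡ (f k) ⟨
    0ℚ + f k         ≤⟨ ℚₚ.+-monoˡ-≤ (f k) (Σ<-nonNeg k p) ⟩
    Σ< k f + f k     ≡⟨ Σ<-suc k f ⟨
    Σ< (suc k) f     ∎) (Σ<-monoˡ p k<n)
    where open ℚₚ.≤-Reasoning

  Σ∣_∣< : Series → ℕ → ℚ
  Σ∣ f ∣< K = Σ< K (λ k → ∣ f k ∣)

  infix 4 ∥_∥₁≤_
  -- A common bound on all partial sums replaces the norm itself, so that no limit has to be formed.
  record ∥_∥₁≤_ (f : Series) (B : ℕ) : Set where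
    constructor bounded
    field partial : ∀ K → Σ∣ f ∣< K ≤ ι B
  open ∥_∥₁≤_ public

  0≤Σ∣∣ : ∀ f K → 0ℚ ≤ Σ∣ f ∣< K
  0≤Σ∣∣ f K = Σ<-nonNeg K (λ k → ℚₚ.0≤∣p∣ (f k))

  ∥∥-cong : ∀ {f g B} → f ≗ g → ∥ f ∥₁≤ B → ∥ g ∥₁≤ B
  ∥∥-cong {B = B} eq p = bounded λ K → subst (_≤ ι B) (Σ<-cong K (λ k _ → cong ∣_∣ (eq k))) (partial p K)

  ∥∥-weaken : ∀ {f B C} → B ℕ.≤ C → ∥ f ∥₁≤ B → ∥ f ∥₁≤ C
  ∥∥-weaken B≤C p = bounded λ K → ℚₚ.≤-trans (partial p K) (ι-mono-≤ B≤C)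

  ∥∥-difference : ∀ {f g h B C} → (f ⊕ g) ≗ h → ∥ g ∥₁≤ B → ∥ h ∥₁≤ C → ∥ f ∥₁≤ C ℕ.+ B
  ∥∥-difference {f} {g} {h} {B} {C} eq p q = bounded λ K → begin
    Σ∣ f ∣< K                          ≤⟨ Σ<-mono K (λ k _ → term k) ⟩
    Σ< K (λ k → ∣ h k ∣ + ∣ g k ∣)     ≡⟨ Σ<-distrib-+ K _ _ ⟩
    Σ∣ h ∣< K + Σ∣ g ∣< K              ≤⟨ ℚₚ.+-mono-≤ (partial q K) (partial p K) ⟩
    ι C + ι B                          ≡⟨ ι-+ C B ⟨
    ι (C ℕ.+ B)                        ∎
    where
    open ℚₚ.≤-Reasoning
    term : ∀ k → ∣ f k ∣ ≤ ∣ h k ∣ + ∣ g k ∣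
    term k = subst (λ x → ∣ x ∣ ≤ ∣ h k ∣ + ∣ g k ∣)
      (trans (cong (ℚ._- g k) (sym (eq k))) (solve 2 (λ x y → x :+ y :- y := x) refl (f k) (g k)))
      (ℚₚ.∣p-q∣≤∣p∣+∣q∣ (h k) (g k))

  ∥∥-⊕ : ∀ {f g B C} → ∥ f ∥₁≤ B → ∥ g ∥₁≤ C → ∥ f ⊕ g ∥₁≤ B ℕ.+ C
  ∥∥-⊕ {f} {g} {B} {C} p q = bounded λ K → begin
    Σ∣ f ⊕ g ∣< K                      ≤⟨ Σ<-mono K (λ k _ → ℚₚ.∣p+q∣≤∣p∣+∣q∣ (f k) (g k)) ⟩
    Σ< K (λ k → ∣ f k ∣ + ∣ g k ∣)     ≡⟨ Σ<-distrib-+ K _ _ ⟩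
    Σ∣ f ∣< K + Σ∣ g ∣< K              ≤⟨ ℚₚ.+-mono-≤ (partial p K) (partial q K) ⟩
    ι B + ι C                          ≡⟨ ι-+ B C ⟨
    ι (B ℕ.+ C)                        ∎
    where open ℚₚ.≤-Reasoning

  -- Submultiplicativity of the ℓ¹ norm passes to partial sums because a coefficient of index below
  -- K of a product involves only coefficients of index below K.
  Σ∣⊛∣ : ∀ K f g → Σ∣ f ⊛ g ∣< K ≤ Σ∣ f ∣< K * Σ∣ g ∣< K
  Σ∣⊛∣ zero    f g = ℚₚ.≤-refl
  Σ∣⊛∣ (suc K) f g = begin
    ∣ (f ⊛ g) 0 ∣ + Σ< K (λ k → ∣ f 0 * g (suc k) + (tail f ⊛ g) k ∣)
      ≤⟨ ℚₚ.+-mono-≤ (ℚₚ.≤-reflexive (trans (cong ∣_∣ (⊛-head f g)) (ℚₚ.∣p*q∣≡∣p∣*∣q∣ (f 0) (g 0))))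
           (Σ<-mono K (λ k _ → ℚₚ.≤-trans (ℚₚ.∣p+q∣≤∣p∣+∣q∣ (f 0 * g (suc k)) _)
             (ℚₚ.+-monoˡ-≤ _ (ℚₚ.≤-reflexive (ℚₚ.∣p*q∣≡∣p∣*∣q∣ (f 0) (g (suc k))))))) ⟩
    ∣ f 0 ∣ * ∣ g 0 ∣ + Σ< K (λ k → ∣ f 0 ∣ * ∣ g (suc k) ∣ + ∣ (tail f ⊛ g) k ∣)
      ≡⟨ cong (λ x → ∣ f 0 ∣ * ∣ g 0 ∣ + x)
          (trans (Σ<-distrib-+ K _ _) (cong (_+ Σ∣ tail f ⊛ g ∣< K) (Σ<-distrib-* K ∣ f 0 ∣ _))) ⟩
    ∣ f 0 ∣ * ∣ g 0 ∣ + (∣ f 0 ∣ * Σ∣ tail g ∣< K + Σ∣ tail f ⊛ g ∣< K)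
      ≤⟨ ℚₚ.+-monoʳ-≤ (∣ f 0 ∣ * ∣ g 0 ∣) (ℚₚ.+-monoʳ-≤ (∣ f 0 ∣ * Σ∣ tail g ∣< K) (ℚₚ.≤-trans (Σ∣⊛∣ K (tail f) g)
           (*-monoˡ (0≤Σ∣∣ (tail f) K) (Σ<-monoˡ (λ k → ℚₚ.0≤∣p∣ (g k)) (ℕₚ.n≤1+n K))))) ⟩
    ∣ f 0 ∣ * ∣ g 0 ∣ + (∣ f 0 ∣ * Σ∣ tail g ∣< K + Σ∣ tail f ∣< K * Σ∣ g ∣< (suc K))
      ≡⟨ solve 4 (λ a b c d → a :* b :+ (a :* c :+ d :* (b :+ c)) := (a :+ d) :* (b :+ c)) refl
           ∣ f 0 ∣ ∣ g 0 ∣ (Σ∣ tail g ∣< K) (Σ∣ tail f ∣< K) ⟩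
    Σ∣ f ∣< (suc K) * Σ∣ g ∣< (suc K) ∎
    where open ℚₚ.≤-Reasoning

  ∥∥-⊛ : ∀ {f g B C} → ∥ f ∥₁≤ B → ∥ g ∥₁≤ C → ∥ f ⊛ g ∥₁≤ B ℕ.* C
  ∥∥-⊛ {f} {g} {B} {C} p q = bounded λ K → ℚₚ.≤-trans (Σ∣⊛∣ K f g)
    (subst (Σ∣ f ∣< K * Σ∣ g ∣< K ≤_) (sym (ι-* B C)) (*-mono-≤ (0≤Σ∣∣ f K) (partial p K) (0≤Σ∣∣ g K) (partial q K)))

  ∥∥-support : ∀ {f B} d → (∀ k → d ℕ.≤ k → f k ≡ 0ℚ) → Σ∣ f ∣< d ≤ ι B → ∥ f ∥₁≤ B
  ∥∥-support {f} d z b = bounded λ K → ℚₚ.≤-trans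
    (Σ<-support K d _ (λ k → ℚₚ.0≤∣p∣ (f k)) (λ k d≤k _ → cong ∣_∣ (z k d≤k))) b

  polynomial-∥∥ : ∀ {f} → IsPolynomial f → ∃ λ B → ∥ f ∥₁≤ B
  polynomial-∥∥ {f} (d , z) with archimedean (Σ∣ f ∣< d)
  ... | B , b = B , ∥∥-support d z b

  ∥1S∥ : ∥ 1S ∥₁≤ 1
  ∥1S∥ = ∥∥-support 1 (λ { (suc k) _ → refl }) (ℚₚ.≤-reflexive (trans (ℚₚ.+-identityʳ 1ℚ) (sym fromℤ-1)))

  ∥0S∥ : ∥ 0S ∥₁≤ 0
  ∥0S∥ = ∥∥-support 0 (λ _ _ → refl) (ℚₚ.≤-reflexive (sym fromℤ-0))

  ∥∥-^ : ∀ {f B} n → ∥ f ∥₁≤ B → ∥ f SE.^ n ∥₁≤ B ℕ.^ n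
  ∥∥-^ zero    p = ∥1S∥
  ∥∥-^ {f} (suc n) p = ∥∥-⊛ {f} {f SE.^ n} p (∥∥-^ n p)

  -- Stands for the square of the ℓ² norm, cut off at K.
  Σ□_< : Series → ℕ → ℚ
  Σ□ f < K = Σ< K (λ k → f k * f k)

  Σ□≤Σ∣∣² : ∀ K f → Σ□ f < K ≤ Σ∣ f ∣< K * Σ∣ f ∣< K
  Σ□≤Σ∣∣² zero    f = ℚₚ.≤-refl
  Σ□≤Σ∣∣² (suc K) f = begin
    f 0 * f 0 + Σ□ tail f < K           ≤⟨ ℚₚ.+-mono-≤ (ℚₚ.≤-reflexive (square-∣∣ (f 0))) (Σ□≤Σ∣∣² K (tail f)) ⟩
    a * a + b * b                       ≡⟨ ℚₚ.+-identityʳ _ ⟨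
    a * a + b * b + 0ℚ                  ≤⟨ ℚₚ.+-monoʳ-≤ (a * a + b * b) (0≤+ 0≤ab 0≤ab) ⟩
    a * a + b * b + (a * b + a * b)
         ≡⟨ solve 2 (λ a b → a :* a :+ b :* b :+ (a :* b :+ a :* b) := (a :+ b) :* (a :+ b)) refl a b ⟩
    (a + b) * (a + b)                   ∎
    where
    open ℚₚ.≤-Reasoning
    a = ∣ f 0 ∣
    b = Σ∣ tail f ∣< K
    0≤ab : 0ℚ ≤ a * b
    0≤ab = 0≤* (ℚₚ.0≤∣p∣ (f 0)) (0≤Σ∣∣ (tail f) K)

module _ where

  open import Data.Rational using (_+_; _*_; -_; _≤_; ∣_∣)

  -- Shifts, degrees and reversal of polynomials

  X^-cong : ∀ s {f g} → f ≗ g → (X^ s · f) ≗ (X^ s · g)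
  X^-cong zero    eq n       = eq n
  X^-cong (suc s) eq zero    = refl
  X^-cong (suc s) eq (suc n) = X^-cong s eq n

  X^-⊕ : ∀ s f g → (X^ s · (f ⊕ g)) ≗ ((X^ s · f) ⊕ (X^ s · g))
  X^-⊕ zero    f g n       = refl
  X^-⊕ (suc s) f g zero    = refl
  X^-⊕ (suc s) f g (suc n) = X^-⊕ s f g n

  X^-⊛ : ∀ s f g → ((X^ s · f) ⊛ g) ≗ (X^ s · (f ⊛ g))
  X^-⊛ zero    f g n       = refl
  X^-⊛ (suc s) f g zero    = trans (⊛-head (X^ suc s · f) g) (ℚₚ.*-zeroˡ (g 0))
  X^-⊛ (suc s) f g (suc n) = trans (cong₂ _+_ (ℚₚ.*-zeroˡ (g (suc n))) (X^-⊛ s f g n)) (ℚₚ.+-identityˡ _)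

  X^-+ : ∀ s t f → (X^ s · (X^ t · f)) ≗ (X^ (s ℕ.+ t) · f)
  X^-+ zero    t f n       = refl
  X^-+ (suc s) t f zero    = refl
  X^-+ (suc s) t f (suc n) = X^-+ s t f n

  X^-below : ∀ s f {k} → k ℕ.< s → (X^ s · f) k ≡ 0ℚ
  X^-below (suc s) f {zero}  k<s       = refl
  X^-below (suc s) f {suc k} (s≤s k<s) = X^-below s f k<s

  X^-above : ∀ s f n → (X^ s · f) (s ℕ.+ n) ≡ f n
  X^-above zero    f n = refl
  X^-above (suc s) f n = X^-above s f n

  X^-0S : ∀ s → (X^ s · 0S) ≗ 0S
  X^-0S zero    n       = refl
  X^-0S (suc s) zero    = refl
  X^-0S (suc s) (suc n) = X^-0S s n

  const-cong : ∀ {a b} → a ≡ b → const a ≗ const b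
  const-cong refl n = refl

  const-⊕ : ∀ a b → const (a + b) ≗ (const a ⊕ const b)
  const-⊕ a b zero    = refl
  const-⊕ a b (suc n) = refl

  Degree≤ : ℕ → Series → Set
  Degree≤ K f = ∀ k → K ℕ.< k → f k ≡ 0ℚ

  Degree≤-⊛ : ∀ K {L f g} → Degree≤ K f → Degree≤ L g → Degree≤ (K ℕ.+ L) (f ⊛ g)
  Degree≤-⊛ zero {f = f} {g} p q k L<k = begin
    (f ⊛ g) k             ≡⟨ ⊛-cong {f} {const (f 0)} {g} {g} (λ { zero → refl ; (suc j) → p (suc j) (s≤s z≤n) }) (λ _ → refl) k ⟩
    (const (f 0) ⊛ g) k   ≡⟨ const-⊛ (f 0) g k ⟩
    f 0 * g k             ≡⟨ cong (f 0 *_) (q k L<k) ⟩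
    f 0 * 0ℚ              ≡⟨ ℚₚ.*-zeroʳ (f 0) ⟩
    0ℚ                    ∎
    where open ≡-Reasoning
  Degree≤-⊛ (suc K) {L} {f} {g} p q (suc k) (s≤s lt) = trans
    (cong₂ _+_ (trans (cong (f 0 *_) (q (suc k) (ℕₚ.m≤n⇒m≤1+n (ℕₚ.≤-trans (s≤s (ℕₚ.m≤n+m L K)) lt)))) (ℚₚ.*-zeroʳ (f 0)))
               (Degree≤-⊛ K {f = tail f} {g} (λ j K<j → p (suc j) (s≤s K<j)) q k lt))
    (ℚₚ.+-identityˡ 0ℚ)

  -- The reversal X^K f(1/X) of the part of f of degree at most K.
  rev : ℕ → Series → Series
  rev zero    f = const (f 0)
  rev (suc K) f = rev K (tail f) ⊕ (X^ suc K · const (f 0))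

  rev-cong : ∀ K {f g} → f ≗ g → rev K f ≗ rev K g
  rev-cong zero    eq   = const-cong (eq 0)
  rev-cong (suc K) eq n = cong₂ _+_ (rev-cong K (eq ∘ suc) n) (X^-cong (suc K) (const-cong (eq 0)) n)

  rev-⊕ : ∀ K f g → rev K (f ⊕ g) ≗ (rev K f ⊕ rev K g)
  rev-⊕ zero    f g n = const-⊕ (f 0) (g 0) n
  rev-⊕ (suc K) f g n = begin
    rev K (tail f ⊕ tail g) n + (X^ suc K · const (f 0 + g 0)) n
      ≡⟨ cong₂ _+_ (rev-⊕ K (tail f) (tail g) n) (trans (X^-cong (suc K) (const-⊕ (f 0) (g 0)) n) (X^-⊕ (suc K) _ _ n)) ⟩
    rev K (tail f) n + rev K (tail g) n + ((X^ suc K · const (f 0)) n + (X^ suc K · const (g 0)) n)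
      ≡⟨ solve 4 (λ a b c d → a :+ b :+ (c :+ d) := (a :+ c) :+ (b :+ d)) refl (rev K (tail f) n) (rev K (tail g) n) _ _ ⟩
    rev (suc K) f n + rev (suc K) g n ∎
    where open ≡-Reasoning

  X^-• : ∀ s c f → (X^ s · (c • f)) ≗ c • (X^ s · f)
  X^-• zero    c f n       = refl
  X^-• (suc s) c f zero    = sym (ℚₚ.*-zeroʳ c)
  X^-• (suc s) c f (suc n) = X^-• s c f n

  const-• : ∀ c a → const (c * a) ≗ c • const a
  const-• c a zero    = refl
  const-• c a (suc n) = sym (ℚₚ.*-zeroʳ c)

  rev-• : ∀ K c f → rev K (c • f) ≗ c • rev K f
  rev-• zero    c f n = const-• c (f 0) n
  rev-• (suc K) c f n = trans
    (cong₂ _+_ (rev-• K c (tail f) n) (trans (X^-cong (suc K) (const-• c (f 0)) n) (X^-• (suc K) c _ n)))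
    (sym (ℚₚ.*-distribˡ-+ c (rev K (tail f) n) _))

  X^const-high : ∀ s c k → s ℕ.< k → (X^ s · const c) k ≡ 0ℚ
  X^const-high zero    c (suc k) s<k       = refl
  X^const-high (suc s) c (suc k) (s≤s s<k) = X^const-high s c k s<k

  rev-degree : ∀ K f → Degree≤ K (rev K f)
  rev-degree zero    f (suc k) K<k = refl
  rev-degree (suc K) f k       K<k = trans
    (cong₂ _+_ (rev-degree K (tail f) k (ℕₚ.<-trans (ℕₚ.n<1+n K) K<k)) (X^const-high (suc K) (f 0) k K<k)) (ℚₚ.+-identityˡ 0ℚ)

  rev-coefficient : ∀ K f j → j ℕ.≤ K → rev K f (K ∸ j) ≡ f j
  rev-coefficient zero    f zero    z≤n = refl
  rev-coefficient (suc K) f zero    z≤n = trans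
    (cong₂ _+_ (rev-degree K (tail f) (suc K) (ℕₚ.n<1+n K))
               (trans (cong (X^ K · const (f 0)) (sym (ℕₚ.+-identityʳ K))) (X^-above K (const (f 0)) 0)))
    (ℚₚ.+-identityˡ (f 0))
  rev-coefficient (suc K) f (suc j) (s≤s j≤K) = trans
    (cong₂ _+_ (rev-coefficient K (tail f) j j≤K) (X^-below (suc K) (const (f 0)) (s≤s (ℕₚ.m∸n≤m K j))))
    (ℚₚ.+-identityʳ (f (suc j)))

  rev-involutive : ∀ K {f} → Degree≤ K f → rev K (rev K f) ≗ f
  rev-involutive K {f} deg k with k ℕₚ.≤? K
  ... | yes k≤K = begin
    rev K (rev K f) k             ≡⟨ cong (rev K (rev K f)) (ℕₚ.m∸[m∸n]≡n k≤K) ⟨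
    rev K (rev K f) (K ∸ (K ∸ k)) ≡⟨ rev-coefficient K (rev K f) (K ∸ k) (ℕₚ.m∸n≤m K k) ⟩
    rev K f (K ∸ k)               ≡⟨ rev-coefficient K f k k≤K ⟩
    f k                           ∎
    where open ≡-Reasoning
  ... | no k≰K = trans (rev-degree K (rev K f) k (ℕₚ.≰⇒> k≰K)) (sym (deg k (ℕₚ.≰⇒> k≰K)))

  rev-0S : ∀ K {f} → f ≗ 0S → rev K f ≗ 0S
  rev-0S K {f} z n = begin
    rev K f n        ≡⟨ rev-cong K (λ k → trans (z k) (sym (ℚₚ.*-zeroˡ (f k)))) n ⟩
    rev K (0ℚ • f) n ≡⟨ rev-• K 0ℚ f n ⟩
    0ℚ * rev K f n   ≡⟨ ℚₚ.*-zeroˡ (rev K f n) ⟩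
    0ℚ               ∎
    where open ≡-Reasoning

  -- A degree overstated by n multiplies the reversal by X^n. In `rev-⊛` this occurs where the
  -- constant term of f multiplies h.
  rev-shift : ∀ n L {h} → Degree≤ L h → rev (n ℕ.+ L) h ≗ (X^ n · rev L h)
  rev-shift zero    zero {h} deg k = refl
  rev-shift (suc n) zero {h} deg k rewrite ℕₚ.+-identityʳ n =
    trans (cong (_+ (X^ suc n · const (h 0)) k) (rev-0S n (λ j → deg (suc j) (s≤s z≤n)) k)) (ℚₚ.+-identityˡ _)
  rev-shift n (suc L) {h} deg k rewrite ℕₚ.+-suc n L = begin
    rev (n ℕ.+ L) (tail h) k + (X^ suc (n ℕ.+ L) · const (h 0)) k
      ≡⟨ cong₂ _+_ (rev-shift n L (λ j L<j → deg (suc j) (s≤s L<j)) k)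
          (trans (cong (λ m → (X^ m · const (h 0)) k) (sym (ℕₚ.+-suc n L))) (sym (X^-+ n (suc L) (const (h 0)) k))) ⟩
    (X^ n · rev L (tail h)) k + (X^ n · (X^ suc L · const (h 0))) k ≡⟨ X^-⊕ n _ _ k ⟨
    (X^ n · rev (suc L) h) k ∎
    where open ≡-Reasoning

  -- X^(K+L) splits between f(1/X) and h(1/X); the induction writes f as f 0 + X · `tail f`.
  rev-⊛ : ∀ K L {f h} → Degree≤ K f → Degree≤ L h → rev (K ℕ.+ L) (f ⊛ h) ≗ (rev K f ⊛ rev L h)
  rev-⊛ zero L {f} {h} degf degh n = begin
    rev L (f ⊛ h) n             ≡⟨ rev-cong L
        (⊛-cong {f} {const (f 0)} {h} {h} (λ { zero → refl ; (suc j) → degf (suc j) (s≤s z≤n) }) (λ _ → refl)) n ⟩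
    rev L (const (f 0) ⊛ h) n   ≡⟨ rev-cong L (const-⊛ (f 0) h) n ⟩
    rev L (f 0 • h) n           ≡⟨ rev-• L (f 0) h n ⟩
    f 0 * rev L h n             ≡⟨ const-⊛ (f 0) (rev L h) n ⟨
    (const (f 0) ⊛ rev L h) n   ∎
    where open ≡-Reasoning
  rev-⊛ (suc K) L {f} {h} degf degh n = begin
    rev (K ℕ.+ L) (tail (f ⊛ h)) n + (X^ suc (K ℕ.+ L) · const ((f ⊛ h) 0)) n
      ≡⟨ cong₂ _+_ (rev-⊕ (K ℕ.+ L) (f 0 • tail h) (tail f ⊛ h) n)
           (trans (X^-cong (suc (K ℕ.+ L)) (λ k → trans (const-cong (⊛-head f h) k) (const-• (f 0) (h 0) k)) n)
               (X^-• (suc (K ℕ.+ L)) (f 0) _ n)) ⟩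
    rev (K ℕ.+ L) (f 0 • tail h) n + rev (K ℕ.+ L) (tail f ⊛ h) n + f 0 * (X^ suc (K ℕ.+ L) · const (h 0)) n
      ≡⟨ cong (_+ f 0 * (X^ suc (K ℕ.+ L) · const (h 0)) n)
           (cong₂ _+_ (rev-• (K ℕ.+ L) (f 0) (tail h) n) (rev-⊛ K L {tail f} {h} (λ j K<j → degf (suc j) (s≤s K<j)) degh n)) ⟩
    f 0 * rev (K ℕ.+ L) (tail h) n + (rev K (tail f) ⊛ rev L h) n + f 0 * (X^ suc (K ℕ.+ L) · const (h 0)) n
      ≡⟨ solve 4 (λ a b c d → a :* b :+ c :+ a :* d := c :+ a :* (b :+ d)) refl
           (f 0) (rev (K ℕ.+ L) (tail h) n) ((rev K (tail f) ⊛ rev L h) n) ((X^ suc (K ℕ.+ L) · const (h 0)) n) ⟩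
    (rev K (tail f) ⊛ rev L h) n + f 0 * rev (suc K ℕ.+ L) h n
      ≡⟨ cong (λ x → (rev K (tail f) ⊛ rev L h) n + f 0 * x) (rev-shift (suc K) L degh n) ⟩
    (rev K (tail f) ⊛ rev L h) n + f 0 * (X^ suc K · rev L h) n
      ≡⟨ cong ((rev K (tail f) ⊛ rev L h) n +_) (trans (sym (X^-• (suc K) (f 0) (rev L h) n))
           (trans (X^-cong (suc K) (λ k → sym (const-⊛ (f 0) (rev L h) k)) n) (sym (X^-⊛ (suc K) (const (f 0)) (rev L h) n)))) ⟩
    (rev K (tail f) ⊛ rev L h) n + ((X^ suc K · const (f 0)) ⊛ rev L h) n
      ≡⟨ ⊛-distribʳ (rev L h) (rev K (tail f)) (X^ suc K · const (f 0)) n ⟨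
    (rev (suc K) f ⊛ rev L h) n ∎
    where open ≡-Reasoning

  -- The coefficient of index K of f · `rev K f` pairs each f j with itself. It takes the place of
  -- the integral in Parseval's formula.
  Σ□-rev : ∀ K f → Σ□ f < (suc K) ≡ (f ⊛ rev K f) K
  Σ□-rev K f = sym (trans (⊛-Σ< K f (rev K f))
    (Σ<-cong (suc K) (λ { j (s≤s j≤K) → cong (f j *_) (rev-coefficient K f j j≤K) })))

  -- For a polynomial F with reversal G, both F·F and F·G have sum of squares equal to
  -- the middle coefficient of F·F·G·G, and F·G has the middle coefficient ΣF².
  Σ□-square : ∀ K {F} → Degree≤ K F →
              Σ□ F < (suc K) * Σ□ F < (suc K) ≤ Σ□ (F ⊛ F) < (suc (K ℕ.+ K))
  Σ□-square K {F} deg = begin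
    Σ□ F < (suc K) * Σ□ F < (suc K)       ≡⟨ cong₂ _*_ (Σ□-rev K F) (Σ□-rev K F) ⟩
    H K * H K                             ≤⟨ term≤Σ< (suc (K ℕ.+ K)) (λ k → 0≤square (H k)) K (s≤s (ℕₚ.m≤m+n K K)) ⟩
    Σ□ H < (suc (K ℕ.+ K))                ≡⟨ Σ□-rev (K ℕ.+ K) H ⟩
    (H ⊛ rev (K ℕ.+ K) H) (K ℕ.+ K)
         ≡⟨ S.*-congˡ {H} (S.trans (rev-⊛ K K {F} {G} deg (rev-degree K F)) (S.*-congˡ {G} (rev-involutive K deg))) (K ℕ.+ K) ⟩
    ((F ⊛ G) ⊛ (G ⊛ F)) (K ℕ.+ K)
         ≡⟨ SS.solve 2 (λ f g → (f SS.:* g) SS.:* (g SS.:* f) SS.:= (f SS.:* f) SS.:* (g SS.:* g)) S.refl F G (K ℕ.+ K) ⟩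
    ((F ⊛ F) ⊛ (G ⊛ G)) (K ℕ.+ K)         ≡⟨ S.*-congˡ {F ⊛ F} (S.sym (rev-⊛ K K {F} {F} deg deg)) (K ℕ.+ K) ⟩
    ((F ⊛ F) ⊛ rev (K ℕ.+ K) (F ⊛ F)) (K ℕ.+ K) ≡⟨ Σ□-rev (K ℕ.+ K) (F ⊛ F) ⟨
    Σ□ (F ⊛ F) < (suc (K ℕ.+ K))          ∎
    where
    open ℚₚ.≤-Reasoning
    G = rev K F
    H = F ⊛ G

  -- Repeated squaring and the ℓ² bound

  Σ□-cong : ∀ K {f g} → f ≗ g → Σ□ f < K ≡ Σ□ g < K
  Σ□-cong K eq = Σ<-cong K (λ k _ → cong₂ _*_ (eq k) (eq k))

  -- By `Σ□-square`, each squaring of the polynomial doubles the degree bound and squares the lower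
  -- bound; hence the exponents 2^j.
  Σ□-power : ∀ j {p K c} → Degree≤ K p → ι c ≤ Σ□ p < (suc K) →
             ∃ λ K′ → Degree≤ K′ (p SE.^ (2 ℕ.^ j)) × ι (c ℕ.^ (2 ℕ.^ j)) ≤ Σ□ (p SE.^ (2 ℕ.^ j)) < (suc K′)
  Σ□-power zero {p} {K} {c} deg le = K , (λ k K<k → trans (S.*-identityʳ p k) (deg k K<k)) ,
    subst₂ _≤_ (cong ι (sym (ℕₚ.*-identityʳ c))) (Σ□-cong (suc K) (S.sym (S.*-identityʳ p))) le
  Σ□-power (suc j) {p} {K} {c} deg le with Σ□-power j {p} {K} {c} deg le
  ... | K′ , deg′ , le′ = K′ ℕ.+ K′ ,
    (λ k lt → trans (split k) (Degree≤-⊛ K′ {f = P} {P} deg′ deg′ k lt)) , (begin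
      ι (c ℕ.^ (2 ℕ.* n))
           ≡⟨ cong ι (trans (cong (λ m → c ℕ.^ (n ℕ.+ m)) (ℕₚ.+-identityʳ n)) (ℕₚ.^-distribˡ-+-* c n n)) ⟩
      ι (c ℕ.^ n ℕ.* c ℕ.^ n)            ≡⟨ ι-* (c ℕ.^ n) (c ℕ.^ n) ⟩
      ι (c ℕ.^ n) * ι (c ℕ.^ n)          ≤⟨ *-mono-≤ (0≤ι _) le′ (0≤ι _) le′ ⟩
      Σ□ P < (suc K′) * Σ□ P < (suc K′)  ≤⟨ Σ□-square K′ deg′ ⟩
      Σ□ (P ⊛ P) < (suc (K′ ℕ.+ K′))     ≡⟨ Σ□-cong (suc (K′ ℕ.+ K′)) split ⟨
      Σ□ (p SE.^ (2 ℕ.* n)) < (suc (K′ ℕ.+ K′)) ∎)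
    where
    open ℚₚ.≤-Reasoning
    n = 2 ℕ.^ j
    P = p SE.^ n
    split : (p SE.^ (2 ℕ.* n)) ≗ (P ⊛ P)
    split = S.trans (SE.^-congʳ p (cong (n ℕ.+_) (ℕₚ.+-identityʳ n))) (SE.^-homo-* p n n)

  ^-distribʳ-* : ∀ b n → (b ℕ.* b) ℕ.^ n ≡ b ℕ.^ n ℕ.* b ℕ.^ n
  ^-distribʳ-* b zero    = refl
  ^-distribʳ-* b (suc n) = trans (cong (b ℕ.* b ℕ.*_) (^-distribʳ-* b n))
    (ℕS.solve 2 (λ b x → b ℕS.:* b ℕS.:* (x ℕS.:* x) ℕS.:= b ℕS.:* x ℕS.:* (b ℕS.:* x)) refl b (b ℕ.^ n))

  -- (1 + 1/b)^n ≥ 1 + n/b, multiplied by b^(n+1).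
  bernoulli : ∀ b n → b ℕ.^ n ℕ.* (b ℕ.+ n) ℕ.≤ b ℕ.* suc b ℕ.^ n
  bernoulli b zero = ℕₚ.≤-reflexive (trans (ℕₚ.+-identityʳ (b ℕ.+ 0)) (trans (ℕₚ.+-identityʳ b) (sym (ℕₚ.*-identityʳ b))))
  bernoulli b (suc n) = begin
    b ℕ.* x ℕ.* (b ℕ.+ suc n)                    ≤⟨ ℕₚ.m≤m+n _ (x ℕ.* n) ⟩
    b ℕ.* x ℕ.* (b ℕ.+ suc n) ℕ.+ x ℕ.* n
         ≡⟨ ℕS.solve 3 (λ b x n → b ℕS.:* x ℕS.:* (b ℕS.:+ (ℕS.con 1 ℕS.:+ n)) ℕS.:+ x ℕS.:* n
                                                      ℕS.:= x ℕS.:* (b ℕS.:+ n) ℕS.:* (ℕS.con 1 ℕS.:+ b)) refl b x n ⟩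
    x ℕ.* (b ℕ.+ n) ℕ.* suc b                    ≤⟨ ℕₚ.*-monoˡ-≤ (suc b) (bernoulli b n) ⟩
    b ℕ.* suc b ℕ.^ n ℕ.* suc b
         ≡⟨ trans (ℕₚ.*-assoc b (suc b ℕ.^ n) (suc b)) (cong (b ℕ.*_) (ℕₚ.*-comm (suc b ℕ.^ n) (suc b))) ⟩
    b ℕ.* (suc b ℕ.* suc b ℕ.^ n)                ∎
    where
    open ℕₚ.≤-Reasoning
    x = b ℕ.^ n

  n<2^n : ∀ n → n ℕ.< 2 ℕ.^ n
  n<2^n zero    = s≤s z≤n
  n<2^n (suc n) = ℕₚ.+-mono-≤ (ℕₚ.≤-trans (s≤s z≤n) (n<2^n n)) (ℕₚ.≤-trans (n<2^n n) (ℕₚ.≤-reflexive (sym (ℕₚ.+-identityʳ _))))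

  -- Divided by b^n, the inequality would bound (1 + 1/b)^n ≥ 1 + n/b by C, which the exponent n =
  -- 2^(b·C) > b·C refutes.
  exponential-gap : ∀ b C → 1 ℕ.≤ b → ¬ (∀ j → suc b ℕ.^ (2 ℕ.^ j) ℕ.≤ C ℕ.* b ℕ.^ (2 ℕ.^ j))
  exponential-gap b@(suc _) C 1≤b le = ℕₚ.<-irrefl refl (begin-strict
    b ℕ.* C    <⟨ n<2^n (b ℕ.* C) ⟩
    n          ≤⟨ ℕₚ.m≤n+m n b ⟩
    b ℕ.+ n    ≤⟨ ℕₚ.*-cancelˡ-≤ (b ℕ.^ n) {{ℕₚ.m^n≢0 b n}} (begin
                    b ℕ.^ n ℕ.* (b ℕ.+ n)     ≤⟨ bernoulli b n ⟩
                    b ℕ.* suc b ℕ.^ n         ≤⟨ ℕₚ.*-monoʳ-≤ b (le (b ℕ.* C)) ⟩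
                    b ℕ.* (C ℕ.* b ℕ.^ n)     ≡⟨ trans (sym (ℕₚ.*-assoc b C _)) (ℕₚ.*-comm (b ℕ.* C) _) ⟩
                    b ℕ.^ n ℕ.* (b ℕ.* C)     ∎) ⟩
    b ℕ.* C    ∎)
    where
    open ℕₚ.≤-Reasoning
    n = 2 ℕ.^ (b ℕ.* C)

  -- With x = ∥p∥₂² and n = 2ʲ, squaring repeatedly gives xⁿ ≤ ∥pⁿ∥₂² ≤ ∥pⁿ∥₁² ≤ Q² B²ⁿ.
  ℓ²-bound : ∀ {p K Q B} → Degree≤ K p → 1 ℕ.≤ B → (∀ n → ∥ p SE.^ n ∥₁≤ Q ℕ.* B ℕ.^ n) →
             ¬ (ι (suc (B ℕ.* B)) ≤ Σ□ p < (suc K))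
  ℓ²-bound {p} {K} {Q} {B} deg 1≤B growth le = exponential-gap (B ℕ.* B) (Q ℕ.* Q) (ℕₚ.*-mono-≤ 1≤B 1≤B) bound
    where
    bound : ∀ j → suc (B ℕ.* B) ℕ.^ (2 ℕ.^ j) ℕ.≤ Q ℕ.* Q ℕ.* (B ℕ.* B) ℕ.^ (2 ℕ.^ j)
    bound j with Σ□-power j {p} {K} {suc (B ℕ.* B)} deg le
    ... | K′ , _ , le′ = ι-cancel-≤ (begin
      ι (suc (B ℕ.* B) ℕ.^ n)                          ≤⟨ le′ ⟩
      Σ□ P < (suc K′)                                  ≤⟨ Σ□≤Σ∣∣² (suc K′) P ⟩
      Σ∣ P ∣< (suc K′) * Σ∣ P ∣< (suc K′)
           ≤⟨ *-mono-≤ (0≤Σ∣∣ P (suc K′)) (partial (growth n) (suc K′)) (0≤Σ∣∣ P (suc K′)) (partial (growth n) (suc K′)) ⟩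
      ι (Q ℕ.* B ℕ.^ n) * ι (Q ℕ.* B ℕ.^ n)            ≡⟨ ι-* (Q ℕ.* B ℕ.^ n) (Q ℕ.* B ℕ.^ n) ⟨
      ι (Q ℕ.* B ℕ.^ n ℕ.* (Q ℕ.* B ℕ.^ n))
           ≡⟨ cong ι (trans (ℕS.solve 2 (λ q x → q ℕS.:* x ℕS.:* (q ℕS.:* x) ℕS.:= q ℕS.:* q ℕS.:* (x ℕS.:* x)) refl Q (B ℕ.^ n))
                                                            (cong (Q ℕ.* Q ℕ.*_) (sym (^-distribʳ-* B n)))) ⟩
      ι (Q ℕ.* Q ℕ.* (B ℕ.* B) ℕ.^ n)                  ∎)
      where
      open ℚₚ.≤-Reasoning
      n = 2 ℕ.^ j
      P = p SE.^ n

  -- Growth of powers under a monic equation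

  evalS : Series → List Series → Series
  evalS y []       = 0S
  evalS y (c ∷ cs) = c ⊕ (y ⊛ evalS y cs)

  data NormSum : List Series → ℕ → Set where
    []  : NormSum [] 0
    _∷_ : ∀ {c cs L Λ} → ∥ c ∥₁≤ L → NormSum cs Λ → NormSum (c ∷ cs) (L ℕ.+ Λ)

  -- p^n · `evalS p cs` is the sum of the c_i p^(n+i), and Λ adds up the bounds for the c_i.
  ∥eval∥ : ∀ {cs Λ W} p n → NormSum cs Λ → (∀ i → i ℕ.< length cs → ∥ p SE.^ (n ℕ.+ i) ∥₁≤ W) →
           ∥ (p SE.^ n) ⊛ evalS p cs ∥₁≤ Λ ℕ.* W
  ∥eval∥ p n [] b = ∥∥-cong (S.sym (S.zeroʳ (p SE.^ n))) ∥0S∥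
  ∥eval∥ {c ∷ cs} {_} {W} p n (_∷_ {L = L} {Λ} l ls) b = ∥∥-weaken (ℕₚ.≤-reflexive (sym (ℕₚ.*-distribʳ-+ W L Λ)))
    (∥∥-cong (S.sym (SS.solve 4 (λ x c p e → x SS.:* (c SS.:+ p SS.:* e) SS.:= c SS.:* x SS.:+ (p SS.:* x) SS.:* e) S.refl
                                (p SE.^ n) c p (evalS p cs)))
      (∥∥-⊕ (∥∥-⊛ l (∥∥-cong (SE.^-congʳ p (ℕₚ.+-identityʳ n)) (b 0 (s≤s z≤n))))
            (∥eval∥ p (suc n) ls (λ i i< → ∥∥-cong (SE.^-congʳ p (ℕₚ.+-suc n i)) (b (suc i) (s≤s i<))))))

  -- Multiplied by p^n, the relation expresses p^(n+d) through E · p^n and the d powers before it,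
  -- so its norm is at most 1 + Λ times a common bound for these. The induction on n therefore
  -- carries a bound for all exponents from n to n + d - 1.
  power-growth : ∀ {c cs Λ E Q} p → NormSum (c ∷ cs) Λ → ∥ E ∥₁≤ 1 → ∥ p ∥₁≤ suc Q →
                 ((p SE.^ length (c ∷ cs)) ⊕ evalS p (c ∷ cs)) ≗ E →
                 ∀ n → ∥ p SE.^ n ∥₁≤ suc Q ℕ.^ length (c ∷ cs) ℕ.* suc Λ ℕ.^ n
  power-growth {c} {cs} {Λ} {E} {Q} p ns e q rel n =
    ∥∥-cong (SE.^-congʳ p (ℕₚ.+-identityʳ n)) (go n 0 (s≤s z≤n))
    where
    d = length (c ∷ cs)
    go : ∀ n i → i ℕ.< d → ∥ p SE.^ (n ℕ.+ i) ∥₁≤ suc Q ℕ.^ d ℕ.* suc Λ ℕ.^ n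
    -- Since Q + 1 ≥ 1, (Q+1)^d dominates the bounds for all powers below d.
    go zero    i i<d = ∥∥-weaken (ℕₚ.≤-trans (ℕₚ.^-monoʳ-≤ (suc Q) (ℕₚ.<⇒≤ i<d))
        (ℕₚ.≤-reflexive (sym (ℕₚ.*-identityʳ _)))) (∥∥-^ i q)
    go (suc n) i i<d with suc i ℕₚ.<? d
    ... | yes i+1<d = ∥∥-cong (SE.^-congʳ p (ℕₚ.+-suc n i))
      (∥∥-weaken (ℕₚ.*-monoʳ-≤ (suc Q ℕ.^ d) (ℕₚ.m≤n*m (suc Λ ℕ.^ n) (suc Λ))) (go n (suc i) i+1<d))
    -- Here i = d - 1: p^(n+d) is the only exponent that the window gains.
    ... | no  i+1≮d = ∥∥-cong (SE.^-congʳ p n+d≡) (∥∥-weaken (ℕₚ.≤-reflexive W≡)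
      (∥∥-difference relₙ (∥eval∥ p n ns (go n)) (∥∥-⊛ e pn)))
      where
      n+d≡ : n ℕ.+ d ≡ suc n ℕ.+ i
      n+d≡ = trans (cong (n ℕ.+_) (ℕₚ.≤-antisym (ℕₚ.≮⇒≥ i+1≮d) i<d)) (ℕₚ.+-suc n i)
      W = suc Q ℕ.^ d ℕ.* suc Λ ℕ.^ n
      pn : ∥ p SE.^ n ∥₁≤ W
      pn = ∥∥-cong (SE.^-congʳ p (ℕₚ.+-identityʳ n)) (go n 0 (s≤s z≤n))
      W≡ : 1 ℕ.* W ℕ.+ Λ ℕ.* W ≡ suc Q ℕ.^ d ℕ.* suc Λ ℕ.^ suc n
      W≡ = ℕS.solve 3 (λ x y l → ℕS.con 1 ℕS.:* (x ℕS.:* y) ℕS.:+ l ℕS.:* (x ℕS.:* y) ℕS.:= x ℕS.:* ((ℕS.con 1 ℕS.:+ l) ℕS.:* y))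
             refl (suc Q ℕ.^ d) (suc Λ ℕ.^ n) Λ
      relₙ : ((p SE.^ (n ℕ.+ d)) ⊕ ((p SE.^ n) ⊛ evalS p (c ∷ cs))) ≗ (E ⊛ (p SE.^ n))
      relₙ = S.trans (S.+-cong (SE.^-homo-* p n d) S.refl)
        (S.trans (S.sym (S.distribˡ (p SE.^ n) (p SE.^ d) (evalS p (c ∷ cs))))
          (S.trans (S.*-congˡ {p SE.^ n} rel) (S.*-comm (p SE.^ n) E)))

  -- Rescaling, truncation and polynomial growth

  scale : ℚ → Series → Series
  scale r f n = (r QE.^ n) * f n

  scale-⊕ : ∀ r f g → scale r (f ⊕ g) ≗ (scale r f ⊕ scale r g)
  scale-⊕ r f g n = ℚₚ.*-distribˡ-+ (r QE.^ n) (f n) (g n)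

  -- `scale r` is the substitution X ↦ rX, a ring homomorphism, so an equation passes to the
  -- rescaled series with rescaled coefficients.
  scale-⊛ : ∀ r f g → scale r (f ⊛ g) ≗ (scale r f ⊛ scale r g)
  scale-⊛ r f g zero = solve 2 (λ x y → con 1ℚ :* (x :* y :+ con 0ℚ) := (con 1ℚ :* x) :* (con 1ℚ :* y) :+ con 0ℚ) refl (f 0) (g 0)
  scale-⊛ r f g (suc n) = begin
    (r * x) * (f 0 * g (suc n) + (tail f ⊛ g) n)
      ≡⟨ solve 5 (λ r x a b c → (r :* x) :* (a :* b :+ c) := (con 1ℚ :* a) :* ((r :* x) :* b) :+ r :* (x :* c)) refl
           r x (f 0) (g (suc n)) ((tail f ⊛ g) n) ⟩
    (1ℚ * f 0) * ((r * x) * g (suc n)) + r * scale r (tail f ⊛ g) n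
      ≡⟨ cong (λ y → (1ℚ * f 0) * ((r * x) * g (suc n)) + r * y) (scale-⊛ r (tail f) g n) ⟩
    (1ℚ * f 0) * ((r * x) * g (suc n)) + r * (scale r (tail f) ⊛ scale r g) n
      ≡⟨ cong ((1ℚ * f 0) * ((r * x) * g (suc n)) +_)
           (trans (sym (•-⊛ r (scale r (tail f)) (scale r g) n))
                  (⊛-cong {r • scale r (tail f)} {tail (scale r f)} {scale r g} {scale r g}
                      (λ k → sym (ℚₚ.*-assoc r _ _)) (λ _ → refl) n)) ⟩
    (1ℚ * f 0) * ((r * x) * g (suc n)) + (tail (scale r f) ⊛ scale r g) n ∎
    where
    open ≡-Reasoning
    x = r QE.^ n

  scale-0S : ∀ r → scale r 0S ≗ 0S
  scale-0S r n = ℚₚ.*-zeroʳ (r QE.^ n)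

  scale-1S : ∀ r → scale r 1S ≗ 1S
  scale-1S r zero    = refl
  scale-1S r (suc n) = ℚₚ.*-zeroʳ (r QE.^ suc n)

  scale-^ : ∀ r f n → scale r (f SE.^ n) ≗ (scale r f SE.^ n)
  scale-^ r f zero    = scale-1S r
  scale-^ r f (suc n) = S.trans (scale-⊛ r f (f SE.^ n)) (S.*-congˡ {scale r f} (scale-^ r f n))

  scale-eval : ∀ r y cs → scale r (evalS y cs) ≗ evalS (scale r y) (map (scale r) cs)
  scale-eval r y []       = scale-0S r
  scale-eval r y (c ∷ cs) = S.trans (scale-⊕ r c (y ⊛ evalS y cs))
    (S.+-congˡ {scale r c} (S.trans (scale-⊛ r y (evalS y cs)) (S.*-congˡ {scale r y} (scale-eval r y cs))))

  ^-nonNeg : ∀ {r} n → 0ℚ ≤ r → 0ℚ ≤ r QE.^ n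
  ^-nonNeg zero    0≤r = subst (0ℚ ≤_) fromℤ-1 (0≤ι 1)
  ^-nonNeg (suc n) 0≤r = 0≤* 0≤r (^-nonNeg n 0≤r)

  ^-≤1 : ∀ {r} n → 0ℚ ≤ r → r ≤ 1ℚ → r QE.^ n ≤ 1ℚ
  ^-≤1 zero    0≤r r≤1 = ℚₚ.≤-refl
  ^-≤1 {r} (suc n) 0≤r r≤1 = subst (r * (r QE.^ n) ≤_) (ℚₚ.*-identityˡ 1ℚ) (*-mono-≤ 0≤r r≤1 (^-nonNeg n 0≤r) (^-≤1 n 0≤r r≤1))

  ^-antitone : ∀ {r m n} → 0ℚ ≤ r → r ≤ 1ℚ → m ℕ.≤ n → r QE.^ n ≤ r QE.^ m
  ^-antitone {n = n} 0≤r r≤1 z≤n       = ^-≤1 n 0≤r r≤1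
  ^-antitone         0≤r r≤1 (s≤s m≤n) = *-monoˡ 0≤r (^-antitone 0≤r r≤1 m≤n)

  -- As r ≤ 1, divisibility of f by X^N gains a factor r^N. For N = 0 this says only that rescaling
  -- does not increase the norm.
  ∥scale∥ : ∀ {r f B C} N → 0ℚ ≤ r → r ≤ 1ℚ → (∀ k → k ℕ.< N → f k ≡ 0ℚ) → (r QE.^ N) * ι B ≤ ι C →
            ∥ f ∥₁≤ B → ∥ scale r f ∥₁≤ C
  ∥scale∥ {r} {f} {B} {C} N 0≤r r≤1 low le b = bounded λ K → begin
    Σ∣ scale r f ∣< K                          ≤⟨ Σ<-mono K (λ k _ → term k) ⟩
    Σ< K (λ k → (r QE.^ N) * ∣ f k ∣)          ≡⟨ Σ<-distrib-* K (r QE.^ N) (λ k → ∣ f k ∣) ⟩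
    (r QE.^ N) * Σ∣ f ∣< K                     ≤⟨ *-monoˡ (^-nonNeg N 0≤r) (partial b K) ⟩
    (r QE.^ N) * ι B                           ≤⟨ le ⟩
    ι C                                        ∎
    where
    open ℚₚ.≤-Reasoning
    term : ∀ k → ∣ scale r f k ∣ ≤ (r QE.^ N) * ∣ f k ∣
    term k with k ℕₚ.<? N
    ... | yes k<N rewrite low k k<N | ℚₚ.*-zeroʳ (r QE.^ k) | ℚₚ.*-zeroʳ (r QE.^ N) = ℚₚ.≤-refl
    ... | no k≮N = begin
      ∣ (r QE.^ k) * f k ∣       ≡⟨ ℚₚ.∣p*q∣≡∣p∣*∣q∣ (r QE.^ k) (f k) ⟩
      ∣ r QE.^ k ∣ * ∣ f k ∣     ≡⟨ cong (_* ∣ f k ∣) (ℚₚ.0≤p⇒∣p∣≡p (^-nonNeg k 0≤r)) ⟩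
      (r QE.^ k) * ∣ f k ∣       ≤⟨ *-mono-≤ (^-nonNeg k 0≤r) (^-antitone 0≤r r≤1 (ℕₚ.≮⇒≥ k≮N)) (ℚₚ.0≤∣p∣ (f k)) ℚₚ.≤-refl ⟩
      (r QE.^ N) * ∣ f k ∣       ∎

  scale-NormSum : ∀ {r cs Λ} → 0ℚ ≤ r → r ≤ 1ℚ → NormSum cs Λ → NormSum (map (scale r) cs) Λ
  scale-NormSum 0≤r r≤1 [] = []
  scale-NormSum 0≤r r≤1 (_∷_ {L = L} l ls) =
    ∥scale∥ 0 0≤r r≤1 (λ _ ()) (ℚₚ.≤-reflexive (ℚₚ.*-identityˡ (ι L))) l ∷ scale-NormSum 0≤r r≤1 ls

  polynomials-NormSum : ∀ {cs} → All IsPolynomial cs → ∃ (NormSum cs)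
  polynomials-NormSum []       = 0 , []
  polynomials-NormSum (p ∷ ps) = _ , proj₂ (polynomial-∥∥ p) ∷ proj₂ (polynomials-NormSum ps)

  trunc : ℕ → Series → Series
  trunc zero    f k       = 0ℚ
  trunc (suc N) f zero    = f 0
  trunc (suc N) f (suc k) = trunc N (tail f) k

  trunc-below : ∀ N f k → k ℕ.< N → trunc N f k ≡ f k
  trunc-below (suc N) f zero    k<N       = refl
  trunc-below (suc N) f (suc k) (s≤s k<N) = trunc-below N (tail f) k k<N

  trunc-above : ∀ N f k → N ℕ.≤ k → trunc N f k ≡ 0ℚ
  trunc-above zero    f k       N≤k       = refl
  trunc-above (suc N) f (suc k) (s≤s N≤k) = trunc-above N (tail f) k N≤k

  infix 4 _≡_mod-X^_
  _≡_mod-X^_ : Series → Series → ℕ → Set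
  f ≡ g mod-X^ N = ∀ k → k ℕ.< N → f k ≡ g k

  mod-⊛ : ∀ {f f′ g g′ N} → f ≡ f′ mod-X^ N → g ≡ g′ mod-X^ N → (f ⊛ g) ≡ (f′ ⊛ g′) mod-X^ N
  mod-⊛ {f} {f′} {g} {g′} p q k k<N = ⊛-cong-below k {f} {f′} {g} {g′}
    (λ j j≤k → p j (ℕₚ.≤-<-trans j≤k k<N)) (λ j j≤k → q j (ℕₚ.≤-<-trans j≤k k<N))

  mod-^ : ∀ {f f′ N} n → f ≡ f′ mod-X^ N → (f SE.^ n) ≡ (f′ SE.^ n) mod-X^ N
  mod-^ zero    p = λ _ _ → refl
  mod-^ {f} {f′} (suc n) p = mod-⊛ {f} {f′} {f SE.^ n} {f′ SE.^ n} p (mod-^ n p)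

  mod-eval : ∀ {f f′ N} cs → f ≡ f′ mod-X^ N → evalS f cs ≡ evalS f′ cs mod-X^ N
  mod-eval []       p k k<N = refl
  mod-eval {f} {f′} (c ∷ cs) p k k<N = cong (c k +_) (mod-⊛ {f} {f′} {evalS f cs} {evalS f′ cs} p (mod-eval cs p) k k<N)

  -- Norms growing at most like a polynomial in the truncation degree N. Sums and products preserve
  -- this, so it passes from the truncations of g to the errors in their equation.
  PolyNorm : (ℕ → Series) → Set
  PolyNorm e = ∃₂ λ A D → ∀ N → ∥ e N ∥₁≤ A ℕ.* suc N ℕ.^ D

  PolyNorm-constant : ∀ {f B} → ∥ f ∥₁≤ B → PolyNorm (λ _ → f)
  PolyNorm-constant {B = B} b = B , 0 , λ N → ∥∥-weaken (ℕₚ.≤-reflexive (sym (ℕₚ.*-identityʳ B))) b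

  PolyNorm-⊕ : ∀ {e e′} → PolyNorm e → PolyNorm e′ → PolyNorm (λ N → e N ⊕ e′ N)
  PolyNorm-⊕ (A , D , b) (A′ , D′ , b′) = A ℕ.+ A′ , D ℕ.+ D′ , λ N → ∥∥-weaken
    (ℕₚ.≤-trans (ℕₚ.+-mono-≤ (ℕₚ.*-monoʳ-≤ A (ℕₚ.^-monoʳ-≤ (suc N) (ℕₚ.m≤m+n D D′)))
                             (ℕₚ.*-monoʳ-≤ A′ (ℕₚ.^-monoʳ-≤ (suc N) (ℕₚ.m≤n+m D′ D))))
                (ℕₚ.≤-reflexive (sym (ℕₚ.*-distribʳ-+ (suc N ℕ.^ (D ℕ.+ D′)) A A′))))
    (∥∥-⊕ (b N) (b′ N))

  PolyNorm-⊛ : ∀ {e e′} → PolyNorm e → PolyNorm e′ → PolyNorm (λ N → e N ⊛ e′ N)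
  PolyNorm-⊛ (A , D , b) (A′ , D′ , b′) = A ℕ.* A′ , D ℕ.+ D′ , λ N → ∥∥-weaken
    (ℕₚ.≤-reflexive (trans
      (ℕS.solve 4 (λ a x c y → a ℕS.:* x ℕS.:* (c ℕS.:* y) ℕS.:= a ℕS.:* c ℕS.:* (x ℕS.:* y)) refl A (suc N ℕ.^ D) A′
          (suc N ℕ.^ D′))
      (cong (A ℕ.* A′ ℕ.*_) (sym (ℕₚ.^-distribˡ-+-* (suc N) D D′)))))
    (∥∥-⊛ (b N) (b′ N))

  PolyNorm-^ : ∀ {e} n → PolyNorm e → PolyNorm (λ N → e N SE.^ n)
  PolyNorm-^ zero    b = PolyNorm-constant ∥1S∥
  PolyNorm-^ {e} (suc n) b = PolyNorm-⊛ {e} b (PolyNorm-^ n b)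

  PolyNorm-eval : ∀ {e cs Λ} → NormSum cs Λ → PolyNorm e → PolyNorm (λ N → evalS (e N) cs)
  PolyNorm-eval []       b = PolyNorm-constant ∥0S∥
  PolyNorm-eval {e} {c ∷ cs} (l ∷ ls) b =
    PolyNorm-⊕ {λ _ → c} {λ N → e N ⊛ evalS (e N) cs} (PolyNorm-constant l) (PolyNorm-⊛ {e} b (PolyNorm-eval ls b))

  ι-positive : ∀ n → ℚ.Positive (ι (suc n))
  ι-positive n = ℚ.positive (ℚₚ.<-≤-trans (ℚₚ.positive⁻¹ 1ℚ) (subst (_≤ ι (suc n)) fromℤ-1 (ι-mono-≤ (s≤s (z≤n {n})))))

  ι-cancelˡ : ∀ n {x y} → ι (suc n) * x ≤ ι (suc n) * y → x ≤ y
  ι-cancelˡ n = ℚₚ.*-cancelˡ-≤-pos (ι (suc n)) {{ι-positive n}}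

  ι-^ : ∀ m n → ι (m ℕ.^ n) ≡ ι m QE.^ n
  ι-^ m zero    = fromℤ-1
  ι-^ m (suc n) = trans (ι-* m (m ℕ.^ n)) (cong (ι m *_) (ι-^ m n))

  -- s = 1 - 1/(m+1), specified without division.
  record Radius (m : ℕ) : Set where
    field
      s       : ℚ
      defines : ι (suc m) * s ≡ ι m

    0≤s : 0ℚ ≤ s
    0≤s = ι-cancelˡ m (subst₂ _≤_ (sym (ℚₚ.*-zeroʳ (ι (suc m)))) (sym defines) (0≤ι m))

    s≤1 : s ≤ 1ℚ
    s≤1 = ι-cancelˡ m (subst₂ _≤_ (sym defines) (sym (ℚₚ.*-identityʳ (ι (suc m)))) (ι-mono-≤ (ℕₚ.n≤1+n m)))

    -- s^N ≤ (m+1)/(N+m+1), a form of Bernoulli's inequality. This decay is only of order 1/N, hence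
    -- the power D + 1 in `vanishing`.
    decay : ∀ N → ι (N ℕ.+ suc m) * (s QE.^ N) ≤ ι (suc m)
    decay zero    = ℚₚ.≤-reflexive (ℚₚ.*-identityʳ (ι (suc m)))
    decay (suc N) = ℚₚ.≤-trans (ι-cancelˡ m (begin
      ι (suc m) * (ι (suc N ℕ.+ suc m) * (s * x))
           ≡⟨ solve 4 (λ a b s x → a :* (b :* (s :* x)) := (b :* (a :* s)) :* x) refl (ι (suc m)) (ι (suc N ℕ.+ suc m)) s x ⟩
      (ι (suc N ℕ.+ suc m) * (ι (suc m) * s)) * x    ≡⟨ cong (λ y → (ι (suc N ℕ.+ suc m) * y) * x) defines ⟩
      (ι (suc N ℕ.+ suc m) * ι m) * x                ≡⟨ cong (_* x) (ι-* (suc N ℕ.+ suc m) m) ⟨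
      ι ((suc N ℕ.+ suc m) ℕ.* m) * x                ≤⟨ *-mono-≤ (0≤ι _) (ι-mono-≤ nat) (^-nonNeg N 0≤s) ℚₚ.≤-refl ⟩
      ι (suc m ℕ.* (N ℕ.+ suc m)) * x
           ≡⟨ trans (cong (_* x) (ι-* (suc m) (N ℕ.+ suc m))) (ℚₚ.*-assoc (ι (suc m)) _ x) ⟩
      ι (suc m) * (ι (N ℕ.+ suc m) * x)              ∎)) (decay N)
      where
      open ℚₚ.≤-Reasoning
      x = s QE.^ N
      nat : (suc N ℕ.+ suc m) ℕ.* m ℕ.≤ suc m ℕ.* (N ℕ.+ suc m)
      nat = ℕₚ.+-mono-≤ (ℕₚ.≤-trans (ℕₚ.n≤1+n m) (ℕₚ.m≤n+m (suc m) N)) (ℕₚ.≤-reflexive (ℕₚ.*-comm (N ℕ.+ suc m) m))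

    decay′ : ∀ N → ι (suc N) * (s QE.^ N) ≤ ι (suc m)
    decay′ N = ℚₚ.≤-trans (*-mono-≤ (0≤ι _)
        (ι-mono-≤ (ℕₚ.≤-trans (ℕₚ.m≤m+n (suc N) m) (ℕₚ.≤-reflexive (sym (ℕₚ.+-suc N m))))) (^-nonNeg N 0≤s) ℚₚ.≤-refl) (decay N)

    -- s^M ≥ 1 - M/(m+1), Bernoulli's inequality cleared of its denominator.
    lower : ∀ M → ι (suc m) ≤ ι (suc m) * (s QE.^ M) + ι M
    lower zero    = ℚₚ.≤-reflexive (sym (trans (cong₂ _+_ (ℚₚ.*-identityʳ (ι (suc m))) fromℤ-0) (ℚₚ.+-identityʳ (ι (suc m)))))
    lower (suc M) = ℚₚ.≤-trans (lower M) (begin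
      ι (suc m) * x + ι M                    ≡⟨ cong (λ y → y * x + ι M) (trans (ι-+ 1 m) (cong (_+ ι m) fromℤ-1)) ⟩
      (1ℚ + ι m) * x + ι M
           ≡⟨ solve 3 (λ a x b → (con 1ℚ :+ a) :* x :+ b := (a :* x :+ b) :+ x) refl (ι m) x (ι M) ⟩
      (ι m * x + ι M) + x                    ≤⟨ ℚₚ.+-monoʳ-≤ (ι m * x + ι M) (^-≤1 M 0≤s s≤1) ⟩
      (ι m * x + ι M) + 1ℚ                   ≡⟨ cong (λ y → y * x + ι M + 1ℚ) defines ⟨
      (ι (suc m) * s * x + ι M) + 1ℚ
           ≡⟨ solve 4 (λ a s x b → a :* s :* x :+ b :+ con 1ℚ := a :* (s :* x) :+ (con 1ℚ :+ b)) refl (ι (suc m)) s x (ι M) ⟩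
      ι (suc m) * (s * x) + (1ℚ + ι M)       ≡⟨ cong (λ y → ι (suc m) * (s * x) + y) (trans (ι-+ 1 M) (cong (_+ ι M) fromℤ-1)) ⟨
      ι (suc m) * (s * x) + ι (suc M)        ∎)
      where
      open ℚₚ.≤-Reasoning
      x = s QE.^ M

    half : ∀ M → 2 ℕ.* M ℕ.≤ suc m → 1ℚ ≤ ι 2 * (s QE.^ M)
    half M 2M≤ = ι-cancelˡ m (begin
      ι (suc m) * 1ℚ                                         ≡⟨ solve 1 (λ a → a :* con 1ℚ := a :+ a :- a) refl a ⟩
      (a + a) ℚ.- a                                          ≤⟨ ℚₚ.+-monoˡ-≤ (- a) (ℚₚ.+-mono-≤ (lower M) (lower M)) ⟩
      ((a * x + ι M) + (a * x + ι M)) ℚ.- a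
           ≡⟨ solve 3 (λ a x b → ((a :* x :+ b) :+ (a :* x :+ b)) :- a := a :* ((con 1ℚ :+ con 1ℚ) :* x) :+
               ((b :+ b) :- a)) refl a x (ι M) ⟩
      a * ((1ℚ + 1ℚ) * x) + ((ι M + ι M) ℚ.- a)              ≤⟨ ℚₚ.+-monoʳ-≤ (a * ((1ℚ + 1ℚ) * x)) (ℚₚ.+-monoˡ-≤ (- a) 2ιM≤a) ⟩
      a * ((1ℚ + 1ℚ) * x) + (a ℚ.- a)
           ≡⟨ trans (cong (a * ((1ℚ + 1ℚ) * x) +_) (ℚₚ.+-inverseʳ a)) (ℚₚ.+-identityʳ _) ⟩
      a * ((1ℚ + 1ℚ) * x)
           ≡⟨ cong (λ y → a * (y * x)) (trans (ι-+ 1 1) (cong₂ _+_ fromℤ-1 fromℤ-1)) ⟨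
      a * (ι 2 * x)                                          ∎)
      where
      open ℚₚ.≤-Reasoning
      x = s QE.^ M
      a = ι (suc m)
      2ιM≤a : ι M + ι M ≤ a
      2ιM≤a = subst (_≤ a) (trans (cong (λ y → ι (M ℕ.+ y)) (ℕₚ.+-identityʳ M)) (ι-+ M M)) (ι-mono-≤ 2M≤)

    -- The (D+1)-th power of (N+1) s^N ≤ m+1 absorbs (N+1)^D and leaves one factor N+1 over, which
    -- exceeds A (m+1)^(D+1).
    vanishing : ∀ A D N → A ℕ.* suc m ℕ.^ suc D ℕ.≤ N → ((s QE.^ suc D) QE.^ N) * ι (A ℕ.* suc N ℕ.^ D) ≤ ι 1
    vanishing A D N le = ι-cancelˡ N (begin
      ι (suc N) * (((s QE.^ suc D) QE.^ N) * ι (A ℕ.* suc N ℕ.^ D))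
        ≡⟨ cong₂ (λ y z → ι (suc N) * (y * z)) swap (trans (ι-* A (suc N ℕ.^ D)) (cong (ι A *_) (ι-^ (suc N) D))) ⟩
      ι (suc N) * ((x QE.^ suc D) * (ι A * (ι (suc N) QE.^ D)))
        ≡⟨ solve 4 (λ n y a z → n :* (y :* (a :* z)) := a :* ((n :* z) :* y)) refl (ι (suc N)) (x QE.^ suc D) (ι A)
            (ι (suc N) QE.^ D) ⟩
      ι A * ((ι (suc N) QE.^ suc D) * (x QE.^ suc D))        ≡⟨ cong (ι A *_) (QE.^-distrib-* (ι (suc N)) x (suc D)) ⟨
      ι A * ((ι (suc N) * x) QE.^ suc D)
           ≤⟨ *-monoˡ (0≤ι A) (^-mono (suc D) (0≤* (0≤ι (suc N)) (^-nonNeg N 0≤s)) (decay′ N)) ⟩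
      ι A * (ι (suc m) QE.^ suc D)
           ≡⟨ trans (ι-* A (suc m ℕ.^ suc D)) (cong (ι A *_) (ι-^ (suc m) (suc D))) ⟨
      ι (A ℕ.* suc m ℕ.^ suc D)                              ≤⟨ ι-mono-≤ (ℕₚ.m≤n⇒m≤1+n le) ⟩
      ι (suc N)                                              ≡⟨ trans (cong (ι (suc N) *_) fromℤ-1) (ℚₚ.*-identityʳ (ι (suc N))) ⟨
      ι (suc N) * ι 1                                        ∎)
      where
      open ℚₚ.≤-Reasoning
      x = s QE.^ N
      swap : (s QE.^ suc D) QE.^ N ≡ x QE.^ suc D
      swap = trans (QE.^-assocʳ s (suc D) N) (trans (QE.^-congʳ s (ℕₚ.*-comm (suc D) N)) (sym (QE.^-assocʳ s N (suc D))))
      ^-mono : ∀ {a b} n → 0ℚ ≤ a → a ≤ b → a QE.^ n ≤ b QE.^ n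
      ^-mono zero    0≤a a≤b = ℚₚ.≤-refl
      ^-mono (suc n) 0≤a a≤b = *-mono-≤ 0≤a a≤b (^-nonNeg n 0≤a) (^-mono n 0≤a a≤b)

  radius : ∀ m → Radius m
  radius m = record { s = r * ι m ; defines = trans (sym (ℚₚ.*-assoc a r (ι m)))
      (trans (cong (_* ι m) (ℚₚ.*-inverseʳ a)) (ℚₚ.*-identityˡ (ι m))) }
    where
    a = ι (suc m)
    instance
      a≢0 : ℚ.NonZero a
      a≢0 = ℚₚ.pos⇒nonZero a {{ι-positive m}}
    r = ℚ.1/ a

  -- p is g truncated at degree N and rescaled by X ↦ rX.  A radius r close to 1 keeps half of each of
  -- the first K squares; N large makes the error E of the monic equation for p small.
  integral⇒Σ□-bounded : ∀ {g c cs} → All IsPolynomial (c ∷ cs) → ((g SE.^ length (c ∷ cs)) ⊕ evalS g (c ∷ cs)) ≗ 0S →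
                        PolyNorm (λ N → trunc N g) → ∃ λ C → ∀ K → ¬ (ι C ≤ Σ□ g < K)
  -- B comes from the coefficients of the equation alone, so the bound is the same for every K. The
  -- factor 2 pays for the half of each square that the rescaling may lose.
  integral⇒Σ□-bounded {g} {c} {cs} polys rel growth = 2 ℕ.* suc (B ℕ.* B) , λ K le → contra K le
    where
    bs = c ∷ cs
    d = length bs
    Λ = proj₁ (polynomials-NormSum polys)
    ns : NormSum bs Λ
    ns = proj₂ (polynomials-NormSum polys)
    B = suc Λ
    E₀ : ℕ → Series
    E₀ N = (trunc N g SE.^ d) ⊕ evalS (trunc N g) bs
    E₀-growth : PolyNorm E₀
    E₀-growth = PolyNorm-⊕ {λ N → trunc N g SE.^ d} {λ N → evalS (trunc N g) bs} (PolyNorm-^ d growth) (PolyNorm-eval ns growth)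
    A = proj₁ E₀-growth
    D = proj₁ (proj₂ E₀-growth)
    contra : ∀ K → ¬ (ι (2 ℕ.* suc (B ℕ.* B)) ≤ Σ□ g < K)
    contra K le = ℓ²-bound {p} {N} {suc Q ℕ.^ length (map (scale r) bs)} {B} deg (s≤s z≤n)
        (power-growth p (scale-NormSum 0≤r r≤1 ns) e q rel′) big
      where
      -- Makes r^(2k) = s^((D+1)·2k) at least 1/2 for k < K, by `half`.
      m = 2 ℕ.* (suc D ℕ.* (K ℕ.+ K))
      open Radius (radius m)
      r = s QE.^ suc D
      0≤r : 0ℚ ≤ r
      0≤r = ^-nonNeg (suc D) 0≤s
      r≤1 : r ≤ 1ℚ
      r≤1 = ^-≤1 (suc D) 0≤s s≤1
      -- The summand K keeps the first K coefficients from being cut off; the other is the size that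
      -- `vanishing` asks for.
      N = K ℕ.+ A ℕ.* suc m ℕ.^ suc D
      p E : Series
      p = scale r (trunc N g)
      E = scale r (E₀ N)
      deg : Degree≤ N p
      deg k N<k = trans (cong ((r QE.^ k) *_) (trunc-above N g k (ℕₚ.<⇒≤ N<k))) (ℚₚ.*-zeroʳ (r QE.^ k))
      -- The truncation agrees with g modulo X^N, and so do the two sides of the equation.
      low : ∀ k → k ℕ.< N → E₀ N k ≡ 0ℚ
      low k k<N = trans (cong₂ _+_ (mod-^ {trunc N g} {g} d (trunc-below N g) k k<N)
          (mod-eval {trunc N g} {g} bs (trunc-below N g) k k<N)) (rel k)
      e : ∥ E ∥₁≤ 1
      e = ∥scale∥ N 0≤r r≤1 low (vanishing A D N (ℕₚ.m≤n+m _ K)) (proj₂ (proj₂ E₀-growth) N)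
      -- Q depends on N, but it enters only the constant factor of the growth, to which the
      -- conclusion of `ℓ²-bound` is insensitive.
      Q = proj₁ growth ℕ.* suc N ℕ.^ proj₁ (proj₂ growth)
      q : ∥ p ∥₁≤ suc Q
      q = ∥scale∥ 0 0≤r r≤1 (λ _ ()) (ℚₚ.≤-reflexive (ℚₚ.*-identityˡ (ι (suc Q))))
          (∥∥-weaken (ℕₚ.n≤1+n Q) (proj₂ (proj₂ growth) N))
      rel′ : ((p SE.^ length (map (scale r) bs)) ⊕ evalS p (map (scale r) bs)) ≗ E
      rel′ = S.sym (S.trans (scale-⊕ r (trunc N g SE.^ d) (evalS (trunc N g) bs))
        (S.+-cong (S.trans (scale-^ r (trunc N g) d) (SE.^-congʳ p (sym (length-map (scale r) bs))))
            (scale-eval r (trunc N g) bs)))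
      term : ∀ k → k ℕ.< K → g k * g k ≤ ι 2 * (p k * p k)
      term k k<K = begin
        g k * g k                                  ≡⟨ ℚₚ.*-identityˡ _ ⟨
        1ℚ * (g k * g k)
             ≤⟨ *-mono-≤ (subst (0ℚ ≤_) fromℤ-1 (0≤ι 1)) (half (suc D ℕ.* (k ℕ.+ k)) bound) (0≤square (g k)) ℚₚ.≤-refl ⟩
        ι 2 * (s QE.^ (suc D ℕ.* (k ℕ.+ k))) * (g k * g k)
          ≡⟨ cong (λ y → ι 2 * y * (g k * g k)) (trans (sym (QE.^-assocʳ s (suc D) (k ℕ.+ k))) (QE.^-homo-* r k k)) ⟩
        ι 2 * (x * x) * (g k * g k)
             ≡⟨ solve 3 (λ t x y → t :* (x :* x) :* (y :* y) := t :* ((x :* y) :* (x :* y))) refl (ι 2) x (g k) ⟩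
        ι 2 * ((x * g k) * (x * g k))
             ≡⟨ cong (λ y → ι 2 * ((x * y) * (x * y))) (trunc-below N g k (ℕₚ.<-≤-trans k<K (ℕₚ.m≤m+n K _))) ⟨
        ι 2 * (p k * p k)                          ∎
        where
        open ℚₚ.≤-Reasoning
        x = r QE.^ k
        bound : 2 ℕ.* (suc D ℕ.* (k ℕ.+ k)) ℕ.≤ suc m
        bound = ℕₚ.m≤n⇒m≤1+n (ℕₚ.*-monoʳ-≤ 2 (ℕₚ.*-monoʳ-≤ (suc D) (ℕₚ.+-mono-≤ (ℕₚ.<⇒≤ k<K) (ℕₚ.<⇒≤ k<K))))
      big : ι (suc (B ℕ.* B)) ≤ Σ□ p < (suc N)
      big = ι-cancelˡ 1 (begin
        ι 2 * ι (suc (B ℕ.* B))          ≡⟨ ι-* 2 (suc (B ℕ.* B)) ⟨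
        ι (2 ℕ.* suc (B ℕ.* B))          ≤⟨ le ⟩
        Σ□ g < K                         ≤⟨ Σ<-mono K term ⟩
        Σ< K (λ k → ι 2 * (p k * p k))   ≡⟨ Σ<-distrib-* K (ι 2) (λ k → p k * p k) ⟩
        ι 2 * Σ□ p < K                   ≤⟨ *-monoˡ (0≤ι 2) (Σ<-monoˡ (λ k → 0≤square (p k)) (ℕₚ.m≤n⇒m≤1+n (ℕₚ.m≤m+n K _))) ⟩
        ι 2 * Σ□ p < (suc N)             ∎)
        where open ℚₚ.≤-Reasoning

  -- From algebraicity over ℚ(X) to an equation over ℚ[X]

  polynomial-⊛ : ∀ {f g} → IsPolynomial f → IsPolynomial g → IsPolynomial (f ⊛ g)
  polynomial-⊛ {f} {g} (d , z) (d′ , z′) = suc (d ℕ.+ d′) , Degree≤-⊛ d {d′} {f} {g} (λ k d<k → z k (ℕₚ.<⇒≤ d<k))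
      (λ k d<k → z′ k (ℕₚ.<⇒≤ d<k))

  polynomial-const : ∀ c → IsPolynomial (const c)
  polynomial-const c = 1 , λ { (suc n) _ → refl }

  polynomial-^ : ∀ {f} n → IsPolynomial f → IsPolynomial (f SE.^ n)
  polynomial-^ zero    p = polynomial-const 1ℚ
  polynomial-^ {f} (suc n) p = polynomial-⊛ {f} {f SE.^ n} p (polynomial-^ n p)

  polynomial-cong : ∀ {f g} → f ≗ g → IsPolynomial f → IsPolynomial g
  polynomial-cong eq (d , z) = d , λ n n≥d → trans (sym (eq n)) (z n n≥d)

  *-≢0 : ∀ {x y} → x ≢ 0ℚ → y ≢ 0ℚ → x * y ≢ 0ℚ
  *-≢0 {x} {y} x≢0 y≢0 xy≡0 = y≢0 (begin
    y                   ≡⟨ ℚₚ.*-identityˡ y ⟨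
    1ℚ * y              ≡⟨ cong (_* y) (ℚₚ.*-inverseˡ x) ⟨
    (ℚ.1/ x * x) * y    ≡⟨ ℚₚ.*-assoc (ℚ.1/ x) x y ⟩
    ℚ.1/ x * (x * y)    ≡⟨ cong (ℚ.1/ x *_) xy≡0 ⟩
    ℚ.1/ x * 0ℚ         ≡⟨ ℚₚ.*-zeroʳ (ℚ.1/ x) ⟩
    0ℚ                  ∎)
    where
    open ≡-Reasoning
    instance
      x-nonZero : ℚ.NonZero x
      x-nonZero = ℚ.≢-nonZero x≢0

  -- Zero constant terms are stripped from either factor until both are nonzero, and these multiply
  -- to a nonzero coefficient. The indices m and n bound the number of steps.
  ⊛-nonzero : ∀ m n f g → f m ≢ 0ℚ → g n ≢ 0ℚ → ∃ λ k → (f ⊛ g) k ≢ 0ℚ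
  ⊛-nonzero m n f g fm gn with f 0 ℚₚ.≟ 0ℚ | g 0 ℚₚ.≟ 0ℚ
  ⊛-nonzero zero    n f g fm gn | yes f0 | _ = contradiction f0 fm
  ⊛-nonzero (suc m) n f g fm gn | yes f0 | _ with ⊛-nonzero m n (tail f) g fm gn
  ... | k , neq = suc k , λ eq → neq
      (trans (sym (trans (cong (_+ (tail f ⊛ g) k) (trans (cong (_* g (suc k)) f0) (ℚₚ.*-zeroˡ (g (suc k)))))
          (ℚₚ.+-identityˡ _))) eq)
  ⊛-nonzero m zero    f g fm gn | no _ | yes g0 = contradiction g0 gn
  ⊛-nonzero m (suc n) f g fm gn | no _ | yes g0 with ⊛-nonzero m n f (tail g) fm gn
  ... | k , neq = suc k , λ eq → neq
      (trans (sym (trans (⊛-tailʳ f g k)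
          (trans (cong (_+ (f ⊛ tail g) k) (trans (cong (f (suc k) *_) g0) (ℚₚ.*-zeroʳ (f (suc k))))) (ℚₚ.+-identityˡ _)))) eq)
  ⊛-nonzero m n f g fm gn | no f0 | no g0 = 0 , λ eq → *-≢0 f0 g0 (trans (sym (⊛-head f g)) eq)

  -- `¬ f ≗ 0S` names no nonzero coefficient, but equality in ℚ is decidable, hence stable, so one
  -- may be assumed.
  ⊛-cancel : ∀ {f g} → ¬ f ≗ 0S → (f ⊛ g) ≗ 0S → g ≗ 0S
  ⊛-cancel {f} {g} f≢0 fg≡0 n = decidable-stable (g n ℚₚ.≟ 0ℚ) λ gn≢0 → f≢0 λ m →
    decidable-stable (f m ℚₚ.≟ 0ℚ) λ fm≢0 → let k , neq = ⊛-nonzero m n f g fm≢0 gn≢0 in neq (fg≡0 k)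

  X^-⊛ʳ : ∀ s f g → (f ⊛ (X^ s · g)) ≗ (X^ s · (f ⊛ g))
  X^-⊛ʳ s f g = S.trans (⊛-comm f (X^ s · g)) (S.trans (X^-⊛ s g f) (X^-cong s (⊛-comm g f)))

  -- The identity Q · c = p in ℚ((X)), multiplied by the power of X that makes it one between power
  -- series.
  record Clears (Q : Series) (c : Laurent) (p : Series) : Set where
    constructor clears
    field
      polynomial : IsPolynomial p
      equation   : (Q ⊛ Laurent.series c) ≗ (X^ Laurent.pole c · p)

  Clears-⊛ : ∀ {Q c p} q → IsPolynomial q → Clears Q c p → Clears (q ⊛ Q) c (q ⊛ p)
  Clears-⊛ {Q} {X^-⟨ s ⟩ h} {p} q poly (clears polyp eq) = clears (polynomial-⊛ {q} poly polyp)
    (S.trans (⊛-assoc q Q h) (S.trans (S.*-congˡ {q} eq) (X^-⊛ʳ s q p)))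

  common-denominator : ∀ {cs} → All IsRationalFunction cs →
                       ∃₂ λ Q ps → IsPolynomial Q × ¬ Q ≗ 0S × Pointwise (Clears Q) cs ps
  common-denominator [] = 1S , [] , polynomial-const 1ℚ , (λ eq → contradiction (eq 0) λ ()) , []
  common-denominator {c ∷ _} ((p , q , polyp , polyq , q≢0 , eq) ∷ rs)
    with Q , ps , polyQ , Q≢0 , cl ← common-denominator rs =
    (q ⊛ Q) , ((Q ⊛ p) ∷ map (q ⊛_) ps) , polynomial-⊛ {q} polyq polyQ , (λ z → Q≢0 (⊛-cancel q≢0 z)) ,
    clears (polynomial-⊛ {Q} polyQ polyp)
           (S.trans (S.*-congʳ (⊛-comm q Q)) (Clears.equation (Clears-⊛ {q} {c} {p} Q polyQ (clears polyp eq)))) ∷ go cl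
    where
    go : ∀ {cs ps} → Pointwise (Clears Q) cs ps → Pointwise (Clears (q ⊛ Q)) cs (map (q ⊛_) ps)
    go []       = []
    go (c ∷ cs) = Clears-⊛ q polyq c ∷ go cs

  Clears-evalAt : ∀ {Q f cs ps} → Pointwise (Clears Q) cs ps →
                  (Q ⊛ Laurent.series (evalAt (fromSeries f) cs)) ≗ (X^ Laurent.pole (evalAt (fromSeries f) cs) · evalS f ps)
  Clears-evalAt {Q} [] = S.zeroʳ Q
  Clears-evalAt {Q} {f} {(X^-⟨ s ⟩ h) ∷ cs} {p ∷ ps} (clears _ eq ∷ cl)
    with evalAt (fromSeries f) cs | Clears-evalAt {Q} {f} cl
  ... | X^-⟨ t ⟩ H | ih = λ n → begin
    (Q ⊛ ((X^ t · h) ⊕ (X^ s · (f ⊛ H)))) n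
      ≡⟨ S.distribˡ Q (X^ t · h) (X^ s · (f ⊛ H)) n ⟩
    (Q ⊛ (X^ t · h)) n + (Q ⊛ (X^ s · (f ⊛ H))) n
      ≡⟨ cong₂ _+_ (X^-⊛ʳ t Q h n) (X^-⊛ʳ s Q (f ⊛ H) n) ⟩
    (X^ t · (Q ⊛ h)) n + (X^ s · (Q ⊛ (f ⊛ H))) n
      ≡⟨ cong₂ _+_ (X^-cong t eq n) (X^-cong s
          (SS.solve 3 (λ q f h → q SS.:* (f SS.:* h) SS.:= f SS.:* (q SS.:* h)) S.refl Q f H) n) ⟩
    (X^ t · (X^ s · p)) n + (X^ s · (f ⊛ (Q ⊛ H))) n
      ≡⟨ cong₂ _+_ (trans (X^-+ t s p n) (cong (λ m → (X^ m · p) n) (ℕₚ.+-comm t s)))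
           (trans (X^-cong s (S.trans (S.*-congˡ {f} ih) (X^-⊛ʳ t f (evalS f ps))) n) (X^-+ s t (f ⊛ evalS f ps) n)) ⟩
    (X^ (s ℕ.+ t) · p) n + (X^ (s ℕ.+ t) · (f ⊛ evalS f ps)) n
      ≡⟨ X^-⊕ (s ℕ.+ t) p (f ⊛ evalS f ps) n ⟨
    (X^ (s ℕ.+ t) · (p ⊕ (f ⊛ evalS f ps))) n ∎
    where open ≡-Reasoning

  Clears-nonzero : ∀ {Q c p} → ¬ Q ≗ 0S → Clears Q c p → ¬ (c ≈ 0L) → ¬ p ≗ 0S
  Clears-nonzero {Q} {X^-⟨ s ⟩ h} {p} Q≢0 (clears _ eq) c≢0 p≡0 = c≢0 λ n → trans
    (⊛-cancel Q≢0 (S.trans eq (S.trans (X^-cong s p≡0) (X^-0S s))) n) (sym (X^-0S s n))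

  Clears-any-nonzero : ∀ {Q cs ps} → ¬ Q ≗ 0S → Pointwise (Clears Q) cs ps → Any (λ c → ¬ (c ≈ 0L)) cs → Any (λ p → ¬ p ≗ 0S) ps
  Clears-any-nonzero Q≢0 (cl ∷ cls) (here c≢0)  = here (Clears-nonzero Q≢0 cl c≢0)
  Clears-any-nonzero Q≢0 (cl ∷ cls) (there any) = there (Clears-any-nonzero Q≢0 cls any)

  Clears-polynomials : ∀ {Q cs ps} → Pointwise (Clears Q) cs ps → All IsPolynomial ps
  Clears-polynomials []         = []
  Clears-polynomials (cl ∷ cls) = Clears.polynomial cl ∷ Clears-polynomials cls

  -- The leading coefficient is kept apart, since it is the multiplier that makes f integral over
  -- ℚ[X]; the degree is the length of `coefficients`.
  record Relation (f : Series) : Set where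
    field
      coefficients : List Series
      leading      : Series
      polynomials  : All IsPolynomial coefficients
      leading-poly : IsPolynomial leading
      leading≢0    : ¬ leading ≗ 0S
      vanishes     : (evalS f coefficients ⊕ ((f SE.^ length coefficients) ⊛ leading)) ≗ 0S

  module _ (em : ExcludedMiddle 0ℓ) where

    private
      Trimmed : Series → List Series → Set
      Trimmed f ps = ∃₂ λ cs a → All IsPolynomial cs × IsPolynomial a × ¬ a ≗ 0S ×
        evalS f ps ≗ (evalS f cs ⊕ ((f SE.^ length cs) ⊛ a))

      -- The last nonzero coefficient is sought from the end of the list, with `em` deciding whether
      -- a coefficient vanishes.
      trim : ∀ f {ps} → All IsPolynomial ps → All (_≗ 0S) ps ⊎ Trimmed f ps
      trim f [] = inj₁ []
      trim f {p ∷ ps} (poly ∷ polys) with trim f polys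
      ... | inj₂ (cs , a , polycs , polya , a≢0 , eq) = inj₂ (p ∷ cs , a , poly ∷ polycs , polya , a≢0 ,
        S.trans (S.+-congˡ {p} (S.*-congˡ {f} eq))
          (SS.solve 5 (λ p f e x a → p SS.:+ f SS.:* (e SS.:+ x SS.:* a) SS.:= (p SS.:+ f SS.:* e) SS.:+ (f SS.:* x)
              SS.:* a) S.refl
            p f (evalS f cs) (f SE.^ length cs) a))
      ... | inj₁ zeros with em {p ≗ 0S}
      ...   | yes p≡0 = inj₁ (p≡0 ∷ zeros)
      ...   | no  p≢0 = inj₂ ([] , p , [] , poly , p≢0 ,
        S.trans (S.+-congˡ {p} (S.*-congˡ {f} (eval-zeros zeros)))
          (SS.solve 2 (λ p f → p SS.:+ f SS.:* SS.con 0 SS.:= SS.con 0 SS.:+ SS.con 1 SS.:* p) S.refl p f))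
        where
        eval-zeros : ∀ {qs} → All (_≗ 0S) qs → evalS f qs ≗ 0S
        eval-zeros []       = S.refl {0S}
        eval-zeros {q ∷ qs} (z ∷ zs) = S.trans (S.+-cong z (S.*-congˡ {f} (eval-zeros zs)))
            (S.trans (S.+-identityˡ (f ⊛ 0S)) (S.zeroʳ f))

      not-all-zero : ∀ {ps} → All (_≗ 0S) ps → ¬ Any (λ p → ¬ p ≗ 0S) ps
      not-all-zero (z ∷ zs) (here nz)   = nz z
      not-all-zero (z ∷ zs) (there any) = not-all-zero zs any

    algebraic⇒relation : ∀ {f} → Algebraic (fromSeries f) → Relation f
    algebraic⇒relation {f} (cs , rational , nonzero , zero-eval)
      with Q , ps , polyQ , Q≢0 , cl ← common-denominator rational
      with trim f (Clears-polynomials cl)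
    ... | inj₁ zeros = contradiction (Clears-any-nonzero Q≢0 cl nonzero) (not-all-zero zeros)
    ... | inj₂ (bs , a , polybs , polya , a≢0 , eq) = record
      { coefficients = bs ; leading = a ; polynomials = polybs ; leading-poly = polya ; leading≢0 = a≢0
      ; vanishes = S.trans (S.sym eq) eval≡0 }
      where
      T = Laurent.pole (evalAt (fromSeries f) cs)
      eval≡0 : evalS f ps ≗ 0S
      eval≡0 n = begin
        evalS f ps n                        ≡⟨ X^-above T (evalS f ps) n ⟨
        (X^ T · evalS f ps) (T ℕ.+ n)       ≡⟨ Clears-evalAt {Q} {f} cl (T ℕ.+ n) ⟨
        (Q ⊛ Laurent.series (evalAt (fromSeries f) cs)) (T ℕ.+ n) ≡⟨ S.*-congˡ {Q} (S.trans zero-eval (X^-0S T)) (T ℕ.+ n) ⟩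
        (Q ⊛ 0S) (T ℕ.+ n)                  ≡⟨ S.zeroʳ Q (T ℕ.+ n) ⟩
        0ℚ                                  ∎
        where open ≡-Reasoning

  -- Multiplying Σ cᵢ fⁱ + a fᵈ by aᵈ⁻¹ makes it monic in a·f, with coefficients cᵢ aᵈ⁻¹⁻ⁱ.
  monicise : Series → List Series → List Series
  monicise a []       = []
  monicise a (c ∷ cs) = (c ⊛ (a SE.^ length cs)) ∷ monicise a cs

  monicise-length : ∀ a cs → length (monicise a cs) ≡ length cs
  monicise-length a []       = refl
  monicise-length a (c ∷ cs) = cong suc (monicise-length a cs)

  monicise-polynomials : ∀ {a cs} → IsPolynomial a → All IsPolynomial cs → All IsPolynomial (monicise a cs)
  monicise-polynomials p [] = []
  monicise-polynomials {cs = c ∷ cs} p (q ∷ qs) = polynomial-⊛ {c} q (polynomial-^ (length cs) p) ∷ monicise-polynomials p qs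

  -- An exponent d - 1 makes no sense for the empty list, hence the additional factor a here. The
  -- companion for nonempty lists is free of it, and the mutual recursion never has to cancel a.
  monicise-eval : ∀ a f cs → (a ⊛ evalS (a ⊛ f) (monicise a cs)) ≗ ((a SE.^ length cs) ⊛ evalS f cs)
  monicise-eval-∷ : ∀ a f c cs → evalS (a ⊛ f) (monicise a (c ∷ cs)) ≗ ((a SE.^ length cs) ⊛ evalS f (c ∷ cs))

  monicise-eval a f []       = S.trans (S.zeroʳ a) (S.sym (S.zeroʳ 1S))
  monicise-eval a f (c ∷ cs) = S.trans (S.*-congˡ {a} (monicise-eval-∷ a f c cs))
      (S.sym (S.*-assoc a (a SE.^ length cs) (evalS f (c ∷ cs))))

  monicise-eval-∷ a f c cs = S.trans
    (S.+-congˡ {c ⊛ x} (S.trans (SS.solve 3 (λ a f e → (a SS.:* f) SS.:* e SS.:= f SS.:* (a SS.:* e)) S.refl a f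
        (evalS (a ⊛ f) (monicise a cs)))
                                (S.*-congˡ {f} (monicise-eval a f cs))))
    (SS.solve 4 (λ c x f e → c SS.:* x SS.:+ f SS.:* (x SS.:* e) SS.:= x SS.:* (c SS.:+ f SS.:* e)) S.refl c x f (evalS f cs))
    where x = a SE.^ length cs

  monic-relation : ∀ {a f c cs} → (evalS f (c ∷ cs) ⊕ ((f SE.^ length (c ∷ cs)) ⊛ a)) ≗ 0S →
                   (((a ⊛ f) SE.^ length (monicise a (c ∷ cs))) ⊕ evalS (a ⊛ f) (monicise a (c ∷ cs))) ≗ 0S
  monic-relation {a} {f} {c} {cs} rel = S.trans
    (S.+-cong (S.trans (SE.^-congʳ (a ⊛ f) (monicise-length a (c ∷ cs))) (SE.^-distrib-* a f (length (c ∷ cs))))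
        (monicise-eval-∷ a f c cs))
    (S.trans (SS.solve 4 (λ a x y e → (a SS.:* x) SS.:* y SS.:+ x SS.:* e SS.:= x SS.:* (e SS.:+ y SS.:* a)) S.refl a x
        (f SE.^ length (c ∷ cs)) (evalS f (c ∷ cs)))
      (S.trans (S.*-congˡ {x} rel) (S.zeroʳ x)))
    where x = a SE.^ length cs

  -- Integrality, growth and Fatou's theorem

  clear-denominators : ∀ d a → (∀ n → d ℕ.≤ n → a n ≡ 0ℚ) → ∃ λ D → ∀ n → IsInteger (ι (suc D) * a n)
  clear-denominators zero a z = 0 , λ n → subst IsInteger
      (sym (trans (cong (ι 1 *_) (z n z≤n)) (trans (ℚₚ.*-zeroʳ (ι 1)) (sym fromℤ-0)))) (_ , refl)
  clear-denominators (suc d) a z with clear-denominators d (tail a) (λ n d≤n → z (suc n) (s≤s d≤n)) | denominator-clears (a 0)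
  -- The successor of this number is the product (D+1)(D₀+1).
  ... | D , int | D₀ , int₀ = D₀ ℕ.+ D ℕ.* suc D₀ , λ
    { zero    → subst IsInteger (trans (sym (ℚₚ.*-assoc (ι (suc D)) (ι (suc D₀)) (a 0)))
        (cong (_* a 0) (sym (ι-* (suc D) (suc D₀))))) (integer-* (_ , refl) int₀)
    ; (suc n) → subst IsInteger (trans
        (solve 3 (λ x y z → x :* (y :* z) := (y :* x) :* z) refl (ι (suc D₀)) (ι (suc D)) (a (suc n)))
                  (cong (_* a (suc n)) (sym (ι-* (suc D) (suc D₀))))) (integer-* (_ , refl) (int n)) }

  integer-⊛ : ∀ {f g} → (∀ n → IsInteger (f n)) → (∀ n → IsInteger (g n)) → ∀ n → IsInteger ((f ⊛ g) n)
  integer-⊛ {f} {g} p q zero    = subst IsInteger (sym (⊛-head f g)) (integer-* (p 0) (q 0))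
  integer-⊛ {f} {g} p q (suc n) = integer-+ (integer-* (p 0) (q (suc n))) (integer-⊛ {tail f} {g} (p ∘ suc) q n)

  Σ<-bound : ∀ n {f c} → (∀ k → k ℕ.< n → f k ≤ c) → Σ< n f ≤ ι n * c
  Σ<-bound zero    {c = c} b = ℚₚ.≤-reflexive (sym (trans (cong (_* c) fromℤ-0) (ℚₚ.*-zeroˡ c)))
  Σ<-bound (suc n) {f} {c} b = begin
    f 0 + Σ< n (f ∘ suc)  ≤⟨ ℚₚ.+-mono-≤ (b 0 (s≤s z≤n)) (Σ<-bound n (λ k k<n → b (suc k) (s≤s k<n))) ⟩
    c + ι n * c           ≡⟨ solve 2 (λ c x → c :+ x :* c := (con 1ℚ :+ x) :* c) refl c (ι n) ⟩
    (1ℚ + ι n) * c        ≡⟨ cong (_* c) (trans (ι-+ 1 n) (cong (_+ ι n) fromℤ-1)) ⟨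
    ι (suc n) * c         ∎
    where open ℚₚ.≤-Reasoning

  LinearGrowth : Series → Set
  LinearGrowth f = ∃ λ C → ∀ n → ∣ f n ∣ ≤ ι (C ℕ.* suc n)

  -- The exponent 2 arises from N coefficients of f, each of order N.
  trunc-growth : ∀ {a f} → IsPolynomial a → LinearGrowth f → PolyNorm (λ N → trunc N (a ⊛ f))
  trunc-growth {a} {f} polya (C , growth) = L ℕ.* C , 2 , λ N → ∥∥-support N (trunc-above N (a ⊛ f)) (begin
    Σ∣ trunc N (a ⊛ f) ∣< N                 ≡⟨ Σ<-cong N (λ k k<N → cong ∣_∣ (trunc-below N (a ⊛ f) k k<N)) ⟩
    Σ∣ a ⊛ f ∣< N                           ≤⟨ Σ∣⊛∣ N a f ⟩
    Σ∣ a ∣< N * Σ∣ f ∣< N                   ≤⟨ *-mono-≤ (0≤Σ∣∣ a N) (partial (proj₂ (polynomial-∥∥ polya)) N) (0≤Σ∣∣ f N)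
                                                 (Σ<-bound N (λ k k<N → ℚₚ.≤-trans (growth k)
                                                     (ι-mono-≤ (ℕₚ.*-monoʳ-≤ C (s≤s (ℕₚ.<⇒≤ k<N)))))) ⟩
    ι L * (ι N * ι (C ℕ.* suc N))           ≡⟨ trans (ι-* L _) (cong (ι L *_) (ι-* N _)) ⟨
    ι (L ℕ.* (N ℕ.* (C ℕ.* suc N)))         ≤⟨ ι-mono-≤ (ℕₚ.*-monoʳ-≤ L (ℕₚ.*-monoˡ-≤ (C ℕ.* suc N) (ℕₚ.n≤1+n N))) ⟩
    ι (L ℕ.* (suc N ℕ.* (C ℕ.* suc N)))
         ≡⟨ cong ι (ℕS.solve 3 (λ l n c → l ℕS.:* (n ℕS.:* (c ℕS.:* n)) ℕS.:= l ℕS.:* c ℕS.:*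
             (n ℕS.:* (n ℕS.:* ℕS.con 1))) refl L (suc N) C) ⟩
    ι (L ℕ.* C ℕ.* suc N ℕ.^ 2)             ∎)
    where
    open ℚₚ.≤-Reasoning
    L = proj₁ (polynomial-∥∥ polya)

  -- The denominator is the leading coefficient a. If a · f were not a polynomial, it would have
  -- nonzero coefficients beyond every index; each adds at least 1 to the sum of squares of the
  -- integral series (D+1) · a · f, which then exceeds any bound.
  fatou : ExcludedMiddle 0ℓ → ∀ {f} → (∀ n → IsInteger (f n)) → LinearGrowth f → Algebraic (fromSeries f) →
          ∃ λ q → IsPolynomial q × ¬ q ≗ 0S × IsPolynomial (q ⊛ f)
  fatou em {f} integral growth algebraic with algebraic⇒relation em algebraic
  -- An equation of degree 0 reads a = 0.
  ... | record { coefficients = [] ; leading≢0 = a≢0 ; leading = a ; vanishes = rel } =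
    contradiction (S.trans (S.sym (SS.solve 1 (λ a → SS.con 0 SS.:+ SS.con 1 SS.:* a SS.:= a) S.refl a)) rel) a≢0
  ... | record { coefficients = c ∷ cs ; leading = a ; polynomials = polys ; leading-poly = polya ; leading≢0 = a≢0 ;
      vanishes = rel }
    with em {IsPolynomial (a ⊛ f)}
  ... | yes p = a , polya , a≢0 , p
  ... | no ¬p = contradiction square-sum (proj₂ bound (proj₁ (large (D² ℕ.* C))))
    where
    g = a ⊛ f
    bound : ∃ λ C → ∀ K → ¬ (ι C ≤ Σ□ g < K)
    bound = integral⇒Σ□-bounded (monicise-polynomials polya polys) (monic-relation {a} {f} {c} {cs} rel)
        (trunc-growth polya growth)
    D = proj₁ (clear-denominators (proj₁ polya) a (proj₂ polya))
    Dg-integral : ∀ n → IsInteger (ι (suc D) * g n)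
    Dg-integral n = subst IsInteger (•-⊛ (ι (suc D)) a f n)
      (integer-⊛ {ι (suc D) • a} {f} (proj₂ (clear-denominators (proj₁ polya) a (proj₂ polya))) integral n)
    nonzero-beyond : ∀ N → ∃ λ n → N ℕ.≤ n × g n ≢ 0ℚ
    nonzero-beyond N with em {∃ λ n → N ℕ.≤ n × g n ≢ 0ℚ}
    ... | yes p = p
    ... | no ¬∃ = contradiction (N , λ n N≤n → decidable-stable (g n ℚₚ.≟ 0ℚ) λ gn≢0 → ¬∃ (n , N≤n , gn≢0)) ¬p
    D² = suc D ℕ.* suc D
    large : ∀ c → ∃ λ K → ι c ≤ ι D² * Σ□ g < K
    large zero = 0 , ℚₚ.≤-reflexive (trans fromℤ-0 (sym (ℚₚ.*-zeroʳ (ι D²))))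
    large (suc c) with K , le ← large c with n , K≤n , gn≢0 ← nonzero-beyond K = suc n , (begin
      ι (suc c)                                ≡⟨ trans (cong ι (ℕₚ.+-comm 1 c)) (trans (ι-+ c 1) (cong (ι c +_) fromℤ-1)) ⟩
      ι c + 1ℚ
           ≤⟨ ℚₚ.+-mono-≤ (ℚₚ.≤-trans le (*-monoˡ (0≤ι D²) (Σ<-monoˡ (λ k → 0≤square (g k)) K≤n)))
                                                    (integer-square (Dg-integral n) (*-≢0 ιD≢0 gn≢0)) ⟩
      ι D² * Σ□ g < n + (ι (suc D) * g n) * (ι (suc D) * g n)
        ≡⟨ cong (ι D² * Σ□ g < n +_) (trans
            (solve 2 (λ d x → (d :* x) :* (d :* x) := (d :* d) :* (x :* x)) refl (ι (suc D)) (g n))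
                                           (cong (_* (g n * g n)) (sym (ι-* (suc D) (suc D))))) ⟩
      ι D² * Σ□ g < n + ι D² * (g n * g n)     ≡⟨ ℚₚ.*-distribˡ-+ (ι D²) _ _ ⟨
      ι D² * (Σ□ g < n + g n * g n)            ≡⟨ cong (ι D² *_) (Σ<-suc n (λ k → g k * g k)) ⟨
      ι D² * Σ□ g < (suc n)                    ∎)
      where
      open ℚₚ.≤-Reasoning
      ιD≢0 : ι (suc D) ≢ 0ℚ
      ιD≢0 eq = contradiction (ι-injective (trans eq (sym fromℤ-0))) λ ()
    C = proj₁ bound
    square-sum : ι C ≤ Σ□ g < (proj₁ (large (D² ℕ.* C)))
    square-sum = ι-cancelˡ (D ℕ.+ D ℕ.* suc D)
        (subst (_≤ ι D² * Σ□ g < (proj₁ (large (D² ℕ.* C)))) (ι-* D² C) (proj₂ (large (D² ℕ.* C))))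

  -- Recurrences and eventual periodicity

  Determined : ∀ {A : Set} → (ℕ → A) → Set
  Determined f = ∃₂ λ L N → ∀ i j → i ℕ.≥ N → j ℕ.≥ N →
    (∀ t → t ℕ.< L → f (i ℕ.+ t) ≡ f (j ℕ.+ t)) → f (i ℕ.+ L) ≡ f (j ℕ.+ L)

  -- As q has degree at most L, the coefficient of index i + L involves only the values of f from i
  -- to i + L.
  ⊛-window : ∀ L {q} → Degree≤ L q → ∀ f i → (q ⊛ f) (i ℕ.+ L) ≡ (q ⊛ (λ t → f (i ℕ.+ t))) L
  ⊛-window zero {q} deg f i = begin
    (q ⊛ f) (i ℕ.+ 0)            ≡⟨ ⊛-cong {q} {const (q 0)} {f} {f}
        (λ { zero → refl ; (suc k) → deg (suc k) (s≤s z≤n) }) (λ _ → refl) (i ℕ.+ 0) ⟩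
    (const (q 0) ⊛ f) (i ℕ.+ 0)  ≡⟨ const-⊛ (q 0) f (i ℕ.+ 0) ⟩
    q 0 * f (i ℕ.+ 0)            ≡⟨ ℚₚ.+-identityʳ _ ⟨
    q 0 * f (i ℕ.+ 0) + 0ℚ       ∎
    where open ≡-Reasoning
  ⊛-window (suc L) {q} deg f i = begin
    (q ⊛ f) (i ℕ.+ suc L)        ≡⟨ cong (q ⊛ f) (ℕₚ.+-suc i L) ⟩
    q 0 * f (suc (i ℕ.+ L)) + (tail q ⊛ f) (i ℕ.+ L)
      ≡⟨ cong₂ _+_ (cong (λ n → q 0 * f n) (sym (ℕₚ.+-suc i L))) (⊛-window L {tail q} (λ k L<k → deg (suc k) (s≤s L<k)) f i) ⟩
    q 0 * f (i ℕ.+ suc L) + (tail q ⊛ (λ t → f (i ℕ.+ t))) L ∎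
    where open ≡-Reasoning

  *-cancelˡ-≡ : ∀ {q x y} → q ≢ 0ℚ → q * x ≡ q * y → x ≡ y
  *-cancelˡ-≡ {q} {x} {y} q≢0 eq = begin
    x                   ≡⟨ step x ⟩
    ℚ.1/ q * (q * x)    ≡⟨ cong (ℚ.1/ q *_) eq ⟩
    ℚ.1/ q * (q * y)    ≡⟨ step y ⟨
    y                   ∎
    where
    open ≡-Reasoning
    instance
      q-nonZero : ℚ.NonZero q
      q-nonZero = ℚ.≢-nonZero q≢0
    step : ∀ z → z ≡ ℚ.1/ q * (q * z)
    step z = sym (trans (sym (ℚₚ.*-assoc (ℚ.1/ q) q z)) (trans (cong (_* z) (ℚₚ.*-inverseˡ q)) (ℚₚ.*-identityˡ z)))

  -- The value of index L enters with the factor q 0 only and can be solved for.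
  ⊛-top : ∀ L {q u v} → q 0 ≢ 0ℚ → (q ⊛ u) L ≡ (q ⊛ v) L → (∀ t → t ℕ.< L → u t ≡ v t) → u L ≡ v L
  ⊛-top zero {q} {u} {v} q0 eq agree = *-cancelˡ-≡ q0 (trans (sym (⊛-head q u)) (trans eq (⊛-head q v)))
  ⊛-top (suc L) {q} {u} {v} q0 eq agree = *-cancelˡ-≡ q0 (∙-cancelʳ ((tail q ⊛ u) L) (q 0 * u (suc L)) (q 0 * v (suc L))
    (trans eq (cong (q 0 * v (suc L) +_)
        (⊛-cong-below L {tail q} {tail q} {v} {u} (λ _ _ → refl) (λ k k≤L → sym (agree k (s≤s k≤L)))))))

  -- `Determined` expresses a recurrence without naming its function. While q 0 = 0, q is divided by
  -- X; once q 0 ≠ 0, the vanishing coefficients of q · f can be solved for the latest value of f.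
  rational⇒determined : ∀ d {q f} → (∀ n → d ℕ.≤ n → q n ≡ 0ℚ) → ¬ q ≗ 0S → IsPolynomial (q ⊛ f) → Determined f
  rational⇒determined zero    z q≢0 poly = contradiction (λ n → z n z≤n) q≢0
  rational⇒determined (suc d) {q} {f} z q≢0 poly@(N , zero-beyond) with q 0 ℚₚ.≟ 0ℚ
  ... | yes q0 = rational⇒determined d {tail q} {f} (λ n d≤n → z (suc n) (s≤s d≤n))
    (λ tail≡0 → q≢0 λ { zero → q0 ; (suc n) → tail≡0 n })
    (N , λ n n≥N → trans (sym (trans
        (cong (_+ (tail q ⊛ f) n) (trans (cong (_* f (suc n)) q0) (ℚₚ.*-zeroˡ (f (suc n))))) (ℚₚ.+-identityˡ _)))
                         (zero-beyond (suc n) (ℕₚ.m≤n⇒m≤1+n n≥N)))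
  ... | no q0≢0 = d , N , λ i j i≥N j≥N → ⊛-top d {q} {λ t → f (i ℕ.+ t)} {λ t → f (j ℕ.+ t)} q0≢0
    (trans (vanish i i≥N) (sym (vanish j j≥N)))
    where
    vanish : ∀ i → i ℕ.≥ N → (q ⊛ (λ t → f (i ℕ.+ t))) d ≡ 0ℚ
    vanish i i≥N = trans (sym (⊛-window d {q} z f i)) (zero-beyond (i ℕ.+ d) (ℕₚ.≤-trans i≥N (ℕₚ.m≤m+n i d)))

  -- A window of L values has at most M^L codes under c, so two of the windows beginning at N, ...,
  -- N + M^L have the same code. Each window determines the next value, so the two agree from then
  -- on.
  determined⇒periodic : ∀ {A : Set} {M} {f : ℕ → A} (c : ℕ → Fin M) (v : Fin M → A) → (∀ n → f n ≡ v (c n)) →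
                        Determined f → Periodic f
  determined⇒periodic {M = M} {f} c v f≡vc (L , N , next) =
    -- The preperiod is I + L because `next-window` compares the values that follow the two windows.
    I ℕ.+ L , J ∸ I , ℕₚ.m<n⇒0<n∸m I<J , λ n n≥ → begin
      f (n ℕ.+ (J ∸ I))                        ≡⟨ cong (λ m → f (m ℕ.+ (J ∸ I))) (ℕₚ.m+[n∸m]≡n n≥) ⟨
      f (I ℕ.+ L ℕ.+ (n ∸ (I ℕ.+ L)) ℕ.+ (J ∸ I)) ≡⟨ cong f (reorder (n ∸ (I ℕ.+ L))) ⟩
      f (J ℕ.+ (n ∸ (I ℕ.+ L)) ℕ.+ L)          ≡⟨ next-window (n ∸ (I ℕ.+ L)) ⟨
      f (I ℕ.+ (n ∸ (I ℕ.+ L)) ℕ.+ L)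
           ≡⟨ cong f (ℕS.solve 3 (λ i m l → i ℕS.:+ m ℕS.:+ l ℕS.:= i ℕS.:+ l ℕS.:+ m) refl I (n ∸ (I ℕ.+ L)) L) ⟩
      f (I ℕ.+ L ℕ.+ (n ∸ (I ℕ.+ L)))          ≡⟨ cong f (ℕₚ.m+[n∸m]≡n n≥) ⟩
      f n                                      ∎
    where
    open ≡-Reasoning
    windowAt : Fin (suc (M ℕ.^ L)) → Fin L → Fin M
    windowAt i t = c (N ℕ.+ toℕ i ℕ.+ toℕ t)
    collision = Finₚ.pigeonhole (ℕₚ.n<1+n (M ℕ.^ L)) (λ i → funToFin (windowAt i))
    i₀ = proj₁ collision
    j₀ = proj₁ (proj₂ collision)
    I = N ℕ.+ toℕ i₀
    J = N ℕ.+ toℕ j₀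
    I<J : I ℕ.< J
    I<J = ℕₚ.+-monoʳ-< N (proj₁ (proj₂ (proj₂ collision)))
    windows-agree : ∀ t → windowAt i₀ t ≡ windowAt j₀ t
    windows-agree t = trans (sym (Finₚ.finToFun-funToFin (windowAt i₀) t))
      (trans (cong (λ x → finToFun x t) (proj₂ (proj₂ (proj₂ collision)))) (Finₚ.finToFun-funToFin (windowAt j₀) t))
    window : ∀ n t → t ℕ.< L → f (I ℕ.+ n ℕ.+ t) ≡ f (J ℕ.+ n ℕ.+ t)
    next-window : ∀ n → f (I ℕ.+ n ℕ.+ L) ≡ f (J ℕ.+ n ℕ.+ L)
    next-window n = next (I ℕ.+ n) (J ℕ.+ n) (ℕₚ.≤-trans (ℕₚ.m≤m+n N _) (ℕₚ.m≤m+n I n))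
      (ℕₚ.≤-trans (ℕₚ.m≤m+n N _) (ℕₚ.m≤m+n J n)) (window n)
    window zero t t<L rewrite ℕₚ.+-identityʳ I | ℕₚ.+-identityʳ J = trans (f≡vc (I ℕ.+ t)) (trans (cong v
      (subst (λ s → c (I ℕ.+ s) ≡ c (J ℕ.+ s)) (Finₚ.toℕ-fromℕ< t<L) (windows-agree (fromℕ< t<L)))) (sym (f≡vc (J ℕ.+ t))))
    window (suc n) t t<L with suc t ℕₚ.<? L
    ... | yes t+1<L = subst₂ (λ x y → f x ≡ f y) (shift I) (shift J) (window n (suc t) t+1<L)
      where
      shift : ∀ x → x ℕ.+ n ℕ.+ suc t ≡ x ℕ.+ suc n ℕ.+ t
      shift x = ℕS.solve 3 (λ x n t → x ℕS.:+ n ℕS.:+ (ℕS.con 1 ℕS.:+ t) ℕS.:= x ℕS.:+ (ℕS.con 1 ℕS.:+ n) ℕS.:+ t) refl x n t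
    -- Here t = L - 1: the entry is the one just appended, supplied by `next-window`.
    ... | no t+1≮L with ℕₚ.≤-antisym (ℕₚ.≮⇒≥ t+1≮L) t<L
    ...   | refl = subst₂ (λ x y → f x ≡ f y) (shift I) (shift J) (next-window n)
      where
      shift : ∀ x → x ℕ.+ n ℕ.+ suc t ≡ x ℕ.+ suc n ℕ.+ t
      shift x = ℕS.solve 3 (λ x n t → x ℕS.:+ n ℕS.:+ (ℕS.con 1 ℕS.:+ t) ℕS.:= x ℕS.:+ (ℕS.con 1 ℕS.:+ n) ℕS.:+ t) refl x n t
    reorder : ∀ m → I ℕ.+ L ℕ.+ m ℕ.+ (J ∸ I) ≡ J ℕ.+ m ℕ.+ L
    reorder m = trans (ℕS.solve 4 (λ i l m x → i ℕS.:+ l ℕS.:+ m ℕS.:+ x ℕS.:= (i ℕS.:+ x) ℕS.:+ m ℕS.:+ l) refl I L m (J ∸ I))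
      (cong (λ x → x ℕ.+ m ℕ.+ L) (ℕₚ.m+[n∸m]≡n (ℕₚ.<⇒≤ I<J)))

  -- Eventually periodic series are rational

  1-X^ : ℕ → Series
  1-X^ e = 1S ⊕ (X^ e · const (- 1ℚ))

  1-X^-polynomial : ∀ e → IsPolynomial (1-X^ e)
  1-X^-polynomial e = suc e , λ { (suc n) (s≤s e≤n) → trans (ℚₚ.+-identityˡ _) (X^const-high e (- 1ℚ) (suc n) (s≤s e≤n)) }

  1-X^-nonzero : ∀ e → e ℕ.≥ 1 → ¬ 1-X^ e ≗ 0S
  1-X^-nonzero (suc e) _ eq = contradiction (eq 0) λ ()

  1-X^-⊛ : ∀ e f → (1-X^ e ⊛ f) ≗ (f ⊕ (X^ e · (⊖ f)))
  1-X^-⊛ e f n = begin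
    (1-X^ e ⊛ f) n                                     ≡⟨ ⊛-distribʳ f 1S (X^ e · const (- 1ℚ)) n ⟩
    (1S ⊛ f) n + ((X^ e · const (- 1ℚ)) ⊛ f) n         ≡⟨ cong₂ _+_ (S.*-identityˡ f n) (X^-⊛ e (const (- 1ℚ)) f n) ⟩
    f n + (X^ e · (const (- 1ℚ) ⊛ f)) n                ≡⟨ cong (f n +_) (X^-cong e (λ k → trans (const-⊛ (- 1ℚ) f k)
                                                            (solve 1 (λ x → con (- 1ℚ) :* x := :- x) refl (f k))) n) ⟩
    f n + (X^ e · (⊖ f)) n                             ∎
    where open ≡-Reasoning

  1-X^-difference : ∀ e f n → (1-X^ e ⊛ f) (e ℕ.+ n) ≡ f (e ℕ.+ n) ℚ.- f n
  1-X^-difference e f n = trans (1-X^-⊛ e f (e ℕ.+ n)) (cong (f (e ℕ.+ n) +_) (X^-above e (⊖ f) n))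

  periodic⇒polynomial : ∀ {f} → ((N , d , _) : Periodic f) → IsPolynomial (1-X^ d ⊛ f)
  periodic⇒polynomial {f} (N , d , _ , per) = d ℕ.+ N , λ n n≥ → subst (λ m → (1-X^ d ⊛ f) m ≡ 0ℚ)
    (trans (sym (ℕₚ.+-assoc d N (n ∸ (d ℕ.+ N)))) (ℕₚ.m+[n∸m]≡n n≥)) (vanish (N ℕ.+ (n ∸ (d ℕ.+ N))) (ℕₚ.m≤m+n N _))
    where
    vanish : ∀ n → n ℕ.≥ N → (1-X^ d ⊛ f) (d ℕ.+ n) ≡ 0ℚ
    vanish n n≥N = trans (1-X^-difference d f n)
      (trans (cong (ℚ._- f n) (trans (cong f (ℕₚ.+-comm d n)) (per n n≥N))) (ℚₚ.+-inverseʳ (f n)))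

  polynomial⇒rational : ∀ {p} → IsPolynomial p → IsRationalFunction (fromSeries p)
  polynomial⇒rational {p} poly = p , 1S , poly , polynomial-const 1ℚ , (λ eq → contradiction (eq 0) λ ()) , S.*-identityˡ p

  rational⇒algebraic : ∀ {q f} → IsPolynomial q → ¬ q ≗ 0S → IsPolynomial (q ⊛ f) → Algebraic (fromSeries f)
  rational⇒algebraic {q} {f} polyq q≢0 (d , z) =
    -- The linear equation -q·f + q·Y = 0.
    fromSeries (⊖ (q ⊛ f)) ∷ fromSeries q ∷ [] ,
    polynomial⇒rational (d , λ n n≥d → cong -_ (z n n≥d)) ∷ polynomial⇒rational polyq ∷ [] ,
    there (here q≢0) ,
    λ n → trans (cong (- (q ⊛ f) n +_) (SS.solve 2 (λ q f → f SS.:* (q SS.:+ f SS.:* SS.con 0) SS.:= q SS.:* f) S.refl q f n))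
                (ℚₚ.+-inverseˡ ((q ⊛ f) n))

  periodic⇒algebraic : ∀ {f} → Periodic f → Algebraic (fromSeries f)
  periodic⇒algebraic {f} per@(N , d , d≥1 , _) = rational⇒algebraic {1-X^ d} {f} (1-X^-polynomial d)
      (1-X^-nonzero d d≥1) (periodic⇒polynomial per)

  -- 1 - X^e makes f eventually constant, and 1 - X turns the result into a polynomial.
  affine-periodic⇒algebraic : ∀ {f} N e c → e ℕ.≥ 1 → (∀ n → n ℕ.≥ N → f (n ℕ.+ e) ≡ f n + c) → Algebraic (fromSeries f)
  affine-periodic⇒algebraic {f} N e c e≥1 step = rational⇒algebraic {1-X^ 1 ⊛ 1-X^ e} {f}
    (polynomial-⊛ {1-X^ 1} (1-X^-polynomial 1) (1-X^-polynomial e))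
    (λ z → 1-X^-nonzero e e≥1 (⊛-cancel (1-X^-nonzero 1 (s≤s z≤n)) z))
    (polynomial-cong (S.sym (S.*-assoc (1-X^ 1) (1-X^ e) f)) (periodic⇒polynomial (e ℕ.+ N , 1 , s≤s z≤n , constant)))
    where
    value : ∀ n → n ℕ.≥ N → (1-X^ e ⊛ f) (e ℕ.+ n) ≡ c
    value n n≥N = trans (1-X^-difference e f n) (trans (cong (ℚ._- f n) (trans (cong f (ℕₚ.+-comm e n)) (step n n≥N)))
      (solve 2 (λ x c → x :+ c :- x := c) refl (f n) c))
    value′ : ∀ n → n ℕ.≥ e ℕ.+ N → (1-X^ e ⊛ f) n ≡ c
    value′ n n≥ = subst (λ m → (1-X^ e ⊛ f) m ≡ c) (ℕₚ.m+[n∸m]≡n (ℕₚ.≤-trans (ℕₚ.m≤m+n e N) n≥))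
      (value (n ∸ e) (ℕₚ.≤-trans (ℕₚ.≤-reflexive (sym (ℕₚ.m+n∸m≡n e N))) (ℕₚ.∸-monoˡ-≤ e n≥)))
    constant : ∀ n → n ℕ.≥ e ℕ.+ N → (1-X^ e ⊛ f) (n ℕ.+ 1) ≡ (1-X^ e ⊛ f) n
    constant n n≥ = trans (value′ (n ℕ.+ 1) (ℕₚ.≤-trans n≥ (ℕₚ.m≤m+n n 1))) (sym (value′ n n≥))

-- The two generating series of a letter

open import Data.Integer using (+_)
open import Data.Rational using (∣_∣)
open import Data.Nat using (_≤_)
open import Data.Fin using (_<_)

1≤ι-suc : ∀ n → 1ℚ ℚ.≤ ι (suc n)
1≤ι-suc n = subst (ℚ._≤ ι (suc n)) fromℤ-1 (ι-mono-≤ (s≤s z≤n))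

integer-0 : IsInteger 0ℚ
integer-0 = + 0 , sym fromℤ-0

Periodic-map : ∀ {A B : Set} {s : ℕ → A} {t : ℕ → B} → (∀ m n → s m ≡ s n → t m ≡ t n) → Periodic s → Periodic t
Periodic-map f (N , d , d≥1 , per) = N , d , d≥1 , λ n n≥N → f (n ℕ.+ d) n (per n n≥N)

finite-valued-algebraic⇒periodic : ExcludedMiddle 0ℓ → ∀ {M f} → (∀ n → IsInteger (f n)) → LinearGrowth f →
  (c : ℕ → Fin M) (v : Fin M → ℚ) → (∀ n → f n ≡ v (c n)) → Algebraic (fromSeries f) → Periodic f
finite-valued-algebraic⇒periodic em integral growth c v f≡vc algebraic =
  let q , (d , z) , q≢0 , poly = fatou em integral growth algebraic
  in determined⇒periodic c v f≡vc (rational⇒determined d {q} z q≢0 poly)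

module _ {k} (w : InfWord k) (a : Fin k) where

  C-transcendental : ExcludedMiddle 0ℓ → ¬ Periodic (indicator w a) → Transcendental (C-series w a)
  C-transcendental em ap algebraic = ap (Periodic-map same
    (finite-valued-algebraic⇒periodic em integral (1 , growth) digit value value-digit algebraic))
    where
    integral : ∀ n → IsInteger (C-series w a n)
    integral n with does (w n Fin.≟ a)
    ... | true  = + 1 , sym fromℤ-1
    ... | false = integer-0
    growth : ∀ n → ∣ C-series w a n ∣ ℚ.≤ ι (1 ℕ.* suc n)
    growth n with does (w n Fin.≟ a)
    ... | true  = 1≤ι-suc (n ℕ.+ 0)
    ... | false = 0≤ι (1 ℕ.* suc n)
    digit : ℕ → Fin 2
    digit n = if does (w n Fin.≟ a) then suc zero else zero
    value : Fin 2 → ℚ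
    value zero    = 0ℚ
    value (suc _) = 1ℚ
    value-digit : ∀ n → C-series w a n ≡ value (digit n)
    value-digit n with does (w n Fin.≟ a)
    ... | true  = refl
    ... | false = refl
    same : ∀ m n → C-series w a m ≡ C-series w a n → indicator w a m ≡ indicator w a n
    same m n eq with does (w m Fin.≟ a) | does (w n Fin.≟ a)
    ... | true  | true  = refl
    ... | false | false = refl

  C-algebraic : EventuallyPeriodic w → Algebraic (fromSeries (C-series w a))
  C-algebraic per = periodic⇒algebraic
      (Periodic-map {t = C-series w a} (λ m n eq → cong (λ b → if does (b Fin.≟ a) then 1ℚ else 0ℚ) eq) per)

-- P enters only through its two equations, so its coefficients are handled as `ι (pos n)` without
-- reducing fractions. The index n + 1 in `P-suc` reflects that occurrences are counted from 1.
module PositionSeries {k} (w : InfWord k) (a : Fin k)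
  (pos : ℕ → ℕ) (correct : ∀ n → IsPosition w a (suc n) (pos n))
  (P : Series) (P-zero : P 0 ≡ 0ℚ) (P-suc : ∀ n → P (suc n) ≡ ι (pos n)) where

  open Positions w a pos correct
  open Count w a

  P-integral : ∀ n → IsInteger (P n)
  P-integral zero    = subst IsInteger (sym P-zero) integer-0
  P-integral (suc n) = + pos n , P-suc n

  P-algebraic : EventuallyPeriodic w → Algebraic (fromSeries P)
  P-algebraic per =
    let N , e , d , e≥1 , affine = periodic⇒pos-affine per
    -- The threshold is `suc N`, as the coefficient of index n + 1 is `pos n`.
    in affine-periodic⇒algebraic (suc N) e (ι d) e≥1 λ
      { (suc n) (s≤s n≥N) → trans (P-suc (n ℕ.+ e))
          (trans (cong ι (affine n n≥N)) (trans (ι-+ (pos n) d) (cong (ℚ._+ ι d) (sym (P-suc n))))) }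

  module _ (G : ℕ) (occurrence : ∀ m → ∃ λ n → m ≤ n × n ℕ.< m ℕ.+ G × w n ≡ a) where

    pos-0≤ : pos 0 ≤ G
    pos-0≤ with occurrence 0
    ... | x , _ , x<G , eq = ℕₚ.≤-trans (pos-minimal eq z≤n) (ℕₚ.<⇒≤ x<G)

    pos-suc≤ : ∀ n → pos (suc n) ≤ pos n ℕ.+ G
    pos-suc≤ n with occurrence (suc (pos n))
    ... | x , pos<x , x< , eq = ℕₚ.≤-trans
      (pos-minimal eq (subst (ℕ._< count x) (count-pos n) (count-strict (w-pos n) pos<x))) (ℕₚ.≤-pred x<)

    pos≤ : ∀ n → pos n ≤ G ℕ.* suc n
    pos≤ zero    = subst (pos 0 ≤_) (sym (ℕₚ.*-identityʳ G)) pos-0≤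
    pos≤ (suc n) = ℕₚ.≤-trans (pos-suc≤ n) (ℕₚ.≤-trans (ℕₚ.+-monoˡ-≤ G (pos≤ n))
      (ℕₚ.≤-reflexive (trans (ℕₚ.+-comm (G ℕ.* suc n) G) (sym (ℕₚ.*-suc G (suc n))))))

    P-growth : ∀ n → ∣ P n ∣ ℚ.≤ ι (G ℕ.* suc n)
    P-growth zero    = subst (λ x → ∣ x ∣ ℚ.≤ ι (G ℕ.* 1)) (sym P-zero) (0≤ι (G ℕ.* 1))
    P-growth (suc n) = subst (ℚ._≤ ι (G ℕ.* suc (suc n))) (sym (trans (cong ∣_∣ (P-suc n)) (ℚₚ.0≤p⇒∣p∣≡p (0≤ι (pos n)))))
      (ι-mono-≤ (ℕₚ.≤-trans (pos≤ n) (ℕₚ.*-monoʳ-≤ G (ℕₚ.n≤1+n (suc n)))))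

    ΔP : Series
    ΔP = 1-X^ 1 ⊛ P

    -- As P 0 = 0, the series (1 - X) · P begins with 0 and `pos 0`, and its coefficients are gaps
    -- from index 2 on.
    increment : ℕ → ℕ
    increment zero          = 0
    increment (suc zero)    = pos 0
    increment (suc (suc n)) = gap n

    ΔP-increment : ∀ n → ΔP n ≡ ι (increment n)
    ΔP-increment zero          = trans (⊛-head (1-X^ 1) P)
        (trans (cong (1-X^ 1 0 ℚ.*_) P-zero) (trans (ℚₚ.*-zeroʳ (1-X^ 1 0)) (sym fromℤ-0)))
    ΔP-increment (suc zero)    = trans (1-X^-difference 1 P 0)
        (trans (cong (λ x → P 1 ℚ.- x) P-zero) (trans (ℚₚ.+-identityʳ (P 1)) (P-suc 0)))
    ΔP-increment (suc (suc n)) = begin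
      ΔP (suc (suc n))                          ≡⟨ 1-X^-difference 1 P (suc n) ⟩
      P (suc (suc n)) ℚ.- P (suc n)             ≡⟨ cong₂ ℚ._-_ (P-suc (suc n)) (P-suc n) ⟩
      ι (pos (suc n)) ℚ.- ι (pos n)
           ≡⟨ cong (λ x → x ℚ.- ι (pos n)) (trans (cong ι (pos-suc n)) (ι-+ (pos n) (gap n))) ⟩
      (ι (pos n) ℚ.+ ι (gap n)) ℚ.- ι (pos n)   ≡⟨ solve 2 (λ x y → x :+ y :- x := y) refl (ι (pos n)) (ι (gap n)) ⟩
      ι (gap n)                                 ∎
      where open ≡-Reasoning

    increment≤ : ∀ n → increment n ≤ G
    increment≤ zero          = z≤n
    increment≤ (suc zero)    = pos-0≤
    increment≤ (suc (suc n)) = ℕₚ.≤-trans (ℕₚ.∸-monoˡ-≤ (pos n) (pos-suc≤ n)) (ℕₚ.≤-reflexive (ℕₚ.m+n∸m≡n (pos n) G))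

    -- P itself is unbounded, whereas its increments take at most G + 1 values; the denominator q of
    -- P clears `ΔP` as well.
    ΔP-periodic : ∃ (λ q → IsPolynomial q × ¬ q ≗ 0S × IsPolynomial (q ⊛ P)) → Periodic ΔP
    ΔP-periodic (q , (d , z) , q≢0 , poly) = determined⇒periodic (λ n → fromℕ< (s≤s (increment≤ n))) (ι ∘ toℕ)
      (λ n → trans (ΔP-increment n) (cong ι (sym (Finₚ.toℕ-fromℕ< (s≤s (increment≤ n))))))
      (rational⇒determined d {q} z q≢0
        (polynomial-cong (SS.solve 3 (λ x q p → x SS.:* (q SS.:* p) SS.:= q SS.:* (x SS.:* p)) S.refl (1-X^ 1) q P)
          (polynomial-⊛ {1-X^ 1} (1-X^-polynomial 1) poly)))

    gap-periodic : Periodic ΔP → Periodic gap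
    gap-periodic (N , e , e≥1 , per) = N , e , e≥1 , λ n n≥N → ι-injective
      (trans (sym (ΔP-increment (suc (suc (n ℕ.+ e)))))
          (trans (per (suc (suc n)) (ℕₚ.m≤n⇒m≤1+n (ℕₚ.m≤n⇒m≤1+n n≥N))) (ΔP-increment (suc (suc n)))))

    P-transcendental : ExcludedMiddle 0ℓ → ¬ Periodic (indicator w a) → Transcendental P
    P-transcendental em ap algebraic =
      ap (gap-periodic⇒indicator-periodic (gap-periodic (ΔP-periodic (fatou em P-integral (G , P-growth) algebraic))))

theorem4p2 : ExcludedMiddle 0ℓ →
    (k : ℕ) → 2 ≤ k →
    (σ : Substitution k) (prim : Primitive σ) →
    (w : InfWord k) (fix : FixedPoint σ w) →
    let C = C-series w
        P = P-series σ prim w fix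
        cond-i   = ¬ EventuallyPeriodic w
        cond-ii  = ∃ λ (i : Fin k) → Transcendental (C i)
        cond-iii = ∃₂ λ (i j : Fin k) → i < j × Transcendental (C i) × Transcendental (C j)
        cond-iv  = ∃ λ (i : Fin k) → Transcendental (P i)
        cond-v   = ∃₂ λ (i j : Fin k) → i < j × Transcendental (P i) × Transcendental (P j)
    in (cond-i ⇔ Aperiodic σ) × (cond-i ⇔ cond-ii) × (cond-i ⇔ cond-iii) × (cond-i ⇔ cond-iv) × (cond-i ⇔ cond-v)
theorem4p2 em k k≥2 σ prim w fix =
  mk⇔ (λ ap → w , fix , ap) (λ (w′ , fix′ , ap) per → ap (fixed-points-periodic k≥2 σ prim fix fix′ per)) ,
  mk⇔ (λ ap → let i , _ , _ , pi , _ = letters ap in i , C-transcendental w i em pi)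
      (λ (i , t) per → t (C-algebraic w i per)) ,
  mk⇔ (λ ap → let i , j , i<j , pi , pj = letters ap in i , j , i<j , C-transcendental w i em pi , C-transcendental w j em pj)
      (λ (i , _ , _ , t , _) per → t (C-algebraic w i per)) ,
  mk⇔ (λ ap → let i , _ , _ , pi , _ = letters ap in i , P-transcendental i em pi)
      (λ (i , t) per → t (PS.P-algebraic i per)) ,
  mk⇔ (λ ap → let i , j , i<j , pi , pj = letters ap in i , j , i<j , P-transcendental i em pi , P-transcendental j em pj)
      (λ (i , _ , _ , t , _) per → t (PS.P-algebraic i per))
  where
  -- The same two letters serve all four conditions on series, since an indicator that is not
  -- eventually periodic makes both C and P transcendental.
  letters = two-aperiodic-letters em k≥2 w
  module PS (a : Fin k) = PositionSeries w a (position σ prim w fix a) (position-correct σ prim w fix a)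
    (P-series σ prim w fix a) refl (λ n → sym (fromℤ-def (+ position σ prim w fix a n)))
  P-transcendental : ∀ a → ExcludedMiddle 0ℓ → ¬ Periodic (indicator w a) → Transcendental (P-series σ prim w fix a)
  P-transcendental a = let G , occurrence = Gaps.bounded-gaps σ prim w fix in PS.P-transcendental a G (occurrence a)
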